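{- There exist a function $f$ with $f(n)=o(n)$ and a constant $C$ such that for all integers $m\ge1$, $0\le n\le m$, and every $S\subseteq[m]$ with $|S|=n$, there is an indexable dictionary for $S$ (supporting $\mathrm{rank}(x,S)$ and $\mathrm{select}(i,S)$ in constant time on the word RAM with word size $\Theta(\lg m)$) that uses at most $n\lceil\lg m\rceil+f(n)+C\lg\lg m$ bits of space.
   Context: $[m]=\{0,\dots,m-1\}$, $\lg=\log_2$. $\mathrm{rank}(x,S)$ returns $-1$ if $x\notin S$ and $|\{y\in S:y<x\}|$ otherwise; $\mathrm{select}(i,S)$ returns the $i$-th smallest element of $S$. Word RAM: words of $w$ bits with constant-time arithmetic and bitwise operations; constant time means independent of $n,m,S$. -}

module Defs where

open import Data.Nat using (ℕ; zero; suc; _+_; _*_; _∸_; _^_; _≤_; _<_; _≡ᵇ_; _<ᵇ_; _<?_; NonZero)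
open import Data.Nat.Properties using (m^n≢0)
open import Relation.Nullary using (yes; no)
open import Relation.Binary.PropositionalEquality using (_≡_)
open import Data.Nat.DivMod using (_/_; _%_)
open import Data.Bool using (Bool; true; false; if_then_else_; _∧_; _∨_; _xor_)
open import Data.List using (List; []; _∷_; length; filter; map)
open import Data.Fin using (Fin; toℕ)
open import Data.Fin.Subset using (Subset; _∈_)
open import Data.Fin.Subset.Properties using (_∈?_)
open import Data.Vec using (toList; allFin)
open import Data.Maybe using (Maybe; just; nothing)
open import Data.Product using (Σ; _×_; _,_; ∃)

elems : ∀ {m} → Subset m → List ℕ
elems {m} S = map toℕ (filter (λ i → i ∈? S) (toList (allFin m)))

countBelow : ∀ {m} → ℕ → Subset m → ℕ
countBelow x S = length (filter (λ y → y <? x) (elems S))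

data RankVal : Set where
  minusOne : RankVal
  val      : ℕ → RankVal

rankS : ∀ {m} → Fin m → Subset m → RankVal
rankS {m} x S with x ∈? S
... | yes _ = val (countBelow (toℕ x) S)
... | no  _ = minusOne

selectS : ∀ {m} → ℕ → Subset m → Maybe ℕ
selectS i S = go i (elems S)
  where
  go : ℕ → List ℕ → Maybe ℕ
  go _ [] = nothing
  go zero (y ∷ _) = just y
  go (suc k) (_ ∷ ys) = go k ys

LittleO-n : (ℕ → ℕ) → Set
LittleO-n f = ∀ k → 1 ≤ k → ∃ λ N → ∀ n → N ≤ n → k * f n ≤ n

-- Word RAM with word size w.  Words are naturals < 2^w; all results are
-- reduced mod 2^w.  Unboundedly many registers R : ℕ → ℕ (a program only
-- uses finitely many) and memory M : ℕ → ℕ (word-addressed).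

odd : ℕ → Bool
odd n = (n % 2) ≡ᵇ 1

bitwise : (Bool → Bool → Bool) → ℕ → ℕ → ℕ → ℕ
bitwise g zero    a b = 0
bitwise g (suc k) a b =
  (if g (odd a) (odd b) then 1 else 0) + 2 * bitwise g k (a / 2) (b / 2)

wrap : ℕ → ℕ → ℕ
wrap w x = _%_ x (2 ^ w) ⦃ m^n≢0 2 w ⦄

data Op : Set where
  add sub mul div mod and or xor shl shr lt eq : Op

evalOp : ℕ → Op → ℕ → ℕ → ℕ
evalOp w o a b = wrap w (go o)
  where
  safeDiv : ℕ → ℕ → ℕ
  safeDiv x zero = 0
  safeDiv x (suc d) = x / suc d
  safeMod : ℕ → ℕ → ℕ
  safeMod x zero = 0
  safeMod x (suc d) = x % suc d
  go : Op → ℕ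
  go add = a + b
  go sub = (a + 2 ^ w) ∸ b
  go mul = a * b
  go div = safeDiv a b
  go mod = safeMod a b
  go and = bitwise _∧_ w a b
  go or  = bitwise _∨_ w a b
  go xor = bitwise _xor_ w a b
  go shl = a * 2 ^ b
  go shr = safeDiv a (2 ^ b)
  go lt  = if a <ᵇ b then 1 else 0
  go eq  = if a ≡ᵇ b then 1 else 0

data Instr : Set where
  li   : (d k : ℕ) → Instr
  op   : Op → (d a b : ℕ) → Instr
  load : (d a : ℕ) → Instr
  store : (a s : ℕ) → Instr
  jz   : (r t : ℕ) → Instr
  jmp  : (t : ℕ) → Instr
  halt : Instr

Program : Set
Program = List Instr

record State : Set where
  constructor st
  field
    pc  : ℕ
    reg : ℕ → ℕ
    mem : ℕ → ℕ
open State public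

update : (ℕ → ℕ) → ℕ → ℕ → (ℕ → ℕ)
update f i v j = if j ≡ᵇ i then v else f j

fetch : Program → ℕ → Maybe Instr
fetch [] _ = nothing
fetch (i ∷ _) zero = just i
fetch (_ ∷ is) (suc k) = fetch is k

-- one step: nothing means the machine has halted (halt instruction, or
-- the program counter left the program)
step : ℕ → Program → State → Maybe State
step w P s with fetch P (pc s)
... | nothing = nothing
... | just halt = nothing
... | just (li d k) = just (st (suc (pc s)) (update (reg s) d (wrap w k)) (mem s))
... | just (op o d a b) = just (st (suc (pc s)) (update (reg s) d (evalOp w o (reg s a) (reg s b))) (mem s))
... | just (load d a) = just (st (suc (pc s)) (update (reg s) d (mem s (reg s a))) (mem s))
... | just (store a v) = just (st (suc (pc s)) (reg s) (update (mem s) (reg s a) (reg s v)))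
... | just (jz r t) = just (st (if reg s r ≡ᵇ 0 then t else suc (pc s)) (reg s) (mem s))
... | just (jmp t) = just (st t (reg s) (mem s))

runWithin : ℕ → Program → ℕ → State → Maybe State
runWithin w P T s with step w P s
... | nothing = just s
runWithin w P zero s | just _ = nothing
runWithin w P (suc T) s | just s' = runWithin w P T s'

-- Loading a bit string into memory: word j holds bits jw .. jw+w-1
-- (bit jw+t has weight 2^t); bits beyond the string are 0.

bitAt : List Bool → ℕ → Bool
bitAt [] _ = false
bitAt (b ∷ _) zero = b
bitAt (_ ∷ bs) (suc k) = bitAt bs k

wordOf : ℕ → List Bool → ℕ → ℕ
wordOf w bs j = go w
  where
  go : ℕ → ℕ
  go zero = 0
  go (suc t) = go t + (if bitAt bs (j * w + t) then 2 ^ t else 0)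

initState : ℕ → List Bool → (q m n : ℕ) → State
initState w bs q m n = st 0 R (wordOf w bs)
  where
  R : ℕ → ℕ
  R zero = q
  R (suc zero) = m
  R (suc (suc zero)) = n
  R (suc (suc (suc _))) = 0

rankOut : State → RankVal
rankOut s = if reg s 0 ≡ᵇ 0 then minusOne else val (reg s 1)

RankCorrect : ℕ → Program → ℕ → ∀ {m} → ℕ → Subset m → List Bool → Set
RankCorrect w P T {m} n S bs =
  ∀ (x : Fin m) → Σ State λ s →
    (runWithin w P T (initState w bs (toℕ x) m n) ≡ just s)
    × (rankOut s ≡ rankS x S)

SelectCorrect : ℕ → Program → ℕ → ∀ {m} → ℕ → Subset m → List Bool → Set
SelectCorrect w P T {m} n S bs =
  ∀ (i : ℕ) → i < n → Σ State λ s →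
    (runWithin w P T (initState w bs i m n) ≡ just s)
    × (selectS i S ≡ just (reg s 0))

IndexableDictionary : ℕ → (Pr Ps : Program) → ℕ → ∀ {m} → ℕ → Subset m → List Bool → Set
IndexableDictionary w Pr Ps T n S bs =
  RankCorrect w Pr T n S bs × SelectCorrect w Ps T n S bs

{-# OPTIONS --safe #-}
-- Select: the elements are coded as by Elias and Fano, with lg m − lg n low
-- bits apiece in an array and the high parts as a monotone sequence of O(n)
-- bits that is decoded in constant time with the help of a small table.
--
-- Rank: it suffices to know the rank of x up to its K low bits, for a constant
-- K, since select identifies the right one among the 2 ^ K candidates (and
-- detects that x is absent).  Omitting K bits from each of the n stored ranks
-- pays for all overhead of order n, so that f is even a constant.
-- If m ≥ 2 ^ 14 n, the coarse ranks are the entries of a minimal perfect hash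
-- table.  Keys are first reduced modulo d₁ and then d₂ to length O(lg n); such
-- moduli exist because a common multiple of 1, ..., N is at least 2 ^ (N − 1).
-- Then follows two-level hashing by tabulation functions, chosen by
-- conditional expectations; offsets and seeds are monotone sequences again.
-- If m < 2 ^ 14 n, the ranks of the multiples of 2 ^ 17 are stored instead.
--
-- Programs do not know w or the positions of the tables: they are read from a
-- self-delimiting header of O(n + lg lg m) bits.  Universes below 2 ^ E, for a
-- constant E, get a table of all answers.
module Submission where

-- The bound n⌈lg m⌉ leaves no slack of order n. With ℓ = ⌊lg n⌋ the low bits take n(⌈lg m⌉ - ℓ)
-- bits, so nℓ bits remain for n ranks of ℓ + 1 bits each, while high parts, hash functions and
-- their directories cost O(n) on top. Hence the scan over candidates: the coefficient of the
-- overhead is fixed first, and K is chosen beyond it. If fewer than K bits are there to be omitted,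
-- then n < 2 ^ K and the whole overhead of order n is a constant. All auxiliary sizes are measured
-- in ν = n + lg lg m + 1, whose three summands are charged to K, to C and to f. Tables must
-- therefore be linear in ν, and even a header entry must not spend lg m bits, since n may be
-- bounded while m grows. The constants are fixed in the order overhead, K, E, each from the
-- preceding ones and from c, the bound on the ratio of w to lg (1 + m). Because a candidate counts
-- only after select has confirmed it, both rank methods can always be run one after the other,
-- whichever tables are present. Scans are unrolled, so apart from one forward jump a program is
-- straight-line code, and its length bounds its running time.

open import Data.Nat
open import Data.Nat.Properties
open import Data.Nat.DivMod hiding (_div_; _mod_)
open import Data.Nat.Divisibility using (_∣_; divides; m∣m*n; n∣m*n; ∣-trans; ∣m⇒∣m*n; ∣⇒≤)
open import Data.Nat.Tactic.RingSolver using (solve-∀)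
open import Data.Bool using (Bool; T; _xor_; _∧_; false; if_then_else_; not; true)
open import Data.Unit using (tt; ⊤)
open import Data.Product using (_,_; _×_; proj₁; proj₂; Σ; ∃)
open import Data.Sum using (_⊎_; inj₁; inj₂)
open import Relation.Nullary using (Dec; contradiction; no; yes)
open import Relation.Binary.PropositionalEquality
open import Function using (_∘_; id)

-- Bit strings as natural numbers.

module BitFields where
  open import Defs
  open import Data.List using (List; []; _∷_; length)

  private
    nz : ∀ k → NonZero (2 ^ k)
    nz k = m^n≢0 2 k

  infixl 8 _÷_
  _÷_ : ℕ → ℕ → ℕ
  x ÷ k = _/_ x (2 ^ k) {{nz k}}

  2^-+ : ∀ a b → 2 ^ (a + b) ≡ 2 ^ a * 2 ^ b
  2^-+ = ^-distribˡ-+-* 2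

  2^-≤ : ∀ {a b} → a ≤ b → 2 ^ a ≤ 2 ^ b
  2^-≤ = ^-monoʳ-≤ 2

  2^∣ : ∀ {a b} → a ≤ b → 2 ^ a ∣ 2 ^ b
  2^∣ {a} {b} a≤b = subst (λ z → 2 ^ a ∣ 2 ^ z) (m+[n∸m]≡n a≤b)
    (subst (2 ^ a ∣_) (sym (2^-+ a (b ∸ a))) (m∣m*n (2 ^ (b ∸ a))))

  n<2^n : ∀ n → n < 2 ^ n
  n<2^n zero = s≤s z≤n
  n<2^n (suc n) = begin-strict
    suc n ≡⟨ +-comm 1 n ⟩
    n + 1 <⟨ +-mono-<-≤ (n<2^n n) (m^n>0 2 n) ⟩
    2 ^ n + 2 ^ n ≡⟨ cong (2 ^ n +_) (sym (+-identityʳ (2 ^ n))) ⟩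
    2 ^ suc n ∎
    where open ≤-Reasoning

  wrap-small : ∀ w {x} → x < 2 ^ w → wrap w x ≡ x
  wrap-small w = m<n⇒m%n≡m {{nz w}}

  wrap-< : ∀ w x → wrap w x < 2 ^ w
  wrap-< w x = m%n<n x (2 ^ w) {{nz w}}

  wrap-wrap : ∀ {a b} x → a ≤ b → wrap a (wrap b x) ≡ wrap a x
  wrap-wrap {a} {b} x a≤b = m∣n⇒o%n%m≡o%m (2 ^ a) (2 ^ b) x {{nz a}} {{nz b}} (2^∣ a≤b)

  ÷-÷ : ∀ x a b → x ÷ a ÷ b ≡ x ÷ (a + b)
  ÷-÷ x a b = trans (m/n/o≡m/[n*o] x (2 ^ a) (2 ^ b) {{nz a}} {{nz b}} {{nz*}})
    (/-congʳ {m = x} {{nz*}} {{nz (a + b)}} (sym (2^-+ a b)))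
    where
    nz* : NonZero (2 ^ a * 2 ^ b)
    nz* = m*n≢0 (2 ^ a) (2 ^ b) {{nz a}} {{nz b}}

  wrap-÷ : ∀ x a b → wrap (a + b) x ÷ a ≡ wrap b (x ÷ a)
  wrap-÷ x a b = trans
    (cong (_÷ a) (%-congʳ {o = x} {{nz (a + b)}} {{nz*}} (trans (2^-+ a b) (*-comm (2 ^ a) (2 ^ b)))))
    (m%[n*o]/o≡m/o%n x (2 ^ b) (2 ^ a) {{nz b}} {{nz a}} {{nz*}})
    where
    nz* : NonZero (2 ^ b * 2 ^ a)
    nz* = m*n≢0 (2 ^ b) (2 ^ a) {{nz b}} {{nz a}}

  wrap-+-∣ : ∀ {a S} x B → a ≤ S → wrap a (x + 2 ^ S * B) ≡ wrap a x
  wrap-+-∣ {a} {S} x B a≤S = %-remove-+ʳ x {{nz a}} (∣m⇒∣m*n B (2^∣ a≤S))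

  ÷-shift : ∀ {A} S B → A < 2 ^ S → (A + 2 ^ S * B) ÷ S ≡ B
  ÷-shift {A} S B A< = trans (+-distrib-/-∣ʳ A {2 ^ S * B} {2 ^ S} {{nz S}} (m∣m*n B))
    (cong₂ _+_ (m<n⇒m/n≡0 {{nz S}} A<)
      (trans (cong (_÷ S) (*-comm (2 ^ S) B)) (m*n/n≡m B (2 ^ S) {{nz S}})))

  ÷-split : ∀ x k → x ≡ wrap k x + 2 ^ k * (x ÷ k)
  ÷-split x k = trans (m≡m%n+[m/n]*n x (2 ^ k) {{nz k}}) (cong (wrap k x +_) (*-comm (x ÷ k) (2 ^ k)))

  ÷-≤ : ∀ x k → x ÷ k ≤ x
  ÷-≤ x k = m/n≤m x (2 ^ k) {{nz k}}

  ÷-< : ∀ {x} k j → x < 2 ^ (k + j) → x ÷ k < 2 ^ j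
  ÷-< {x} k j x< = m<n*o⇒m/o<n {{nz k}} (subst (x <_) (trans (2^-+ k j) (*-comm (2 ^ k) (2 ^ j))) x<)

  join-< : ∀ {A B} S T → A < 2 ^ S → B < 2 ^ T → A + 2 ^ S * B < 2 ^ (S + T)
  join-< {A} {B} S T A< B< = begin-strict
    A + 2 ^ S * B <⟨ +-monoˡ-< (2 ^ S * B) A< ⟩
    2 ^ S + 2 ^ S * B ≡⟨ sym (*-suc (2 ^ S) B) ⟩
    2 ^ S * suc B ≤⟨ *-monoʳ-≤ (2 ^ S) B< ⟩
    2 ^ S * 2 ^ T ≡⟨ sym (2^-+ S T) ⟩
    2 ^ (S + T) ∎
    where open ≤-Reasoning

  -- The whole memory is viewed as one natural number `V`. Concatenation is then A + 2 ^ S * B, and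
  -- statements about layouts become divisibility facts about powers of two.
  rd : ℕ → ℕ → ℕ → ℕ
  rd V p τ = wrap τ (V ÷ p)

  rd-wrap : ∀ V p τ → rd V p τ ≡ wrap (p + τ) V ÷ p
  rd-wrap V p τ = sym (wrap-÷ V p τ)

  rd-lo : ∀ {A} S B p τ → p + τ ≤ S → rd (A + 2 ^ S * B) p τ ≡ rd A p τ
  rd-lo {A} S B p τ le = trans (rd-wrap _ p τ)
    (trans (cong (_÷ p) (wrap-+-∣ {p + τ} {S} A B le)) (sym (rd-wrap A p τ)))

  rd-hi : ∀ {A} S B p τ → A < 2 ^ S → rd (A + 2 ^ S * B) (S + p) τ ≡ rd B p τ
  rd-hi {A} S B p τ A< = cong (wrap τ)
    (trans (sym (÷-÷ (A + 2 ^ S * B) S p)) (cong (_÷ p) (÷-shift S B A<)))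

  rd-small : ∀ {N} τ → N < 2 ^ τ → rd N 0 τ ≡ N
  rd-small {N} τ N< = trans (cong (wrap τ) (n/1≡n N)) (wrap-small τ N<)

  -- Allows a segment to be located once as a whole; its entries are afterwards found by arithmetic
  -- inside the segment's own number.
  rd-sub : ∀ {V P N} len off τ → rd V P len ≡ N → off + τ ≤ len → rd V (P + off) τ ≡ rd N off τ
  rd-sub {V} {P} {N} len off τ e le = begin
    wrap τ (V ÷ (P + off)) ≡⟨ cong (wrap τ) (sym (÷-÷ V P off)) ⟩
    rd (V ÷ P) off τ ≡⟨ rd-wrap (V ÷ P) off τ ⟩
    wrap (off + τ) (V ÷ P) ÷ off ≡⟨ cong (_÷ off) (sym (wrap-wrap (V ÷ P) le)) ⟩
    wrap (off + τ) (wrap len (V ÷ P)) ÷ off ≡⟨ cong (λ z → wrap (off + τ) z ÷ off) e ⟩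
    wrap (off + τ) N ÷ off ≡⟨ sym (rd-wrap N off τ) ⟩
    rd N off τ ∎
    where open ≡-Reasoning

  ∑ : ℕ → (ℕ → ℕ) → ℕ
  ∑ zero f = 0
  ∑ (suc n) f = ∑ n f + f n

  ∑-mono : ∀ f {m n} → m ≤ n → ∑ m f ≤ ∑ n f
  ∑-mono f {m} {zero} z≤n = z≤n
  ∑-mono f {m} {suc n} le with m≤n⇒m<n∨m≡n le
  ... | inj₁ m<n = ≤-trans (∑-mono f (s≤s⁻¹ m<n)) (m≤m+n _ _)
  ... | inj₂ refl = ≤-refl

  ∑-const : ∀ n c → ∑ n (λ _ → c) ≡ n * c
  ∑-const zero c = refl
  ∑-const (suc n) c = trans (cong (_+ c) (∑-const n c)) (+-comm (n * c) c)

  opaque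
    -- Lengths vary because the explicit low bits of different blocks, and likewise the segments of
    -- the memory, have different sizes; `arr` is the case of equal lengths.
    cat : ℕ → (len num : ℕ → ℕ) → ℕ
    cat zero len num = 0
    cat (suc n) len num = cat n len num + 2 ^ ∑ n len * num n

    cat-< : ∀ n len num → (∀ i → i < n → num i < 2 ^ len i) → cat n len num < 2 ^ ∑ n len
    cat-< zero len num b = s≤s z≤n
    cat-< (suc n) len num b = join-< (∑ n len) (len n)
      (cat-< n len num (λ i i<n → b i (m<n⇒m<1+n i<n))) (b n ≤-refl)

    cat-rd : ∀ n len num → (∀ i → i < n → num i < 2 ^ len i) → ∀ i → i < n →
      rd (cat n len num) (∑ i len) (len i) ≡ num i
    cat-rd (suc n) len num b i i<n with m≤n⇒m<n∨m≡n i<n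
    ... | inj₁ (s≤s i<n') = trans (rd-lo (∑ n len) (num n) (∑ i len) (len i) (∑-mono len i<n'))
        (cat-rd n len num (λ j j<n → b j (m<n⇒m<1+n j<n)) i i<n')
    ... | inj₂ refl = begin
        rd (cat n len num + 2 ^ ∑ n len * num n) (∑ n len) (len n)
          ≡⟨ cong (λ p → rd (cat n len num + 2 ^ ∑ n len * num n) p (len n)) (sym (+-identityʳ (∑ n len))) ⟩
        rd (cat n len num + 2 ^ ∑ n len * num n) (∑ n len + 0) (len n)
          ≡⟨ rd-hi (∑ n len) (num n) 0 (len n) (cat-< n len num (λ j j<n → b j (m<n⇒m<1+n j<n))) ⟩
        rd (num n) 0 (len n) ≡⟨ rd-small (len n) (b n ≤-refl) ⟩
        num n ∎
      where open ≡-Reasoning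

  arr : ℕ → ℕ → (ℕ → ℕ) → ℕ
  arr ω n f = cat n (λ _ → ω) f

  arr-< : ∀ ω n f → (∀ i → i < n → f i < 2 ^ ω) → arr ω n f < 2 ^ (n * ω)
  arr-< ω n f b = subst (λ z → arr ω n f < 2 ^ z) (∑-const n ω) (cat-< n (λ _ → ω) f b)

  arr-rd : ∀ ω n f → (∀ i → i < n → f i < 2 ^ ω) → ∀ i → i < n → rd (arr ω n f) (i * ω) ω ≡ f i
  arr-rd ω n f b i i<n = subst (λ z → rd (arr ω n f) z ω ≡ f i) (∑-const i ω) (cat-rd n (λ _ → ω) f b i i<n)

  bitsOf : ℕ → ℕ → List Bool
  bitsOf zero V = []
  bitsOf (suc l) V = odd V ∷ bitsOf l (V / 2)

  length-bitsOf : ∀ l V → length (bitsOf l V) ≡ l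
  length-bitsOf zero V = refl
  length-bitsOf (suc l) V = cong suc (length-bitsOf l (V / 2))

  bitAt-bitsOf : ∀ l V k → V < 2 ^ l → bitAt (bitsOf l V) k ≡ odd (V ÷ k)
  bitAt-bitsOf zero zero k V< = cong odd (sym (0/n≡0 (2 ^ k) {{nz k}}))
  bitAt-bitsOf zero (suc V) k (s≤s ())
  bitAt-bitsOf (suc l) V zero V< = cong odd (sym (n/1≡n V))
  bitAt-bitsOf (suc l) V (suc k) V< =
    trans (bitAt-bitsOf l (V / 2) k (m<n*o⇒m/o<n (subst (V <_) (*-comm 2 (2 ^ l)) V<)))
      (cong odd (÷-÷ V 1 k))

  bitWord : List Bool → ℕ → ℕ → ℕ
  bitWord bs p zero = 0
  bitWord bs p (suc t) = bitWord bs p t + (if bitAt bs (p + t) then 2 ^ t else 0)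

  -- wordOf is defined through a local function that cannot be named; the
  -- metavariable lets unification name it once the word size and the loop
  -- counter have been made independent.
  mutual
    wordOf-loop : ℕ → List Bool → ℕ → ℕ → ℕ
    wordOf-loop = _

    wordOf-bitWord : ∀ w bs j → wordOf w bs j ≡ bitWord bs (j * w) w
    wordOf-bitWord zero bs j = refl
    wordOf-bitWord (suc t) bs j with suc t
    ... | u = cong (_+ (if bitAt bs (j * u + t) then 2 ^ t else 0)) (wordOf-loop-bitWord u bs j t)

    wordOf-loop-bitWord : ∀ u bs j t → wordOf-loop u bs j t ≡ bitWord bs (j * u) t
    wordOf-loop-bitWord u bs j zero = refl
    wordOf-loop-bitWord u bs j (suc t) =
      cong (_+ (if bitAt bs (j * u + t) then 2 ^ t else 0)) (wordOf-loop-bitWord u bs j t)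

  -- Peels off the top bit instead of the bottom one, to match the recursion of `wordOf`.
  wrap-suc : ∀ t x → wrap (suc t) x ≡ wrap t x + (if odd (x ÷ t) then 2 ^ t else 0)
  wrap-suc t x = trans (÷-split (wrap (suc t) x) t) (cong₂ _+_ (wrap-wrap x (n≤1+n t))
    (trans (cong (2 ^ t *_) (trans (cong (λ z → wrap z x ÷ t) (+-comm 1 t)) (wrap-÷ x t 1))) (bit (x ÷ t))))
    where
    bit : ∀ y → 2 ^ t * (y % 2) ≡ (if odd y then 2 ^ t else 0)
    bit y with y % 2 | m%n<n y 2
    ... | 0 | _ = *-zeroʳ (2 ^ t)
    ... | 1 | _ = *-identityʳ (2 ^ t)
    ... | suc (suc _) | s≤s (s≤s ())

  bitWord-rd : ∀ l V p t → V < 2 ^ l → bitWord (bitsOf l V) p t ≡ rd V p t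
  bitWord-rd l V p zero V< = sym (n%1≡0 (V ÷ p))
  bitWord-rd l V p (suc t) V< = trans
    (cong₂ (λ a b → a + (if b then 2 ^ t else 0)) (bitWord-rd l V p t V<)
      (trans (bitAt-bitsOf l V (p + t) V<) (cong odd (sym (÷-÷ V p t)))))
    (sym (wrap-suc t (V ÷ p)))

  wordOf-rd : ∀ w l V j → V < 2 ^ l → wordOf w (bitsOf l V) j ≡ rd V (j * w) w
  wordOf-rd w l V j V< = trans (wordOf-bitWord w (bitsOf l V) j) (bitWord-rd l V (j * w) w V<)

-- A compiler from expressions to programs with a single branch.

module StraightLine where
  open import Defs
  open import Data.Maybe using (just; nothing)
  open import Data.Fin using (Fin; zero; suc)
  open import Data.Vec using (Vec; []; _∷_; lookup)
  open import Data.List using (List; []; _∷_; length; _++_; map)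
  open import Data.List.Properties using (length-++; length-map; ++-assoc)

  data SI : Set where
    sli : (d k : ℕ) → SI
    sop : Op → (d a b : ℕ) → SI
    sld : (d a : ℕ) → SI

  instr : SI → Instr
  instr (sli d k) = li d k
  instr (sop o d a b) = op o d a b
  instr (sld d a) = load d a

  -- `call` acts as a let: its arguments are evaluated once into registers and the body sees nothing
  -- else. A value used repeatedly is computed once, and each body is specified in its own small
  -- environment.
  data Ex (n : ℕ) : Set where
    var  : Fin n → Ex n
    lit  : ℕ → Ex n
    bin  : Op → Ex n → Ex n → Ex n
    ld   : Ex n → Ex n
    call : ∀ {k} → Ex k → Vec (Ex n) k → Ex n

  mutual
    -- `σ` gives the registers of the variables and `d` the first free register. Each result goes to
    -- a fresh register, so all earlier values survive; this is the invariant behind `Extends`.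
    comp : ∀ {n} → Ex n → Vec ℕ n → ℕ → List SI × ℕ × ℕ
    comp (var i) σ d = [] , lookup σ i , d
    comp (lit k) σ d = sli d k ∷ [] , d , suc d
    comp (bin o a b) σ d =
      let (c₁ , r₁ , d₁) = comp a σ d
          (c₂ , r₂ , d₂) = comp b σ d₁
      in c₁ ++ c₂ ++ sop o d₂ r₁ r₂ ∷ [] , d₂ , suc d₂
    comp (ld a) σ d =
      let (c₁ , r₁ , d₁) = comp a σ d
      in c₁ ++ sld d₁ r₁ ∷ [] , d₁ , suc d₁
    comp (call f as) σ d =
      let (c₁ , rs , d₁) = comps as σ d
          (c₂ , r , d₂) = comp f rs d₁
      in c₁ ++ c₂ , r , d₂

    comps : ∀ {n k} → Vec (Ex n) k → Vec ℕ n → ℕ → List SI × Vec ℕ k × ℕ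
    comps [] σ d = [] , [] , d
    comps (a ∷ as) σ d =
      let (c₁ , r , d₁) = comp a σ d
          (c₂ , rs , d₂) = comps as σ d₁
      in c₁ ++ c₂ , r ∷ rs , d₂

  update-same : ∀ R d v → update R d v d ≡ v
  update-same R d v with d ≡ᵇ d in e
  ... | true = refl
  ... | false = contradiction (trans (sym (≡ᵇ-refl d)) e) λ ()
    where
    ≡ᵇ-refl : ∀ n → (n ≡ᵇ n) ≡ true
    ≡ᵇ-refl zero = refl
    ≡ᵇ-refl (suc n) = ≡ᵇ-refl n

  update-other : ∀ R {d j} v → j ≢ d → update R d v j ≡ R j
  update-other R {d} {j} v j≢d with j ≡ᵇ d in e
  ... | true = contradiction (≡ᵇ⇒≡ j d (subst Data.Bool.T (sym e) tt)) j≢d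
  ... | false = refl

  module Machine (w : ℕ) (μ : ℕ → ℕ) where

    opaque
      mutual
        eval : ∀ {n} → Ex n → Vec ℕ n → ℕ
        eval (var i) ρ = lookup ρ i
        eval (lit k) ρ = wrap w k
        eval (bin o a b) ρ = evalOp w o (eval a ρ) (eval b ρ)
        eval (ld a) ρ = μ (eval a ρ)
        eval (call f as) ρ = eval f (evals as ρ)

        evals : ∀ {n k} → Vec (Ex n) k → Vec ℕ n → Vec ℕ k
        evals [] ρ = []
        evals (a ∷ as) ρ = eval a ρ ∷ evals as ρ

    exec₁ : SI → (ℕ → ℕ) → (ℕ → ℕ)
    exec₁ (sli d k) R = update R d (wrap w k)
    exec₁ (sop o d a b) R = update R d (evalOp w o (R a) (R b))
    exec₁ (sld d a) R = update R d (μ (R a))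

    exec : List SI → (ℕ → ℕ) → (ℕ → ℕ)
    exec [] R = R
    exec (i ∷ c) R = exec c (exec₁ i R)

    exec-++ : ∀ c₁ c₂ R → exec (c₁ ++ c₂) R ≡ exec c₂ (exec c₁ R)
    exec-++ [] c₂ R = refl
    exec-++ (i ∷ c₁) c₂ R = exec-++ c₁ c₂ (exec₁ i R)

    Match : ∀ {n} → ℕ → (ℕ → ℕ) → Vec ℕ n → Vec ℕ n → Set
    Match d R [] [] = ⊤
    Match d R (s ∷ σ) (x ∷ ρ) = (s < d × R s ≡ x) × Match d R σ ρ

    match-lookup : ∀ {n d R} {σ ρ : Vec ℕ n} → Match d R σ ρ → ∀ i → lookup σ i < d × R (lookup σ i) ≡ lookup ρ i
    match-lookup {σ = _ ∷ _} {_ ∷ _} (p , _) zero = p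
    match-lookup {σ = _ ∷ _} {_ ∷ _} (_ , q) (suc i) = match-lookup q i

    Extends : ℕ → (R R′ : ℕ → ℕ) → Set
    Extends d R R′ = ∀ j → j < d → R′ j ≡ R j

    extends-trans : ∀ {d d′ R R′ R″} → d ≤ d′ → Extends d R R′ → Extends d′ R′ R″ → Extends d R R″
    extends-trans le p q j j<d = trans (q j (<-≤-trans j<d le)) (p j j<d)

    match-extends : ∀ {n d d′ R R′} {σ ρ : Vec ℕ n} → d ≤ d′ → Extends d R R′ → Match d R σ ρ → Match d′ R′ σ ρ
    match-extends {σ = []} {[]} le ext _ = tt
    match-extends {σ = _ ∷ _} {_ ∷ _} le ext ((s< , e) , m) =
      (<-≤-trans s< le , trans (ext _ s<) e) , match-extends le ext m

    extends-update : ∀ {d} R v → Extends d R (update R d v)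
    extends-update R v j j<d = update-other R v (<⇒≢ j<d)

    Correct : ∀ {n} → Ex n → ℕ → (ℕ → ℕ) → Vec ℕ n → List SI × ℕ × ℕ → Set
    Correct e d R ρ (c , r , d′) =
      d ≤ d′ × r < d′ × exec c R r ≡ eval e ρ × Extends d R (exec c R)

    opaque
      unfolding eval

      mutual
        comp-correct : ∀ {n} (e : Ex n) {σ ρ} {d R} → Match d R σ ρ → Correct e d R ρ (comp e σ d)
        comp-correct (var i) m = ≤-refl , proj₁ (match-lookup m i) , proj₂ (match-lookup m i) , λ _ _ → refl
        comp-correct (lit k) {d = d} {R} m = n≤1+n d , ≤-refl , update-same R d _ , extends-update R _
        comp-correct (bin o a b) {σ} {ρ} {d} {R} m
          with comp a σ d | comp-correct a m
        ... | c₁ , r₁ , d₁ | le₁ , r₁< , v₁ , x₁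
          with comp b σ d₁ | comp-correct b {σ} {ρ} {d₁} (match-extends le₁ x₁ m)
        ... | c₂ , r₂ , d₂ | le₂ , r₂< , v₂ , x₂
          rewrite exec-++ c₁ (c₂ ++ sop o d₂ r₁ r₂ ∷ []) R
                | exec-++ c₂ (sop o d₂ r₁ r₂ ∷ []) (exec c₁ R) =
          ≤-trans le₁ (≤-trans le₂ (n≤1+n d₂)) , ≤-refl
          , trans (update-same (exec c₂ (exec c₁ R)) d₂ _) (cong₂ (evalOp w o) (trans (x₂ r₁ r₁<) v₁) v₂)
          , extends-trans (≤-trans le₁ le₂) (extends-trans le₁ x₁ x₂) (extends-update _ _)
        comp-correct (ld a) {σ} {ρ} {d} {R} m
          with comp a σ d | comp-correct a m
        ... | c₁ , r₁ , d₁ | le₁ , r₁< , v₁ , x₁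
          rewrite exec-++ c₁ (sld d₁ r₁ ∷ []) R =
          ≤-trans le₁ (n≤1+n d₁) , ≤-refl , trans (update-same (exec c₁ R) d₁ _) (cong μ v₁)
          , extends-trans le₁ x₁ (extends-update _ _)
        comp-correct (call f as) {σ} {ρ} {d} {R} m
          with comps as σ d | comps-correct as m
        ... | c₁ , rs , d₁ | le₁ , m₁ , x₁
          with comp f rs d₁ | comp-correct f {rs} {evals as ρ} {d₁} m₁
        ... | c₂ , r , d₂ | le₂ , r< , v , x₂
          rewrite exec-++ c₁ c₂ R =
          ≤-trans le₁ le₂ , r< , v , extends-trans le₁ x₁ x₂

        comps-correct : ∀ {n k} (as : Vec (Ex n) k) {σ ρ} {d R} → Match d R σ ρ →
          let (c , rs , d′) = comps as σ d
          in d ≤ d′ × Match d′ (exec c R) rs (evals as ρ) × Extends d R (exec c R)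
        comps-correct [] m = ≤-refl , tt , λ _ _ → refl
        comps-correct (a ∷ as) {σ} {ρ} {d} {R} m
          with comp a σ d | comp-correct a m
        ... | c₁ , r₁ , d₁ | le₁ , r₁< , v₁ , x₁
          with comps as σ d₁ | comps-correct as {σ} {ρ} {d₁} (match-extends le₁ x₁ m)
        ... | c₂ , rs , d₂ | le₂ , m₂ , x₂
          rewrite exec-++ c₁ c₂ R =
          ≤-trans le₁ le₂ , ((<-≤-trans r₁< le₂ , trans (x₂ r₁ r₁<) v₁) , m₂) , extends-trans le₁ x₁ x₂

    data Steps (P : Program) : ℕ → State → State → Set where
      done : ∀ {s} → Steps P 0 s s
      more : ∀ {k s s′ s″} → step w P s ≡ just s′ → Steps P k s′ s″ → Steps P (suc k) s s″

    steps-trans : ∀ {P j k s s′ s″} → Steps P j s s′ → Steps P k s′ s″ → Steps P (j + k) s s″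
    steps-trans done q = q
    steps-trans (more e p) q = more e (steps-trans p q)

    runWithin-steps : ∀ {P k T s s′} → Steps P k s s′ → step w P s′ ≡ nothing → k ≤ T → runWithin w P T s ≡ just s′
    runWithin-steps {P} {T = T} {s} done h le with step w P s
    runWithin-steps {T = T} done refl le | nothing = refl
    runWithin-steps {P} {T = suc T} {s} (more e p) h (s≤s le) with step w P s
    runWithin-steps (more refl p) h (s≤s le) | just _ = runWithin-steps p h le

    fetch-at : ∀ pre i post → fetch (pre ++ i ∷ post) (length pre) ≡ just i
    fetch-at [] i post = refl
    fetch-at (_ ∷ pre) i post = fetch-at pre i post

    fetch-end : ∀ P → fetch P (length P) ≡ nothing
    fetch-end [] = refl
    fetch-end (_ ∷ P) = fetch-end P

    step-straight : ∀ P p R i → fetch P p ≡ just (instr i) → step w P (st p R μ) ≡ just (st (suc p) (exec₁ i R) μ)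
    step-straight P p R (sli d k) e rewrite e = refl
    step-straight P p R (sop o d a b) e rewrite e = refl
    step-straight P p R (sld d a) e rewrite e = refl

    step-jz : ∀ P p R r t → fetch P p ≡ just (jz r t) →
      step w P (st p R μ) ≡ just (st (if R r ≡ᵇ 0 then t else suc p) R μ)
    step-jz P p R r t e rewrite e = refl

    step-halt : ∀ P s → fetch P (pc s) ≡ just halt → step w P s ≡ nothing
    step-halt P s e rewrite e = refl

    step-end : ∀ P s → fetch P (pc s) ≡ nothing → step w P s ≡ nothing
    step-end P s e rewrite e = refl

    steps-straight : ∀ P pre c post R → P ≡ pre ++ map instr c ++ post →
      Steps P (length c) (st (length pre) R μ) (st (length pre + length c) (exec c R) μ)
    steps-straight P pre [] post R e rewrite +-identityʳ (length pre) = done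
    steps-straight P pre (i ∷ c) post R e =
      more (step-straight P (length pre) R i (trans (cong (λ Q → fetch Q (length pre)) e) (fetch-at pre (instr i) _)))
        (subst₂ (λ a b → Steps P (length c) (st a (exec₁ i R) μ) (st b (exec c (exec₁ i R)) μ))
          len len′
          (steps-straight P (pre ++ instr i ∷ []) c post (exec₁ i R) (trans e (sym (++-assoc pre (instr i ∷ []) _)))))
      where
      len : length (pre ++ instr i ∷ []) ≡ suc (length pre)
      len = trans (length-++ pre) (+-comm (length pre) 1)
      len′ : length (pre ++ instr i ∷ []) + length c ≡ length pre + suc (length c)
      len′ = trans (cong (_+ length c) len) (sym (+-suc (length pre) (length c)))

  args : Vec ℕ 3
  args = 0 ∷ 1 ∷ 2 ∷ []

  -- The addition of 0 guarantees that the result sits in a register beyond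
  -- the argument registers, so that writing register 1 cannot destroy it.
  emit : List SI × ℕ × ℕ → List SI
  emit (c , r , d) = c ++ sli d 1 ∷ sop sub 1 r d ∷ sli d 0 ∷ sop add 0 r d ∷ []

  output : Ex 3 → List SI
  output e = emit (comp (bin add e (lit 0)) args 3)

  -- The only jump goes forward, so every instruction is executed at most once and `length` of the
  -- program bounds the number of steps. The first alternative stops at `halt`, the second one by
  -- running off the end.
  branch : (test big small : Ex 3) → Program
  branch test big small =
    let (c , r , _) = comp test args 3
    in map instr c ++ jz r (length c + suc (length (output big) + 1))
         ∷ map instr (output big) ++ halt ∷ map instr (output small)

  module Branch (w : ℕ) (μ : ℕ → ℕ) where
    open Machine w μ

    -- A result v is delivered as v in register 0 and v - 1 in register 1. A rank expression
    -- computes the rank plus one, or 0 for absence, which then agrees with `rankOut`; for select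
    -- only register 0 matters. The reductions modulo 2 ^ w stay visible here since no bound on v is
    -- known yet.
    Outcome : State → ℕ → Set
    Outcome s v = reg s 0 ≡ evalOp w add (evalOp w add v (wrap w 0)) (wrap w 0)
      × reg s 1 ≡ evalOp w sub (evalOp w add v (wrap w 0)) (wrap w 1)

    emit-correct : ∀ c r d R {v} → 3 ≤ r → r < d → exec c R r ≡ evalOp w add v (wrap w 0) →
      ∀ p → Outcome (st p (exec (emit (c , r , d)) R) μ) v
    emit-correct c r d R {v} 3≤r r<d e p
      rewrite exec-++ c (sli d 1 ∷ sop sub 1 r d ∷ sli d 0 ∷ sop add 0 r d ∷ []) R =
        cong₂ (evalOp w add)
          (trans (update-other R₂ _ r≢d) (trans (update-other R₁ _ (≢-sym (<⇒≢ 1<r))) (trans (update-other R₀ _ r≢d) e)))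
          (update-same R₂ d _)
      , trans (update-other R₂ _ (<⇒≢ (<-trans 1<r r<d)))
          (cong₂ (evalOp w sub) (trans (update-other R₀ _ r≢d) e) (update-same R₀ d _))
      where
      R₀ = exec c R
      R₁ = update R₀ d (wrap w 1)
      R₂ = update R₁ 1 (evalOp w sub (R₁ r) (R₁ d))
      1<r : 1 < r
      1<r = ≤-trans (s≤s (s≤s z≤n)) 3≤r
      r≢d : r ≢ d
      r≢d = <⇒≢ r<d

    opaque
      unfolding Machine.eval

      output-correct : ∀ e {R x y z} → Match 3 R args (x ∷ y ∷ z ∷ []) →
        ∀ p → Outcome (st p (exec (output e) R) μ) (eval e (x ∷ y ∷ z ∷ []))
      output-correct e {R} {x} {y} {z} m = emit-correct (proj₁ (comp (bin add e (lit 0)) args 3)) _ _ R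
        (m≤n⇒m≤1+n (proj₁ (comp-correct e {args} {x ∷ y ∷ z ∷ []} {3} {R} m))) ≤-refl
        (proj₁ (proj₂ (proj₂ (comp-correct (bin add e (lit 0)) {args} {x ∷ y ∷ z ∷ []} {3} {R} m))))

    module _ (test big small : Ex 3) {R : ℕ → ℕ} {x y z : ℕ} (m : Match 3 R args (x ∷ y ∷ z ∷ [])) where
      private
        ρ : Vec ℕ 3
        ρ = x ∷ y ∷ z ∷ []
        P = branch test big small
        c = proj₁ (comp test args 3)
        r = proj₁ (proj₂ (comp test args 3))
        tgt = length c + suc (length (output big) + 1)
        cc = comp-correct test {args} {ρ} {3} {R} m
        R′ = exec c R

        m′ : Match 3 R′ args ρ
        m′ = match-extends {R = R} {σ = args} {ρ} ≤-refl (proj₂ (proj₂ (proj₂ cc))) m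

        tail₁ = map instr (output big) ++ halt ∷ map instr (output small)

        len-c : length (map instr c) ≡ length c
        len-c = length-map instr c

        s₁ : Steps P (length c) (st 0 R μ) (st (length c) R′ μ)
        s₁ = steps-straight P [] c (jz r tgt ∷ tail₁) R refl

        f₂ : fetch P (length c) ≡ just (jz r tgt)
        f₂ = subst (λ k → fetch P k ≡ just (jz r tgt)) len-c (fetch-at (map instr c) (jz r tgt) tail₁)

        e₂ : step w P (st (length c) R′ μ) ≡ just (st (if R′ r ≡ᵇ 0 then tgt else suc (length c)) R′ μ)
        e₂ = step-jz P (length c) R′ r tgt f₂

        pre₃ = map instr c ++ jz r tgt ∷ []
        len-pre₃ : length pre₃ ≡ suc (length c)
        len-pre₃ = trans (length-++ (map instr c)) (trans (+-comm _ 1) (cong suc len-c))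
        P₃ : P ≡ pre₃ ++ tail₁
        P₃ = sym (++-assoc (map instr c) (jz r tgt ∷ []) tail₁)

        pre₄ = pre₃ ++ map instr (output big)
        len-pre₄ : length pre₄ ≡ suc (length c) + length (output big)
        len-pre₄ = trans (length-++ pre₃) (cong₂ _+_ len-pre₃ (length-map instr (output big)))
        P₄ : P ≡ pre₄ ++ halt ∷ map instr (output small)
        P₄ = trans P₃ (sym (++-assoc pre₃ (map instr (output big)) _))

        pre₅ = pre₄ ++ halt ∷ []
        len-pre₅ : length pre₅ ≡ tgt
        len-pre₅ = trans (length-++ pre₄) (trans (cong (_+ 1) len-pre₄) (trans (+-assoc (suc (length c)) _ 1) (sym (+-suc (length c) _))))
        P₅ : P ≡ pre₅ ++ map instr (output small) ++ []
        P₅ = trans P₄ (trans (sym (++-assoc pre₄ (halt ∷ []) _)) (cong (pre₅ ++_) (sym (++-identityʳ (map instr (output small))))))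
          where open import Data.List.Properties using (++-identityʳ)

        len-P : length P ≡ length c + suc (length (output big) + suc (length (output small)))
        len-P = trans (length-++ (map instr c)) (cong₂ _+_ len-c (cong suc (trans (length-++ (map instr (output big)))
          (cong₂ _+_ (length-map instr (output big)) (cong suc (length-map instr (output small)))))))

      run-big : eval test ρ ≢ 0 → Σ State λ s → runWithin w P (length P) (st 0 R μ) ≡ just s × Outcome s (eval big ρ)
      run-big nz = s , runWithin-steps (steps-trans s₁ (more e₃ s₃)) hlt le , output-correct big m′ 0
        where
        s = st (suc (length c) + length (output big)) (exec (output big) R′) μ
        e₃ : step w P (st (length c) R′ μ) ≡ just (st (suc (length c)) R′ μ)
        e₃ with R′ r | proj₁ (proj₂ (proj₂ cc)) | e₂
        ... | zero | q | _ = contradiction (sym q) nz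
        ... | suc _ | q | h = h
        s₃ : Steps P (length (output big)) (st (suc (length c)) R′ μ) s
        s₃ = subst (λ k → Steps P (length (output big)) (st k R′ μ) (st (k + length (output big)) (exec (output big) R′) μ)) len-pre₃
          (steps-straight P pre₃ (output big) _ R′ P₃)
        hlt : step w P s ≡ nothing
        hlt = step-halt P s (subst₂ (λ Q k → fetch Q k ≡ just halt) (sym P₄) len-pre₄ (fetch-at pre₄ halt _))
        le : length c + suc (length (output big)) ≤ length P
        le = subst (length c + suc (length (output big)) ≤_) (sym len-P) (+-monoʳ-≤ (length c) (s≤s (m≤m+n _ _)))

      run-small : eval test ρ ≡ 0 → Σ State λ s → runWithin w P (length P) (st 0 R μ) ≡ just s × Outcome s (eval small ρ)
      run-small ez = s , runWithin-steps (steps-trans s₁ (more e₃ s₃)) hlt le , output-correct small m′ 0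
        where
        s = st (tgt + length (output small)) (exec (output small) R′) μ
        e₃ : step w P (st (length c) R′ μ) ≡ just (st tgt R′ μ)
        e₃ with R′ r | proj₁ (proj₂ (proj₂ cc)) | e₂
        ... | zero | q | h = h
        ... | suc _ | q | _ = contradiction (trans q ez) λ ()
        s₃ : Steps P (length (output small)) (st tgt R′ μ) s
        s₃ = subst (λ k → Steps P (length (output small)) (st k R′ μ) (st (k + length (output small)) (exec (output small) R′) μ)) len-pre₅
          (steps-straight P pre₅ (output small) [] R′ P₅)
        end : length P ≡ tgt + length (output small)
        end = trans len-P (trans (cong (λ k → length c + suc k) (sym (+-assoc (length (output big)) 1 _))) (sym (+-assoc (length c) (suc (length (output big) + 1)) _)))
        hlt : step w P s ≡ nothing
        hlt = step-end P s (subst (λ k → fetch P k ≡ nothing) end (fetch-end P))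
        le : length c + suc (length (output small)) ≤ length P
        le = subst (length c + suc (length (output small)) ≤_) (sym len-P) (+-monoʳ-≤ (length c) (s≤s (≤-trans (n≤1+n _) (m≤n+m _ _))))

-- Reading bit fields, arrays and monotone sequences with RAM instructions.

module FieldAccess where
  open BitFields
  open StraightLine
  open import Defs
  open import Data.Empty using (⊥-elim)
  open import Data.Fin using (zero; suc)
  open import Data.Vec using (Vec; []; _∷_; lookup)

  x0 : ∀ {n} → Ex (1 + n)
  x0 = var zero
  x1 : ∀ {n} → Ex (2 + n)
  x1 = var (suc zero)
  x2 : ∀ {n} → Ex (3 + n)
  x2 = var (suc (suc zero))
  x3 : ∀ {n} → Ex (4 + n)
  x3 = var (suc (suc (suc zero)))
  x4 : ∀ {n} → Ex (5 + n)
  x4 = var (suc (suc (suc (suc zero))))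
  x5 : ∀ {n} → Ex (6 + n)
  x5 = var (suc (suc (suc (suc (suc zero)))))
  x6 : ∀ {n} → Ex (7 + n)
  x6 = var (suc (suc (suc (suc (suc (suc zero))))))
  x7 : ∀ {n} → Ex (8 + n)
  x7 = var (suc (suc (suc (suc (suc (suc (suc zero)))))))

  infixl 6 _⊞_ _⊟_ _⊻_
  infixl 7 _⊠_ _⊘_ _⊙_
  infixl 8 _≪_ _≫_
  _⊞_ _⊟_ _⊻_ _⊠_ _⊘_ _⊙_ _≪_ _≫_ : ∀ {n} → Ex n → Ex n → Ex n
  _⊞_ = bin add
  _⊟_ = bin sub
  _⊻_ = bin xor
  _⊠_ = bin mul
  _⊘_ = bin div
  _⊙_ = bin mod
  _≪_ = bin shl
  _≫_ = bin shr

  -- Environment: word size, word address, bit offset.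
  fieldE : Ex 4
  fieldE = ((ld x2 ≫ x3) ⊞ (ld (x2 ⊞ lit 1) ≪ (x0 ⊟ x3))) ≪ (x0 ⊟ x1) ≫ (x0 ⊟ x1)

  fieldE′ : Ex 4
  fieldE′ = call fieldE (x0 ∷ x1 ∷ x2 ⊞ (x3 ⊘ x0) ∷ x3 ⊙ x0 ∷ [])

  -- Reads the field of width x5 at bit position x1 * x0 + x2 + x4 * x3, where
  -- x0 is the word size.  Splitting the index x4 by the word size keeps all
  -- intermediate values below 2 ^ x0, although the bit position may exceed it.
  readE : Ex 6
  readE = call fieldE′ (x0 ∷ x5 ∷ x1 ⊞ (x4 ⊘ x0) ⊠ x3 ∷ x2 ⊞ (x4 ⊙ x0) ⊠ x3 ∷ [])

  -- Numbering: 0 low bits, 1 coarse ranks, 2 sampled ranks for dense sets, 3 decoding table, 4 hash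
  -- tables; then four monotone sequences of five segments each, starting at 5 (high parts), 10
  -- (bucket starts), 15 (prefix sums of seeds) and 20 (occupied slots before a slot).
  segments : ℕ
  segments = 25

  -- The first three variables of every expression that uses the header are the word size, the width
  -- η of a header entry and the header's bit position H₀. A segment owns four entries: word index
  -- and bit offset of its start, entry width, and one scalar.
  hdrE : ℕ → Ex 3
  hdrE j = call readE (x0 ∷ lit 0 ∷ x2 ∷ x1 ∷ lit j ∷ x1 ∷ [])

  hdr : ∀ {n} → ℕ → Ex (3 + n)
  hdr j = call (hdrE j) (x0 ∷ x1 ∷ x2 ∷ [])

  origin : ∀ {n} → ℕ → Ex (3 + n)
  origin a = hdr (1 + a * 4) ⊞ (x2 ⊞ x1 ⊠ lit (segments * 4))

  getE : ℕ → Ex 4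
  getE a = call readE (x0 ∷ hdr (a * 4) ∷ origin a ∷ hdr (2 + a * 4) ∷ x3 ∷ hdr (2 + a * 4) ∷ [])

  get : ∀ {n} → ℕ → Ex (3 + n) → Ex (3 + n)
  get a e = call (getE a) (x0 ∷ x1 ∷ x2 ∷ e ∷ [])

  -- The fourth entries carry global parameters, unrelated to the segment at whose place they stand:
  -- 0 number of low bits, 1 block length g, 2 and 3 the moduli d₁ and d₂, 4 digit base, 5 number of
  -- buckets, 6 size of one hash table.
  scalar : ∀ {n} → ℕ → Ex (3 + n)
  scalar a = hdr (3 + a * 4)

  monoE₃ : ℕ → Ex 8
  monoE₃ b = x4 ⊞ ((x7 ≪ x5) ⊞ call readE (x0 ∷ hdr ((4 + b) * 4) ∷ origin (4 + b) ∷ lit 1 ∷ x6 ⊞ x3 ⊠ x5 ∷ x5 ∷ []))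

  -- The segments `b` to 4 + `b` hold, for each block, the base value, the number of explicit low
  -- bits, the pointer to them and the unary pattern, and finally the low bits themselves. Segment 3
  -- decodes patterns of all sequences.
  monoE₂ : ℕ → Ex 6
  monoE₂ b = call (monoE₃ b) (x0 ∷ x1 ∷ x2 ∷ x4 ∷ get b x3 ∷ get (1 + b) x3 ∷ get (2 + b) x3 ∷ get 3 (get (3 + b) x3 ⊠ x5 ⊞ x4) ∷ [])

  monoE : ℕ → Ex 4
  monoE b = call (monoE₂ b) (x0 ∷ x1 ∷ x2 ∷ x3 ⊘ scalar 1 ∷ x3 ⊙ scalar 1 ∷ scalar 1 ∷ [])

  module Rules (w : ℕ) (μ : ℕ → ℕ) where
    open Machine w μ

    module _ {n} {ρ : Vec ℕ n} where
      infixr 5 _∷⇓_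
      opaque
        unfolding eval

        var⇓ : ∀ {i} → eval (var i) ρ ≡ lookup ρ i
        var⇓ = refl

        lit⇓ : ∀ {k} → k < 2 ^ w → eval (lit k) ρ ≡ k
        lit⇓ = wrap-small w

        add⇓ : ∀ {a b x y} → eval a ρ ≡ x → eval b ρ ≡ y → x + y < 2 ^ w → eval (a ⊞ b) ρ ≡ x + y
        add⇓ p q l = trans (cong₂ (evalOp w add) p q) (wrap-small w l)

        sub⇓ : ∀ {a b x y} → eval a ρ ≡ x → eval b ρ ≡ y → y ≤ x → x < 2 ^ w → eval (a ⊟ b) ρ ≡ x ∸ y
        sub⇓ {x = x} {y} p q y≤x x< = trans (cong₂ (evalOp w sub) p q)
          (trans (cong (wrap w) (+-∸-comm (2 ^ w) y≤x))
            (trans ([m+n]%n≡m%n (x ∸ y) (2 ^ w) {{m^n≢0 2 w}}) (wrap-small w (≤-<-trans (m∸n≤m x y) x<))))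

        mul⇓ : ∀ {a b x y} → eval a ρ ≡ x → eval b ρ ≡ y → x * y < 2 ^ w → eval (a ⊠ b) ρ ≡ x * y
        mul⇓ p q l = trans (cong₂ (evalOp w mul) p q) (wrap-small w l)

        div⇓ : ∀ {a b x y} .{{_ : NonZero y}} → eval a ρ ≡ x → eval b ρ ≡ y → x < 2 ^ w → eval (a ⊘ b) ρ ≡ x / y
        div⇓ {x = x} {suc y} p q l = trans (cong₂ (evalOp w div) p q)
          (wrap-small w (≤-<-trans (m/n≤m x (suc y)) l))

        mod⇓ : ∀ {a b x y} .{{_ : NonZero y}} → eval a ρ ≡ x → eval b ρ ≡ y → x < 2 ^ w → eval (a ⊙ b) ρ ≡ x % y
        mod⇓ {x = x} {suc y} p q l = trans (cong₂ (evalOp w mod) p q)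
          (wrap-small w (≤-<-trans (m%n≤m x (suc y)) l))

        shl⇓ : ∀ {a b x y} → eval a ρ ≡ x → eval b ρ ≡ y → eval (a ≪ b) ρ ≡ wrap w (x * 2 ^ y)
        shl⇓ p q = cong₂ (evalOp w shl) p q

        shr⇓ : ∀ {a b x y} → eval a ρ ≡ x → eval b ρ ≡ y → x < 2 ^ w → eval (a ≫ b) ρ ≡ x ÷ y
        shr⇓ {x = x} {y} p q l = trans (cong₂ (evalOp w shr) p q) (go (2 ^ y) {{m^n≢0 2 y}})
          where
          go : ∀ d .{{_ : NonZero d}} → evalOp w div x d ≡ x / d
          go (suc d) = wrap-small w (≤-<-trans (m/n≤m x (suc d)) l)

        bin⇓ : ∀ {o a b x y} → eval a ρ ≡ x → eval b ρ ≡ y → eval (bin o a b) ρ ≡ evalOp w o x y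
        bin⇓ {o} p q = cong₂ (evalOp w o) p q

        ld⇓ : ∀ {a x} → eval a ρ ≡ x → eval (ld a) ρ ≡ μ x
        ld⇓ = cong μ

        []⇓ : evals [] ρ ≡ []
        []⇓ = refl

        _∷⇓_ : ∀ {k a x} {as : Vec (Ex n) k} {xs} → eval a ρ ≡ x → evals as ρ ≡ xs → evals (a ∷ as) ρ ≡ x ∷ xs
        _∷⇓_ = cong₂ _∷_

        call⇓ : ∀ {k} {f : Ex k} {as xs y} → evals as ρ ≡ xs → eval f xs ≡ y → eval (call f as) ρ ≡ y
        call⇓ {f = f} p q = trans (cong (eval f) p) q

    flag : 1 ≤ w → ∀ b → wrap w (if b then 1 else 0) ≡ (if b then 1 else 0)
    flag 1≤w true = wrap-small w (≤-<-trans 1≤w (n<2^n w))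
    flag 1≤w false = wrap-small w (m^n>0 2 w)

    <ᵇ-yes : ∀ {x y} → x < y → (x <ᵇ y) ≡ true
    <ᵇ-yes {x} {y} l with x <ᵇ y in e
    ... | true = refl
    ... | false = ⊥-elim (subst Data.Bool.T e (<⇒<ᵇ l))

    <ᵇ-no : ∀ {x y} → y ≤ x → (x <ᵇ y) ≡ false
    <ᵇ-no {x} {y} l with x <ᵇ y in e
    ... | true = contradiction (<ᵇ⇒< x y (subst Data.Bool.T (sym e) tt)) (≤⇒≯ l)
    ... | false = refl

    ≡ᵇ-yes : ∀ {x y} → x ≡ y → (x ≡ᵇ y) ≡ true
    ≡ᵇ-yes {x} {y} l with x ≡ᵇ y in e
    ... | true = refl
    ... | false = ⊥-elim (subst Data.Bool.T e (≡⇒≡ᵇ x y l))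

    ≡ᵇ-no : ∀ {x y} → x ≢ y → (x ≡ᵇ y) ≡ false
    ≡ᵇ-no {x} {y} l with x ≡ᵇ y in e
    ... | true = contradiction (≡ᵇ⇒≡ x y (subst Data.Bool.T (sym e) tt)) l
    ... | false = refl

  module Reading (w : ℕ) .{{_ : NonZero w}} (μ : ℕ → ℕ) (V : ℕ) (μ-rd : ∀ j → μ j ≡ rd V (j * w) w) where
    open Machine w μ
    open Rules w μ

    wrap-+-wrap : ∀ x z → wrap w (x + wrap w z) ≡ wrap w (x + z)
    wrap-+-wrap x z = sym (trans (cong (wrap w) (trans (cong (x +_) (÷-split z w)) (sym (+-assoc x _ _))))
      (wrap-+-∣ {w} {w} (x + wrap w z) (z ÷ w) ≤-refl))

    μ-< : ∀ j → μ j < 2 ^ w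
    μ-< j = subst (_< 2 ^ w) (sym (μ-rd j)) (wrap-< w _)

    w<2^w : w < 2 ^ w
    w<2^w = n<2^n w

    -- Two adjacent words, shifted and added, give the quotient of `V` modulo 2 ^ w; shifting left
    -- and right by w ∸ τ then masks τ bits. At offset 0 the second word is shifted by w and
    -- vanishes modulo 2 ^ w, so this case is not special.
    fieldE-spec : ∀ τ a off → τ ≤ w → off < w → a + 1 < 2 ^ w →
      eval fieldE (w ∷ τ ∷ a ∷ off ∷ []) ≡ rd V (a * w + off) τ
    fieldE-spec τ a off τ≤w off<w a< = begin
      eval fieldE ρ
        ≡⟨ shr⇓ (shl⇓ sum-eq sub-eq) sub-eq (wrap-< w _) ⟩
      wrap w (wrap w Y * 2 ^ (w ∸ τ)) ÷ (w ∸ τ)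
        ≡⟨ cong (λ z → wrap z (wrap w Y * 2 ^ (w ∸ τ)) ÷ (w ∸ τ)) (sym (m∸n+n≡m τ≤w)) ⟩
      wrap ((w ∸ τ) + τ) (wrap w Y * 2 ^ (w ∸ τ)) ÷ (w ∸ τ)
        ≡⟨ wrap-÷ (wrap w Y * 2 ^ (w ∸ τ)) (w ∸ τ) τ ⟩
      wrap τ ((wrap w Y * 2 ^ (w ∸ τ)) ÷ (w ∸ τ))
        ≡⟨ cong (λ z → wrap τ (z ÷ (w ∸ τ))) (*-comm (wrap w Y) (2 ^ (w ∸ τ))) ⟩
      wrap τ ((0 + 2 ^ (w ∸ τ) * wrap w Y) ÷ (w ∸ τ))
        ≡⟨ cong (wrap τ) (÷-shift (w ∸ τ) (wrap w Y) (m^n>0 2 (w ∸ τ))) ⟩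
      wrap τ (wrap w Y) ≡⟨ wrap-wrap Y τ≤w ⟩
      wrap τ Y ∎
      where
      open ≡-Reasoning
      ρ : Vec ℕ 4
      ρ = w ∷ τ ∷ a ∷ off ∷ []
      hi lo : Ex 4
      hi = ld x2 ≫ x3
      lo = ld (x2 ⊞ lit 1) ≪ (x0 ⊟ x3)
      Y = V ÷ (a * w + off)
      c = w ∸ off
      B = rd V ((a + 1) * w) w
      Y′ = V ÷ ((a + 1) * w)
      off+c : off + c ≡ w
      off+c = m+[n∸m]≡n (<⇒≤ off<w)
      Y′-eq : Y ÷ c ≡ Y′
      Y′-eq = trans (÷-÷ V (a * w + off) c) (cong (V ÷_) (trans (+-assoc (a * w) off c)
        (trans (cong (a * w +_) off+c) (trans (+-comm (a * w) w) (cong (_* w) (+-comm 1 a))))))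
      sub-eq : eval (x0 ⊟ x1) ρ ≡ w ∸ τ
      sub-eq = sub⇓ var⇓ var⇓ τ≤w w<2^w
      1<2^w : 1 < 2 ^ w
      1<2^w = ≤-<-trans (m≤n+m 1 a) a<
      hi-eq : eval hi ρ ≡ wrap c Y
      hi-eq = trans (shr⇓ (ld⇓ var⇓) var⇓ (μ-< a)) (trans (cong (_÷ off) (trans (μ-rd a) (cong (λ z → wrap z (V ÷ (a * w))) (sym off+c))))
        (trans (wrap-÷ (V ÷ (a * w)) off c) (cong (wrap c) (÷-÷ V (a * w) off))))
      lo-eq : eval lo ρ ≡ wrap w (B * 2 ^ c)
      lo-eq = shl⇓ (trans (ld⇓ (add⇓ var⇓ (lit⇓ 1<2^w) a<)) (μ-rd (a + 1))) (sub⇓ var⇓ var⇓ (<⇒≤ off<w) w<2^w)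
      split-eq : (wrap c Y + B * 2 ^ c) + 2 ^ w * (2 ^ c * (Y′ ÷ w)) ≡ Y
      split-eq = sym (trans (÷-split Y c) (trans (cong (λ z → wrap c Y + 2 ^ c * z) (trans Y′-eq (÷-split Y′ w)))
        (ring (wrap c Y) (2 ^ c) B (2 ^ w) (Y′ ÷ w))))
        where
        ring : ∀ y p b q z → y + p * (b + q * z) ≡ (y + b * p) + q * (p * z)
        ring = solve-∀
      sum-eq : eval (hi ⊞ lo) ρ ≡ wrap w Y
      sum-eq = begin
        eval (hi ⊞ lo) ρ ≡⟨ bin⇓ hi-eq lo-eq ⟩
        wrap w (wrap c Y + wrap w (B * 2 ^ c)) ≡⟨ wrap-+-wrap (wrap c Y) (B * 2 ^ c) ⟩
        wrap w (wrap c Y + B * 2 ^ c) ≡⟨ sym (wrap-+-∣ {w} {w} (wrap c Y + B * 2 ^ c) (2 ^ c * (Y′ ÷ w)) ≤-refl) ⟩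
        wrap w ((wrap c Y + B * 2 ^ c) + 2 ^ w * (2 ^ c * (Y′ ÷ w))) ≡⟨ cong (wrap w) split-eq ⟩
        wrap w Y ∎

    readE-spec : ∀ W O ω i τ → τ ≤ w → i < 2 ^ w → O + w * ω < 2 ^ w → (W * w + O + i * ω) / w + 1 < 2 ^ w →
      eval readE (w ∷ W ∷ O ∷ ω ∷ i ∷ τ ∷ []) ≡ rd V (W * w + O + i * ω) τ
    readE-spec W O ω i τ τ≤w i< O< pos< =
      call⇓ (var⇓ ∷⇓ var⇓ ∷⇓ B-eq ∷⇓ t-eq ∷⇓ []⇓) (call⇓ (var⇓ ∷⇓ var⇓ ∷⇓ a-eq ∷⇓ o-eq ∷⇓ []⇓)
        (trans (fieldE-spec τ (B + t / w) (t % w) τ≤w (m%n<n t w) (subst (λ z → z + 1 < 2 ^ w) pos/ pos<))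
          (cong (λ z → rd V z τ) (trans pos-eq′ (sym pos-eq)))))
      where
      ρ : Vec ℕ 6
      ρ = w ∷ W ∷ O ∷ ω ∷ i ∷ τ ∷ []
      q = i / w
      r = i % w
      B = W + q * ω
      t = O + r * ω
      ρ′ : Vec ℕ 4
      ρ′ = w ∷ τ ∷ B ∷ t ∷ []
      pos-eq : W * w + O + i * ω ≡ t + B * w
      pos-eq = trans (cong (λ z → W * w + O + z * ω) (m≡m%n+[m/n]*n i w)) (ring W w O r q ω)
        where
        ring : ∀ W w O r q ω → W * w + O + (r + q * w) * ω ≡ (O + r * ω) + (W + q * ω) * w
        ring = solve-∀
      pos-eq′ : (B + t / w) * w + t % w ≡ t + B * w
      pos-eq′ = trans (ring B w (t / w) (t % w)) (cong (_+ B * w) (sym (m≡m%n+[m/n]*n t w)))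
        where
        ring : ∀ B w x y → (B + x) * w + y ≡ (y + x * w) + B * w
        ring = solve-∀
      pos/ : (W * w + O + i * ω) / w ≡ B + t / w
      pos/ = trans (/-congˡ {o = w} (trans pos-eq (+-comm t (B * w))))
        (trans (+-distrib-/-∣ˡ {B * w} t (divides B refl)) (cong (_+ t / w) (m*n/n≡m B w)))
        where open import Data.Nat.Divisibility using (divides)
      a< : B + t / w < 2 ^ w
      a< = <-trans (subst (_< B + t / w + 1) (+-identityʳ _) (+-monoʳ-< (B + t / w) (s≤s z≤n))) (subst (λ z → z + 1 < 2 ^ w) pos/ pos<)
      B< : B < 2 ^ w
      B< = ≤-<-trans (m≤m+n B (t / w)) a<
      t< : t < 2 ^ w
      t< = ≤-<-trans (+-monoʳ-≤ O (*-monoˡ-≤ ω (<⇒≤ (m%n<n i w)))) O<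
      B-eq : eval (x1 ⊞ (x4 ⊘ x0) ⊠ x3) ρ ≡ B
      B-eq = add⇓ var⇓ (mul⇓ (div⇓ var⇓ var⇓ i<) var⇓ (≤-<-trans (m≤n+m (q * ω) W) B<)) B<
      t-eq : eval (x2 ⊞ (x4 ⊙ x0) ⊠ x3) ρ ≡ t
      t-eq = add⇓ var⇓ (mul⇓ (mod⇓ var⇓ var⇓ i<) var⇓ (≤-<-trans (m≤n+m (r * ω) O) t<)) t<
      a-eq : eval (x2 ⊞ (x3 ⊘ x0)) ρ′ ≡ B + t / w
      a-eq = add⇓ var⇓ (div⇓ var⇓ var⇓ t<) a<
      o-eq : eval (x3 ⊙ x0) ρ′ ≡ t % w
      o-eq = mod⇓ var⇓ var⇓ t<

  record Image (w : ℕ) .{{_ : NonZero w}} (μ : ℕ → ℕ) : Set where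
    field
      V η H₀ total : ℕ
      start stride scal : ℕ → ℕ
      μ-rd : ∀ j → μ j ≡ rd V (j * w) w
      η≤w : η ≤ w
      H₀≤w : H₀ ≤ w
      -- The header ends at or before 101 * w, namely H₀ ≤ w plus 100 entries of η ≤ w bits; one
      -- more w allows for the start offset of a segment, and w * w for the reduced index times the
      -- stride.
      word-large : w * 102 + w * w < 2 ^ w
      total-small : ∀ p → p ≤ total → p / w + 1 < 2 ^ w
      data≤total : H₀ + η * (segments * 4) ≤ total
      hdr-rd : ∀ a → a < segments →
        (rd V (H₀ + (a * 4) * η) η ≡ start a / w) ×
        (rd V (H₀ + (1 + a * 4) * η) η ≡ start a % w) ×
        (rd V (H₀ + (2 + a * 4) * η) η ≡ stride a) ×
        (rd V (H₀ + (3 + a * 4) * η) η ≡ scal a)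

  module Layout {w : ℕ} .{{_ : NonZero w}} {μ : ℕ → ℕ} (image : Image w μ) where
    open Image image public
    open Machine w μ public
    open Rules w μ public
    open Reading w μ V μ-rd public

    D₀ : ℕ
    D₀ = H₀ + η * (segments * 4)

    D₀≤ : D₀ ≤ w * 101
    D₀≤ = ≤-trans (+-mono-≤ H₀≤w (*-monoˡ-≤ 100 η≤w)) (≤-reflexive (sym (*-suc w 100)))

    w²+<  : ∀ {x y} → x ≤ w * 102 → y ≤ w → x + w * y < 2 ^ w
    w²+< l k = ≤-<-trans (+-mono-≤ l (*-monoʳ-≤ w k)) word-large

    lit< : ∀ {k} → k ≤ 102 → k < 2 ^ w
    lit< {k} l = ≤-<-trans (≤-trans l (≤-trans (m≤n*m 102 w) (m≤m+n (w * 102) (w * w)))) word-large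

    hdrE-spec : ∀ j → j < segments * 4 → eval (hdrE j) (w ∷ η ∷ H₀ ∷ []) ≡ rd V (H₀ + j * η) η
    hdrE-spec j j< = call⇓ (var⇓ ∷⇓ lit⇓ (lit< z≤n) ∷⇓ var⇓ ∷⇓ var⇓ ∷⇓ lit⇓ (lit< j≤) ∷⇓ var⇓ ∷⇓ []⇓)
      (readE-spec 0 H₀ η j η η≤w (lit< j≤) (w²+< (≤-trans H₀≤w (m≤m*n w 102)) η≤w)
        (total-small _ (≤-trans (+-monoʳ-≤ H₀ (≤-trans (*-monoˡ-≤ η (<⇒≤ j<)) (≤-reflexive (*-comm (segments * 4) η)))) data≤total)))
      where
      j≤ : j ≤ 102
      j≤ = ≤-trans (<⇒≤ j<) (m≤m+n 100 2)

    hdr⇓ : ∀ {n} {ρ : Vec ℕ n} {j x} → eval (hdrE j) (w ∷ η ∷ H₀ ∷ []) ≡ x → eval (hdr j) (w ∷ η ∷ H₀ ∷ ρ) ≡ x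
    hdr⇓ = call⇓ (var⇓ ∷⇓ var⇓ ∷⇓ var⇓ ∷⇓ []⇓)

    private
      idx< : ∀ a c → a < segments → c < 4 → c + a * 4 < segments * 4
      idx< a c a< c< = <-≤-trans (+-monoˡ-< (a * 4) c<) (*-monoˡ-≤ 4 a<)

    hdr-start : ∀ a → a < segments → eval (hdrE (a * 4)) (w ∷ η ∷ H₀ ∷ []) ≡ start a / w
    hdr-start a a< = trans (hdrE-spec _ (idx< a 0 a< (s≤s z≤n))) (proj₁ (hdr-rd a a<))

    hdr-offset : ∀ a → a < segments → eval (hdrE (1 + a * 4)) (w ∷ η ∷ H₀ ∷ []) ≡ start a % w
    hdr-offset a a< = trans (hdrE-spec _ (idx< a 1 a< (s≤s (s≤s z≤n)))) (proj₁ (proj₂ (hdr-rd a a<)))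

    hdr-stride : ∀ a → a < segments → eval (hdrE (2 + a * 4)) (w ∷ η ∷ H₀ ∷ []) ≡ stride a
    hdr-stride a a< = trans (hdrE-spec _ (idx< a 2 a< (s≤s (s≤s (s≤s z≤n))))) (proj₁ (proj₂ (proj₂ (hdr-rd a a<))))

    hdr-scalar : ∀ a → a < segments → eval (hdrE (3 + a * 4)) (w ∷ η ∷ H₀ ∷ []) ≡ scal a
    hdr-scalar a a< = trans (hdrE-spec _ (idx< a 3 a< ≤-refl)) (proj₂ (proj₂ (proj₂ (hdr-rd a a<))))

    origin⇓ : ∀ {n} {ρ : Vec ℕ n} a → a < segments → eval (origin a) (w ∷ η ∷ H₀ ∷ ρ) ≡ start a % w + D₀
    origin⇓ a a< = add⇓ (hdr⇓ (hdr-offset a a<))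
      (add⇓ var⇓ (mul⇓ var⇓ (lit⇓ (lit< (m≤m+n 100 2))) (small {η * (segments * 4)} (m≤n+m _ H₀))) (small {D₀} ≤-refl)) s<
      where
      small : ∀ {x} → x ≤ D₀ → x < 2 ^ w
      small {x} l = subst (_< 2 ^ w) (+-identityʳ x) (subst (λ z → x + z < 2 ^ w) (*-zeroʳ w)
        (w²+< {x} {0} (≤-trans l (≤-trans D₀≤ (*-monoʳ-≤ w (n≤1+n 101)))) z≤n))
      s< : start a % w + D₀ < 2 ^ w
      s< = ≤-<-trans (≤-trans (≤-trans (+-mono-≤ (<⇒≤ (m%n<n (start a) w)) D₀≤) (≤-reflexive (sym (*-suc w 101)))) (m≤m+n _ _)) word-large

    seg-spec : ∀ a ω i τ → a < segments → τ ≤ w → ω ≤ w → i < 2 ^ w → D₀ + start a + i * ω ≤ total →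
      eval readE (w ∷ start a / w ∷ start a % w + D₀ ∷ ω ∷ i ∷ τ ∷ []) ≡ rd V (D₀ + start a + i * ω) τ
    seg-spec a ω i τ a< τ≤ ω≤ i< p≤ = trans
      (readE-spec (start a / w) (start a % w + D₀) ω i τ τ≤ i<
        (w²+< (≤-trans (+-mono-≤ (<⇒≤ (m%n<n (start a) w)) D₀≤) (≤-reflexive (sym (*-suc w 101)))) ω≤)
        (subst (λ z → z / w + 1 < 2 ^ w) (sym pos) (total-small _ p≤)))
      (cong (λ z → rd V z τ) pos)
      where
      pos : start a / w * w + (start a % w + D₀) + i * ω ≡ D₀ + start a + i * ω
      pos = cong (_+ i * ω) (trans (ring (start a / w * w) (start a % w) D₀) (cong (D₀ +_) (sym (m≡m%n+[m/n]*n (start a) w))))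
        where
        ring : ∀ x y z → x + (y + z) ≡ z + (y + x)
        ring = solve-∀

    record Array (a N : ℕ) (f : ℕ → ℕ) : Set where
      field
        seg<   : a < segments
        stride≤ : stride a ≤ w
        fits   : D₀ + start a + N * stride a ≤ total
        N<     : N ≤ 2 ^ w
        holds  : ∀ i → i < N → rd V (D₀ + start a + i * stride a) (stride a) ≡ f i
    open Array public

    getE-spec : ∀ {a N f} → Array a N f → ∀ i → i < N → eval (getE a) (w ∷ η ∷ H₀ ∷ i ∷ []) ≡ f i
    getE-spec {a} {N} A i i< =
      call⇓ (var⇓ ∷⇓ hdr⇓ (hdr-start a (seg< A)) ∷⇓ origin⇓ a (seg< A) ∷⇓ hdr⇓ (hdr-stride a (seg< A)) ∷⇓ var⇓ ∷⇓ hdr⇓ (hdr-stride a (seg< A)) ∷⇓ []⇓)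
      (trans (seg-spec a (stride a) i (stride a) (seg< A) (stride≤ A) (stride≤ A) (<-≤-trans i< (N< A))
          (≤-trans (+-monoʳ-≤ (D₀ + start a) (*-monoˡ-≤ (stride a) (<⇒≤ i<))) (fits A)))
        (holds A i i<))

    get⇓ : ∀ {n} {ρ : Vec ℕ n} {e a N f i} → Array a N f → i < N → eval e (w ∷ η ∷ H₀ ∷ ρ) ≡ i → eval (get a e) (w ∷ η ∷ H₀ ∷ ρ) ≡ f i
    get⇓ A i< p = call⇓ (var⇓ ∷⇓ var⇓ ∷⇓ var⇓ ∷⇓ p ∷⇓ []⇓) (getE-spec A _ i<)

    -- The interface between decoding and coding: it says which arrays are present and that they
    -- combine to `v`, whatever construction produced the blocks.
    record Mono (b N : ℕ) (v : ℕ → ℕ) : Set where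
      field
        g nb nd : ℕ
        base width ptr pat dec : ℕ → ℕ
        {{g≢0}}   : NonZero g
        g-scal    : scal 1 ≡ g
        base-arr  : Array b nb base
        width-arr : Array (1 + b) nb width
        ptr-arr   : Array (2 + b) nb ptr
        pat-arr   : Array (3 + b) nb pat
        dec-arr   : Array 3 nd dec
        ovf<      : 4 + b < segments
        N≤        : N ≤ 2 ^ w
        block<    : ∀ i → i < N → i / g < nb
        pat<      : ∀ i → i < N → pat (i / g) * g + i % g < nd
        width≤    : ∀ k → k < nb → width k ≤ w
        low≤      : ∀ i → i < N → D₀ + start (4 + b) + (ptr (i / g) + i % g * width (i / g)) * 1 ≤ total
        low<      : ∀ i → i < N → ptr (i / g) + i % g * width (i / g) < 2 ^ w
        value     : ∀ i → i < N → base (i / g) + (dec (pat (i / g) * g + i % g) * 2 ^ width (i / g)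
          + rd V (D₀ + start (4 + b) + (ptr (i / g) + i % g * width (i / g)) * 1) (width (i / g))) ≡ v i
        value<    : ∀ i → i < N → v i < 2 ^ w

    monoE-spec : ∀ {b N v} → Mono b N v → ∀ i → i < N → eval (monoE b) (w ∷ η ∷ H₀ ∷ i ∷ []) ≡ v i
    monoE-spec {b} {N} {v} M i i<N =
      call⇓ (var⇓ ∷⇓ var⇓ ∷⇓ var⇓ ∷⇓ div⇓ var⇓ sc i< ∷⇓ mod⇓ var⇓ sc i< ∷⇓ sc ∷⇓ []⇓)
        (call⇓ (var⇓ ∷⇓ var⇓ ∷⇓ var⇓ ∷⇓ var⇓ ∷⇓ get⇓ (base-arr M) k< var⇓ ∷⇓ get⇓ (width-arr M) k< var⇓ ∷⇓ get⇓ (ptr-arr M) k< var⇓ ∷⇓ hi-eq ∷⇓ []⇓)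
          (trans (add⇓ var⇓ inner (subst (_< 2 ^ w) (sym (value M i i<N)) (value< M i i<N))) (value M i i<N)))
      where
      open Mono
      k = _/_ i (g M) {{g≢0 M}}
      j = _%_ i (g M) {{g≢0 M}}
      ω = width M k
      h = dec M (pat M k * g M + j)
      low = rd V (D₀ + start (4 + b) + (ptr M k + j * ω) * 1) ω
      i< : i < 2 ^ w
      i< = <-≤-trans i<N (N≤ M)
      k< : k < nb M
      k< = block< M i i<N
      ρ₁ : Vec ℕ 4
      ρ₁ = w ∷ η ∷ H₀ ∷ i ∷ []
      ρ₂ : Vec ℕ 6
      ρ₂ = w ∷ η ∷ H₀ ∷ k ∷ j ∷ g M ∷ []
      ρ₃ : Vec ℕ 8
      ρ₃ = w ∷ η ∷ H₀ ∷ j ∷ base M k ∷ ω ∷ ptr M k ∷ h ∷ []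
      hiE : Ex 6
      hiE = get 3 (get (3 + b) x3 ⊠ x5 ⊞ x4)
      rdE : Ex 8
      rdE = call readE (x0 ∷ hdr ((4 + b) * 4) ∷ origin (4 + b) ∷ lit 1 ∷ x6 ⊞ x3 ⊠ x5 ∷ x5 ∷ [])
      instance
        gz : NonZero (g M)
        gz = g≢0 M
      sc : eval (scalar 1) ρ₁ ≡ g M
      sc = hdr⇓ (trans (hdr-scalar 1 (s≤s (s≤s z≤n))) (g-scal M))
      p< : pat M k * g M + j < nd M
      p< = pat< M i i<N
      p<2^w : pat M k * g M + j < 2 ^ w
      p<2^w = <-≤-trans p< (N< (dec-arr M))
      hi-eq : eval hiE ρ₂ ≡ h
      hi-eq = get⇓ (dec-arr M) p< (add⇓ (mul⇓ (get⇓ (pat-arr M) k< var⇓) var⇓ (≤-<-trans (m≤m+n _ j) p<2^w)) var⇓ p<2^w)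
      off< : ptr M k + j * ω < 2 ^ w
      off< = low< M i i<N
      v< : h * 2 ^ ω + low < 2 ^ w
      v< = ≤-<-trans (m≤n+m _ (base M k)) (subst (_< 2 ^ w) (sym (value M i i<N)) (value< M i i<N))
      rd-eq : eval rdE ρ₃ ≡ low
      rd-eq = call⇓ (var⇓ ∷⇓ hdr⇓ (hdr-start (4 + b) (ovf< M)) ∷⇓ origin⇓ (4 + b) (ovf< M) ∷⇓ lit⇓ (lit< (m≤m+n 1 101))
          ∷⇓ add⇓ var⇓ (mul⇓ var⇓ var⇓ (≤-<-trans (m≤n+m _ (ptr M k)) off<)) off< ∷⇓ var⇓ ∷⇓ []⇓)
        (seg-spec (4 + b) 1 (ptr M k + j * ω) ω (ovf< M) (width≤ M k k<) (>-nonZero⁻¹ w) off< (low≤ M i i<N))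
      inner : eval ((x7 ≪ x5) ⊞ rdE) ρ₃ ≡ h * 2 ^ ω + low
      inner = add⇓ (trans (shl⇓ var⇓ var⇓) (wrap-small w (≤-<-trans (m≤m+n _ low) v<))) rd-eq v<

-- Lower bounds for common multiples, and moduli that separate given numbers.

module CommonMultiples where
  open BitFields
  open import Relation.Nullary.Decidable using (_×-dec_; ¬?)

  ∑-cong : ∀ n {f g : ℕ → ℕ} → (∀ i → i < n → f i ≡ g i) → ∑ n f ≡ ∑ n g
  ∑-cong zero p = refl
  ∑-cong (suc n) p = cong₂ _+_ (∑-cong n (λ i i< → p i (m<n⇒m<1+n i<))) (p n ≤-refl)

  ∑-≤ : ∀ n {f g : ℕ → ℕ} → (∀ i → i < n → f i ≤ g i) → ∑ n f ≤ ∑ n g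
  ∑-≤ zero p = z≤n
  ∑-≤ (suc n) p = +-mono-≤ (∑-≤ n (λ i i< → p i (m<n⇒m<1+n i<))) (p n ≤-refl)

  ∑-+ : ∀ n (f g : ℕ → ℕ) → ∑ n (λ i → f i + g i) ≡ ∑ n f + ∑ n g
  ∑-+ zero f g = refl
  ∑-+ (suc n) f g = trans (cong (_+ (f n + g n)) (∑-+ n f g)) (ring (∑ n f) (∑ n g) (f n) (g n))
    where
    ring : ∀ a b c d → (a + b) + (c + d) ≡ (a + c) + (b + d)
    ring = solve-∀

  ∑-* : ∀ n c (f : ℕ → ℕ) → ∑ n (λ i → c * f i) ≡ c * ∑ n f
  ∑-* zero c f = sym (*-zeroʳ c)
  ∑-* (suc n) c f = trans (cong (_+ c * f n) (∑-* n c f)) (sym (*-distribˡ-+ c (∑ n f) (f n)))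

  ∑-first : ∀ n (f : ℕ → ℕ) → ∑ (suc n) f ≡ f 0 + ∑ n (f ∘ suc)
  ∑-first zero f = sym (+-identityʳ (f 0))
  ∑-first (suc n) f = trans (cong (_+ f (suc n)) (∑-first n f)) (+-assoc (f 0) (∑ n (f ∘ suc)) (f (suc n)))

  binom : ℕ → ℕ → ℕ
  binom n zero = 1
  binom zero (suc k) = 0
  binom (suc n) (suc k) = binom n k + binom n (suc k)

  binom-absorb : ∀ n k → suc k * binom (suc n) (suc k) ≡ suc n * binom n k
  binom-absorb zero zero = refl
  binom-absorb zero (suc k) = *-zeroʳ (suc (suc k))
  binom-absorb (suc n) zero = begin
    1 * (1 + binom (suc n) 1) ≡⟨ ring (binom (suc n) 1) ⟩
    1 + 1 * binom (suc n) 1 ≡⟨ cong (1 +_) (binom-absorb n 0) ⟩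
    1 + suc n * 1 ∎
    where
    open ≡-Reasoning
    ring : ∀ x → 1 * (1 + x) ≡ 1 + 1 * x
    ring = solve-∀
  binom-absorb (suc n) (suc k) = begin
    suc (suc k) * (binom (suc n) (suc k) + binom (suc n) (suc (suc k)))
      ≡⟨ ring₁ k (binom (suc n) (suc k)) (binom (suc n) (suc (suc k))) ⟩
    binom (suc n) (suc k) + suc k * binom (suc n) (suc k) + suc (suc k) * binom (suc n) (suc (suc k))
      ≡⟨ cong₂ (λ x y → binom (suc n) (suc k) + x + y) (binom-absorb n k) (binom-absorb n (suc k)) ⟩
    binom n k + binom n (suc k) + suc n * binom n k + suc n * binom n (suc k)
      ≡⟨ ring₂ n (binom n k) (binom n (suc k)) ⟩
    suc (suc n) * (binom n k + binom n (suc k)) ∎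
    where
    open ≡-Reasoning
    ring₁ : ∀ k x y → suc (suc k) * (x + y) ≡ x + suc k * x + suc (suc k) * y
    ring₁ = solve-∀
    ring₂ : ∀ n x y → x + y + suc n * x + suc n * y ≡ suc (suc n) * (x + y)
    ring₂ = solve-∀

  binom-beyond : ∀ n k → n < k → binom n k ≡ 0
  binom-beyond zero (suc k) _ = refl
  binom-beyond (suc n) (suc k) (s≤s l) = cong₂ _+_ (binom-beyond n k l) (binom-beyond n (suc k) (m<n⇒m<1+n l))

  ∑-binom : ∀ n → ∑ (suc n) (binom n) ≡ 2 ^ n
  ∑-binom zero = refl
  ∑-binom (suc n) = begin
    ∑ (suc (suc n)) (binom (suc n)) ≡⟨ ∑-first (suc n) (binom (suc n)) ⟩
    1 + ∑ (suc n) (λ k → binom n k + binom n (suc k)) ≡⟨ cong (1 +_) (∑-+ (suc n) (binom n) (binom n ∘ suc)) ⟩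
    1 + (∑ (suc n) (binom n) + ∑ (suc n) (binom n ∘ suc)) ≡⟨ ring (∑ (suc n) (binom n)) _ ⟩
    ∑ (suc n) (binom n) + (1 + ∑ (suc n) (binom n ∘ suc)) ≡⟨ cong (∑ (suc n) (binom n) +_) (sym (∑-first (suc n) (binom n))) ⟩
    ∑ (suc n) (binom n) + (∑ (suc n) (binom n) + binom n (suc n)) ≡⟨ cong₂ (λ x y → x + (x + y)) (∑-binom n) (binom-beyond n (suc n) ≤-refl) ⟩
    2 ^ suc n ∎
    where
    open ≡-Reasoning
    ring : ∀ x y → 1 + (x + y) ≡ x + (1 + y)
    ring = solve-∀

  -- Leibniz harmonic triangle: 1 / (n + 1) (n choose k) is an integer
  -- combination of 1 / 1, ..., 1 / (n + 1).
  leibniz : ∀ N M → (∀ d → d ≤ N → suc d ∣ M) → ∀ n k → n ≤ N → k ≤ n → suc n * binom n k ∣ M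
  leibniz N M all n zero n≤ _ = subst (_∣ M) (sym (*-identityʳ (suc n))) (all n n≤)
  leibniz N M all (suc n) (suc k) n≤ (s≤s k≤)
    with leibniz N M all n k (≤-trans (n≤1+n n) n≤) k≤ | leibniz N M all (suc n) k n≤ (m≤n⇒m≤1+n k≤)
  ... | divides a Ma | divides b Mb = divides (a ∸ b) (sym (begin
      (a ∸ b) * x ≡⟨ *-distribʳ-∸ x a b ⟩
      a * x ∸ b * x ≡⟨ cong (_∸ b * x) key ⟩
      (M + b * x) ∸ b * x ≡⟨ m+n∸n≡m M (b * x) ⟩
      M ∎))
    where
    open ≡-Reasoning
    s = suc (suc n)
    B₀ = binom (suc n) k
    B₁ = binom (suc n) (suc k)
    x = s * B₁
    P-eq : suc k * B₁ ≡ suc n * binom n k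
    P-eq = binom-absorb n k
    Q-eq : suc k * B₀ + suc k * B₁ ≡ s * B₀
    Q-eq = trans (sym (*-distribˡ-+ (suc k) B₀ B₁)) (binom-absorb (suc n) k)
    -- The recurrence of the triangle is 1 / (s B₁) = 1 / ((n + 1) (n choose k)) - 1 / (s B₀).
    -- Multiplying by M turns the two right-hand terms into the integers `a` and `b`; `key` is this
    -- identity without subtraction or fractions.
    key : a * x ≡ M + b * x
    key = *-cancelˡ-≡ (a * x) (M + b * x) (suc k) (begin
      suc k * (a * (s * B₁)) ≡⟨ r₁ (suc k) a s B₁ ⟩
      s * (a * (suc k * B₁)) ≡⟨ cong (λ z → s * (a * z)) P-eq ⟩
      s * (a * (suc n * binom n k)) ≡⟨ cong (s *_) (sym Ma) ⟩
      s * M ≡⟨ cong (s *_) Mb ⟩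
      s * (b * (s * B₀)) ≡⟨ cong (λ z → s * (b * z)) (sym Q-eq) ⟩
      s * (b * (suc k * B₀ + suc k * B₁)) ≡⟨ r₂ s b (suc k) B₀ B₁ ⟩
      suc k * (b * (s * B₀) + b * (s * B₁)) ≡⟨ cong (λ z → suc k * (z + b * (s * B₁))) (sym Mb) ⟩
      suc k * (M + b * (s * B₁)) ∎)
      where
      r₁ : ∀ k a s x → k * (a * (s * x)) ≡ s * (a * (k * x))
      r₁ = solve-∀
      r₂ : ∀ s b k x y → s * (b * (k * x + k * y)) ≡ k * (b * (s * x) + b * (s * y))
      r₂ = solve-∀

  -- The N + 1 numbers (N + 1) (N choose k) all divide M, hence are at most M, and their average is
  -- 2 ^ N.
  commonMultiple-≥ : ∀ N M .{{_ : NonZero M}} → (∀ d → d ≤ N → suc d ∣ M) → 2 ^ N ≤ M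
  commonMultiple-≥ N M all = *-cancelˡ-≤ (suc N) (begin
    suc N * 2 ^ N ≡⟨ cong (suc N *_) (sym (∑-binom N)) ⟩
    suc N * ∑ (suc N) (binom N) ≡⟨ sym (∑-* (suc N) (suc N) (binom N)) ⟩
    ∑ (suc N) (λ k → suc N * binom N k) ≤⟨ ∑-≤ (suc N) (λ k k< → ∣⇒≤ (leibniz N M all N k ≤-refl (s≤s⁻¹ k<))) ⟩
    ∑ (suc N) (λ _ → M) ≡⟨ ∑-const (suc N) M ⟩
    suc N * M ∎)
    where open ≤-Reasoning

  ∏ : ℕ → (ℕ → ℕ) → ℕ
  ∏ zero f = 1
  ∏ (suc n) f = ∏ n f * f n

  ∏-∣ : ∀ n f i → i < n → f i ∣ ∏ n f
  ∏-∣ (suc n) f i i< with m≤n⇒m<n∨m≡n i<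
  ... | inj₁ (s≤s l) = ∣m⇒∣m*n (f n) (∏-∣ n f i l)
  ... | inj₂ refl = n∣m*n (∏ n f)

  ∏-pos : ∀ n f → (∀ i → i < n → 0 < f i) → 0 < ∏ n f
  ∏-pos zero f p = s≤s z≤n
  ∏-pos (suc n) f p = *-mono-≤ (∏-pos n f (λ i i< → p i (m<n⇒m<1+n i<))) (p n ≤-refl)

  ∏-≤ : ∀ n f B → (∀ i → i < n → f i ≤ 2 ^ B) → ∏ n f ≤ 2 ^ (n * B)
  ∏-≤ zero f B p = ≤-refl
  ∏-≤ (suc n) f B p = ≤-trans (*-mono-≤ (∏-≤ n f B (λ i i< → p i (m<n⇒m<1+n i<))) (p n ≤-refl))
    (≤-reflexive (trans (sym (2^-+ (n * B) B)) (cong (2 ^_) (+-comm (n * B) B))))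

  %≡⇒∣ : ∀ a b d .{{_ : NonZero d}} → a % d ≡ b % d → d ∣ ∣ a - b ∣
  %≡⇒∣ a b d e = divides ∣ a / d - b / d ∣ (begin
    ∣ a - b ∣ ≡⟨ cong₂ ∣_-_∣ (m≡m%n+[m/n]*n a d) (trans (m≡m%n+[m/n]*n b d) (cong (_+ b / d * d) (sym e))) ⟩
    ∣ a % d + a / d * d - a % d + b / d * d ∣ ≡⟨ ∣m+n-m+o∣≡∣n-o∣ (a % d) (a / d * d) (b / d * d) ⟩
    ∣ a / d * d - b / d * d ∣ ≡⟨ sym (*-distribʳ-∣-∣ d (a / d) (b / d)) ⟩
    ∣ a / d - b / d ∣ * d ∎)
    where open ≡-Reasoning

  InjectiveOn : ℕ → (ℕ → ℕ) → Set
  InjectiveOn n X = ∀ i j → i < n → j < n → X i ≡ X j → i ≡ j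

  -- If every modulus up to n² B + 2 failed, the product of all differences
  -- would be a common multiple of 1, ..., n² B + 2, hence too large.
  mod-injective : ∀ n B X → InjectiveOn n X → (∀ i → i < n → X i < 2 ^ B) →
    ∃ λ d → d ≤ n * (n * B) + 1 × InjectiveOn n (λ i → X i % suc d)
  mod-injective n B X inj X< with anyUpTo? (λ d → ¬? (collision? d)) (2 + n * (n * B))
    where
    Collision : ℕ → Set
    Collision d = ∃ λ i → i < n × ∃ λ j → j < n × i ≢ j × X i % suc d ≡ X j % suc d
    collision? : ∀ d → Dec (Collision d)
    collision? d = anyUpTo? (λ i → anyUpTo? (λ j → ¬? (i ≟ j) ×-dec (X i % suc d ≟ X j % suc d)) n) n
  ... | yes (d , d< , ok) = d , subst (d ≤_) (+-comm 1 (n * (n * B))) (s≤s⁻¹ d<) , good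
    where
    good : InjectiveOn n (λ i → X i % suc d)
    good i j i< j< e with i ≟ j
    ... | yes i≡j = i≡j
    ... | no i≢j = contradiction (i , i< , j , j< , i≢j , e) ok
  ... | no none = contradiction (^-monoʳ-< 2 (s≤s (s≤s z≤n)) {x = n * (n * B)} {1 + n * (n * B)} ≤-refl) (≤⇒≯ (≤-trans (commonMultiple-≥ (1 + n * (n * B)) M {{>-nonZero M>0}} all) M≤))
    where
    -- The value 1 on the diagonal keeps the product nonzero. With n² factors of at most 2 ^ B the
    -- product is at most 2 ^ (n² B), whereas a common multiple of 1, ..., n² B + 2 is at least 2 ^
    -- (n² B + 1).
    δ : ℕ → ℕ → ℕ
    δ i j with i ≟ j
    ... | yes _ = 1
    ... | no _ = ∣ X i - X j ∣
    δ-pos : ∀ i j → i < n → j < n → 0 < δ i j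
    δ-pos i j i< j< with i ≟ j
    ... | yes _ = s≤s z≤n
    ... | no i≢j with ∣ X i - X j ∣ in e
    ... | zero = contradiction (inj i j i< j< (∣m-n∣≡0⇒m≡n e)) i≢j
    ... | suc _ = s≤s z≤n
    δ-≤ : ∀ i j → i < n → j < n → δ i j ≤ 2 ^ B
    δ-≤ i j i< j< with i ≟ j
    ... | yes _ = m^n>0 2 B
    ... | no _ = ≤-trans (∣m-n∣≤m⊔n (X i) (X j)) (⊔-lub (<⇒≤ (X< i i<)) (<⇒≤ (X< j j<)))
    M = ∏ n (λ i → ∏ n (δ i))
    M>0 : 0 < M
    M>0 = ∏-pos n _ (λ i i< → ∏-pos n _ (λ j j< → δ-pos i j i< j<))
    M≤ : M ≤ 2 ^ (n * (n * B))
    M≤ = ∏-≤ n _ (n * B) (λ i i< → ∏-≤ n _ B (λ j j< → δ-≤ i j i< j<))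
    all : ∀ d → d ≤ 1 + n * (n * B) → suc d ∣ M
    all d d≤ with anyUpTo? (λ i → anyUpTo? (λ j → ¬? (i ≟ j) ×-dec (X i % suc d ≟ X j % suc d)) n) n
    ... | no ok = contradiction (d , s≤s d≤ , ok) none
    ... | yes (i , i< , j , j< , i≢j , e) = ∣-trans step (∣-trans (∏-∣ n (δ i) j j<) (∏-∣ n (λ i → ∏ n (δ i)) i i<))
      where
      step : suc d ∣ δ i j
      step with i ≟ j
      ... | yes i≡j = contradiction i≡j i≢j
      ... | no _ = %≡⇒∣ (X i) (X j) (suc d) e

-- Logarithms and sums; tabulation hashing by conditional expectations.

module Tabulating where
  open BitFields
  open StraightLine using (update-same; update-other)
  open CommonMultiples
  open import Defs using (wrap; update)
  open import Data.Nat.Logarithm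
  open import Data.Nat.Logarithm.Core using (⌈log2⌉)
  open import Data.Nat.Induction using (<-wellFounded)
  open import Induction.WellFounded using (Acc; acc)
  open import Data.List using (List; []; _∷_; _++_)
  open import Data.List.Relation.Unary.All using (All; []; _∷_)
  open import Data.List.Relation.Unary.All.Properties using (++⁺)
  open import Data.Empty using (⊥-elim)

  log-≥ : ∀ n → n ≤ 2 ^ ⌈log₂ n ⌉
  log-≥ n = go n (<-wellFounded n)
    where
    go : ∀ n (a : Acc _<_ n) → n ≤ 2 ^ ⌈log2⌉ n a
    go zero (acc _) = z≤n
    go (suc zero) (acc _) = s≤s z≤n
    go (suc (suc n)) (acc rs) = begin
      2 + n ≤⟨ +-monoʳ-≤ 2 (≤-trans (≤-reflexive (sym (⌊n/2⌋+⌈n/2⌉≡n n))) (+-monoˡ-≤ ⌈ n /2⌉ (⌊n/2⌋≤⌈n/2⌉ n))) ⟩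
      2 + (⌈ n /2⌉ + ⌈ n /2⌉) ≡⟨ ring ⌈ n /2⌉ ⟩
      2 * suc ⌈ n /2⌉ ≤⟨ *-monoʳ-≤ 2 (go (suc ⌈ n /2⌉) _) ⟩
      2 ^ ⌈log2⌉ (2 + n) (acc rs) ∎
      where
      open ≤-Reasoning
      ring : ∀ x → 2 + (x + x) ≡ 2 * suc x
      ring = solve-∀

  log-≤ : ∀ {n k} → n ≤ 2 ^ k → ⌈log₂ n ⌉ ≤ k
  log-≤ {n} {k} l = subst (⌈log₂ n ⌉ ≤_) (⌈log₂2^n⌉≡n k) (⌈log₂⌉-mono-≤ l)

  log-< : ∀ {n} → 1 ≤ n → 2 ^ ⌈log₂ n ⌉ < 2 * n
  log-< {n} 1≤n with ⌈log₂ n ⌉ in e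
  ... | zero = *-monoʳ-≤ 2 1≤n
  ... | suc k with 2 ^ suc k <? 2 * n
  ... | yes l = l
  ... | no ¬l = contradiction (log-≤ {n} {k} (*-cancelˡ-≤ 2 (≮⇒≥ ¬l))) (<⇒≱ (subst (k <_) (sym e) ≤-refl))

  ind : Bool → ℕ
  ind b = if b then 1 else 0

  ≡ᵇ-true : ∀ {a b} → (a ≡ᵇ b) ≡ true → a ≡ b
  ≡ᵇ-true {a} {b} e = ≡ᵇ⇒≡ a b (subst T (sym e) tt)

  ≡⇒true : ∀ {a b} → a ≡ b → (a ≡ᵇ b) ≡ true
  ≡⇒true {a} {b} p with a ≡ᵇ b in e
  ... | true = refl
  ... | false = ⊥-elim (subst T e (≡⇒≡ᵇ a b p))

  ≢⇒false : ∀ {a b} → a ≢ b → (a ≡ᵇ b) ≡ false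
  ≢⇒false {a} {b} p with a ≡ᵇ b in e
  ... | true = contradiction (≡ᵇ-true e) p
  ... | false = refl

  ∑-zero : ∀ n {f : ℕ → ℕ} → (∀ i → i < n → f i ≡ 0) → ∑ n f ≡ 0
  ∑-zero n p = trans (∑-cong n p) (trans (∑-const n 0) (*-zeroʳ n))

  ∑-swap : ∀ m n (f : ℕ → ℕ → ℕ) → ∑ m (λ i → ∑ n (f i)) ≡ ∑ n (λ j → ∑ m (λ i → f i j))
  ∑-swap zero n f = sym (∑-zero n (λ _ _ → refl))
  ∑-swap (suc m) n f = trans (cong (_+ ∑ n (f m)) (∑-swap m n f)) (sym (∑-+ n (λ j → ∑ m (λ i → f i j)) (f m)))

  ∑-term : ∀ n (f : ℕ → ℕ) i → i < n → f i ≤ ∑ n f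
  ∑-term n f i i< = ≤-trans (m≤n+m (f i) (∑ i f)) (∑-mono f i<)

  ∑-split : ∀ a b f → ∑ (a + b) f ≡ ∑ a f + ∑ b (λ j → f (a + j))
  ∑-split a zero f = trans (cong (λ z → ∑ z f) (+-identityʳ a)) (sym (+-identityʳ _))
  ∑-split a (suc b) f = trans (cong (λ z → ∑ z f) (+-suc a b)) (trans (cong (_+ f (a + b)) (∑-split a b f)) (+-assoc (∑ a f) _ _))

  ∑-blocks : ∀ W r f → ∑ (W * r) f ≡ ∑ W (λ i → ∑ r (λ j → f (i * r + j)))
  ∑-blocks zero r f = refl
  ∑-blocks (suc W) r f = trans (cong (λ z → ∑ z f) (+-comm r (W * r)))
    (trans (∑-split (W * r) r f) (cong (_+ ∑ r (λ j → f (W * r + j))) (∑-blocks W r f)))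

  ∑-unique : ∀ n (P : ℕ → Bool) → (∀ i j → i < n → j < n → P i ≡ true → P j ≡ true → i ≡ j) → ∑ n (ind ∘ P) ≤ 1
  ∑-unique zero P u = z≤n
  ∑-unique (suc n) P u with P n in e
  ... | false = ≤-trans (≤-reflexive (+-identityʳ _)) (∑-unique n P (λ i j i< j< → u i j (m<n⇒m<1+n i<) (m<n⇒m<1+n j<)))
  ... | true = ≤-reflexive (cong (_+ 1) (∑-zero n none))
    where
    none : ∀ i → i < n → ind (P i) ≡ 0
    none i i< with P i in e′
    ... | true = contradiction (u i n (m<n⇒m<1+n i<) ≤-refl e′ e) (<⇒≢ i<)
    ... | false = refl

  ∑-single : ∀ n k (f : ℕ → ℕ) → k < n → ∑ n (λ d → if d ≡ᵇ k then f d else 0) ≡ f k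
  ∑-single (suc n) k f k< with m≤n⇒m<n∨m≡n k<
  ... | inj₁ (s≤s k<n) rewrite ≢⇒false {n} {k} (≢-sym (<⇒≢ k<n)) = trans (+-identityʳ _) (∑-single n k f k<n)
  ... | inj₂ refl rewrite ≡⇒true {n} {n} refl = cong (_+ f n) (∑-zero n none)
    where
    none : ∀ i → i < n → (if i ≡ᵇ n then f i else 0) ≡ 0
    none i i< rewrite ≢⇒false {i} {n} (<⇒≢ i<) = refl

  below-average : ∀ R (F : ℕ → ℕ) → 1 ≤ R → ∃ λ v → v < R × R * F v ≤ ∑ R F
  below-average R F 1≤R with anyUpTo? (λ v → R * F v ≤? ∑ R F) R
  ... | yes p = p
  ... | no none = contradiction (begin-strict
      R * ∑ R F <⟨ *-monoʳ-< R {{>-nonZero 1≤R}} ≤-refl ⟩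
      R * suc (∑ R F) ≡⟨ sym (∑-const R (suc (∑ R F))) ⟩
      ∑ R (λ _ → suc (∑ R F)) ≤⟨ ∑-≤ R (λ v v< → ≰⇒> (λ l → none (v , v< , l))) ⟩
      ∑ R (λ v → R * F v) ≡⟨ ∑-* R R F ⟩
      R * ∑ R F ∎) (<-irrefl refl)
    where open ≤-Reasoning

  mod-cancel : ∀ a j k r .{{_ : NonZero r}} → j < r → k < r → (a + j) % r ≡ (a + k) % r → j ≡ k
  mod-cancel a j k r j< k< e with j ≟ k
  ... | yes p = p
  ... | no j≢k = contradiction
        (∣⇒≤ {{≢-nonZero (λ z → j≢k (∣m-n∣≡0⇒m≡n z))}} (subst (r ∣_) (∣m+n-m+o∣≡∣n-o∣ a j k) (%≡⇒∣ (a + j) (a + k) r e)))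
        (<⇒≱ (≤-<-trans (∣m-n∣≤m⊔n j k) (⊔-lub j< k<)))

  -- Each of the W blocks of r consecutive values of v meets a given residue at most once. Read as a
  -- probability: a uniform v below W * r collides with probability at most 1 / r.
  count-residue : ∀ W r .{{_ : NonZero r}} a b → ∑ (W * r) (λ v → ind ((a + v) % r ≡ᵇ b % r)) ≤ W
  count-residue W r a b = begin
    ∑ (W * r) _ ≡⟨ ∑-blocks W r _ ⟩
    ∑ W (λ i → ∑ r (λ j → ind ((a + (i * r + j)) % r ≡ᵇ b % r))) ≤⟨ ∑-≤ W (λ i _ → ∑-unique r _ (once i)) ⟩
    ∑ W (λ _ → 1) ≡⟨ ∑-const W 1 ⟩
    W * 1 ≡⟨ *-identityʳ W ⟩
    W ∎
    where
    open ≤-Reasoning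
    once : ∀ i j k → j < r → k < r → ((a + (i * r + j)) % r ≡ᵇ b % r) ≡ true → ((a + (i * r + k)) % r ≡ᵇ b % r) ≡ true → j ≡ k
    once i j k j< k< p q = mod-cancel (a + i * r) j k r j< k<
      (trans (cong (_% r) (+-assoc a (i * r) j)) (trans (≡ᵇ-true p) (trans (sym (≡ᵇ-true q)) (cong (_% r) (sym (+-assoc a (i * r) k))))))

  sumOver : ∀ {A : Set} → List A → (A → ℕ) → ℕ
  sumOver [] f = 0
  sumOver (x ∷ l) f = f x + sumOver l f

  sumOver-++ : ∀ {A : Set} (l k : List A) f → sumOver (l ++ k) f ≡ sumOver l f + sumOver k f
  sumOver-++ [] k f = refl
  sumOver-++ (x ∷ l) k f = trans (cong (f x +_) (sumOver-++ l k f)) (sym (+-assoc (f x) _ _))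

  sumOver-∑ : ∀ {A : Set} n (l : List A) (f : ℕ → A → ℕ) → ∑ n (λ v → sumOver l (f v)) ≡ sumOver l (λ x → ∑ n (λ v → f v x))
  sumOver-∑ n [] f = ∑-zero n (λ _ _ → refl)
  sumOver-∑ n (x ∷ l) f = trans (∑-+ n (λ v → f v x) (λ v → sumOver l (f v))) (cong (∑ n (λ v → f v x) +_) (sumOver-∑ n l f))

  sumOver-≤ : ∀ {A : Set} {P : A → Set} {f g : A → ℕ} {l} → All P l → (∀ x → P x → f x ≤ g x) → sumOver l f ≤ sumOver l g
  sumOver-≤ [] h = z≤n
  sumOver-≤ (p ∷ ps) h = +-mono-≤ (h _ p) (sumOver-≤ ps h)

  -- One pair of keys: `u` and `v` mark the table entries that each key sums up, and the test fails
  -- if the two sums agree modulo `r`. Entries range over R = W * r values, so `W` is R times the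
  -- failure probability of a random table.
  record Test (R : ℕ) : Set where
    field
      u v  : ℕ → Bool
      r W  : ℕ
      {{r≢0}} : NonZero r
      size : W * r ≡ R
  open Test

  linear : ℕ → (ℕ → ℕ) → (ℕ → Bool) → ℕ
  linear M tab u = ∑ M (λ t → if u t then tab t else 0)

  bad : ∀ {R} → ℕ → (ℕ → ℕ) → Test R → ℕ
  bad M tab q = ind (linear M tab (u q) % r q ≡ᵇ linear M tab (v q) % r q)

  Separated : ∀ {R} → ℕ → Test R → Set
  Separated M q = ∃ λ t → t < M × u q t ≢ v q t

  Agree Differ : ∀ {R} → ℕ → Test R → Set
  Agree M q = Separated M q × u q M ≡ v q M
  Differ M q = u q M ≢ v q M

  split : ∀ {R} M (l : List (Test R)) → All (Separated (suc M)) l →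
    Σ (List (Test R)) λ l₁ → Σ (List (Test R)) λ l₂ → All (Agree M) l₁ × All (Differ M) l₂
      × (∀ f → sumOver l f ≡ sumOver l₁ f + sumOver l₂ f)
  split M [] [] = [] , [] , [] , [] , λ f → refl
  split M (q ∷ l) (s ∷ ss) with split M l ss | u q M Data.Bool.≟ v q M
  ... | l₁ , l₂ , a₁ , a₂ , e | no ne = l₁ , q ∷ l₂ , a₁ , ne ∷ a₂ , λ f → trans (cong (f q +_) (e f)) (ring (f q) (sumOver l₁ f) (sumOver l₂ f))
    where
    ring : ∀ x y z → x + (y + z) ≡ y + (x + z)
    ring = solve-∀
  split M (q ∷ l) ((t , t< , ne) ∷ ss) | l₁ , l₂ , a₁ , a₂ , e | yes p =
    q ∷ l₁ , l₂ , ((t , earlier , ne) , p) ∷ a₁ , a₂ , λ f → trans (cong (f q +_) (e f)) (sym (+-assoc (f q) _ _))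
    where
    earlier : t < M
    earlier with m≤n⇒m<n∨m≡n t<
    ... | inj₁ (s≤s l) = l
    ... | inj₂ refl = contradiction p ne

  -- Method of conditional expectations: a test is decided by the last table
  -- entry on which its two keys differ, and given the earlier entries at most
  -- one residue of that entry makes the keys collide.
  derandomize : ∀ {R} → 1 ≤ R → ∀ M (l : List (Test R)) → All (Separated M) l →
    ∃ λ tab → (∀ t → tab t < R) × R * sumOver l (bad M tab) ≤ sumOver l W
  derandomize {R} 1≤R zero [] [] = (λ _ → 0) , (λ _ → 1≤R) , ≤-reflexive (*-zeroʳ R)
  derandomize {R} 1≤R zero (q ∷ l) ((_ , () , _) ∷ _)
  derandomize {R} 1≤R (suc M) l sep with split M l sep
  ... | l₁ , l₂ , agree , differ , sum-split with derandomize 1≤R M l₁ (Data.List.Relation.Unary.All.map proj₁ agree)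
  ... | tab , tab< , IH with below-average R (λ x → sumOver l₂ (bad (suc M) (update tab M x))) 1≤R
  ... | x , x< , avg = tab′ , tab′< , (begin
      R * sumOver l (bad (suc M) tab′) ≡⟨ cong (R *_) (sum-split _) ⟩
      R * (sumOver l₁ (bad (suc M) tab′) + sumOver l₂ (bad (suc M) tab′)) ≡⟨ *-distribˡ-+ R (sumOver l₁ _) (sumOver l₂ _) ⟩
      R * sumOver l₁ (bad (suc M) tab′) + R * sumOver l₂ (bad (suc M) tab′)
        ≤⟨ +-mono-≤ (≤-trans (*-monoʳ-≤ R (sumOver-≤ agree (λ q p → same q (proj₂ p)))) IH)
             (≤-trans avg (≤-trans (≤-reflexive (sumOver-∑ R l₂ _)) (sumOver-≤ differ few))) ⟩
      sumOver l₁ W + sumOver l₂ W ≡⟨ sym (sum-split W) ⟩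
      sumOver l W ∎)
    where
    open ≤-Reasoning
    tab′ = update tab M x
    tab′< : ∀ t → tab′ t < R
    tab′< t with t ≡ᵇ M
    ... | true = x<
    ... | false = tab< t
    prefix : ∀ y us → linear M (update tab M y) us ≡ linear M tab us
    prefix y us = ∑-cong M (λ t t< → cong (λ z → if us t then z else 0) (update-other tab y (<⇒≢ t<)))
    -- If both keys use the new entry or neither does, the same amount is added to both sums, and
    -- whether they agree modulo r was settled before.
    same : ∀ q → u q M ≡ v q M → bad (suc M) tab′ q ≤ bad M tab q
    same q p with linear (suc M) tab′ (u q) % r q ≡ᵇ linear (suc M) tab′ (v q) % r q in e
    ... | false = z≤n
    ... | true = ≤-reflexive (cong ind (sym (≡⇒true cancel)))
      where
      y = if v q M then tab′ M else 0
      a = linear M tab (u q)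
      b = linear M tab (v q)
      e′ : (y + a) % r q ≡ (y + b) % r q
      e′ = trans (cong (_% r q) (trans (+-comm y a) (cong₂ _+_ (sym (prefix x (u q))) (cong (λ z → if z then tab′ M else 0) (sym p)))))
        (trans (≡ᵇ-true e) (cong (_% r q) (trans (cong (_+ y) (prefix x (v q))) (+-comm b y))))
      cancel : a % r q ≡ b % r q
      cancel = mod-cancel y (a % r q) (b % r q) (r q) (m%n<n a (r q)) (m%n<n b (r q)) (trans (red a) (trans e′ (sym (red b))))
        where
        red : ∀ c → (y + c % r q) % r q ≡ (y + c) % r q
        red c = trans (%-distribˡ-+ y (c % r q) (r q)) (trans (cong (λ z → (y % r q + z) % r q) (m%n%n≡m%n c (r q))) (sym (%-distribˡ-+ y c (r q))))
    -- Exactly one of the two sums contains the new entry, so for fixed earlier entries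
    -- `count-residue` applies.
    few : ∀ q → Differ M q → ∑ R (λ y → bad (suc M) (update tab M y) q) ≤ W q
    few q d = ≤-trans (≤-reflexive (trans (cong (λ z → ∑ z _) (sym (size q))) (∑-cong (W q * r q) (λ y _ → cong ind (shape y)))))
        (bound (u q M) (v q M) d)
      where
      a = linear M tab (u q)
      b = linear M tab (v q)
      shape : ∀ y → (linear (suc M) (update tab M y) (u q) % r q ≡ᵇ linear (suc M) (update tab M y) (v q) % r q)
        ≡ ((a + (if u q M then y else 0)) % r q ≡ᵇ (b + (if v q M then y else 0)) % r q)
      shape y = cong₂ (λ s t → s % r q ≡ᵇ t % r q)
        (cong₂ _+_ (prefix y (u q)) (cong (λ z → if u q M then z else 0) (update-same tab M y)))
        (cong₂ _+_ (prefix y (v q)) (cong (λ z → if v q M then z else 0) (update-same tab M y)))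
      ≡ᵇ-sym : ∀ s t → (s ≡ᵇ t) ≡ (t ≡ᵇ s)
      ≡ᵇ-sym zero zero = refl
      ≡ᵇ-sym zero (suc t) = refl
      ≡ᵇ-sym (suc s) zero = refl
      ≡ᵇ-sym (suc s) (suc t) = ≡ᵇ-sym s t
      bound : ∀ p q′ → p ≢ q′ → ∑ (W q * r q) (λ y → ind ((a + (if p then y else 0)) % r q ≡ᵇ (b + (if q′ then y else 0)) % r q)) ≤ W q
      bound true true ne = contradiction refl ne
      bound false false ne = contradiction refl ne
      bound true false ne = count-residue (W q) (r q) a (b + 0)
      bound false true ne = ≤-trans (≤-reflexive (∑-cong (W q * r q) (λ y _ → cong ind (≡ᵇ-sym ((a + 0) % r q) ((b + y) % r q))))) (count-residue (W q) (r q) b (a + 0))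

  module Tabulation (β : ℕ) .{{_ : NonZero β}} where

    digit : ℕ → ℕ → ℕ
    digit zero y = y % β
    digit (suc j) y = digit j (y / β)

    digit-< : ∀ j y → digit j y < β
    digit-< zero y = m%n<n y β
    digit-< (suc j) y = digit-< j (y / β)

    -- Simple tabulation over base-β digits, with one subtable of β entries per digit laid out
    -- consecutively in `tab`. Addition takes the place of exclusive or, so that the hash is linear
    -- in the table entries.
    hash : ℕ → (ℕ → ℕ) → ℕ → ℕ
    hash c tab y = ∑ c (λ j → tab (j * β + digit j y))

    uses : ℕ → ℕ → Bool
    uses y t = t % β ≡ᵇ digit (t / β) y

    private
      at% : ∀ j {d} → d < β → (j * β + d) % β ≡ d
      at% j {d} d< = trans (cong (_% β) (+-comm (j * β) d)) (trans ([m+kn]%n≡m%n d j β) (m<n⇒m%n≡m d<))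
      at/ : ∀ j {d} → d < β → (j * β + d) / β ≡ j
      at/ j {d} d< = trans (+-distrib-/-∣ˡ {j * β} d (divides j refl)) (trans (cong₂ _+_ (m*n/n≡m j β) (m<n⇒m/n≡0 d<)) (+-identityʳ j))

    hash-linear : ∀ c tab y → linear (c * β) tab (uses y) ≡ hash c tab y
    hash-linear c tab y = trans (∑-blocks c β _) (∑-cong c (λ j _ → trans
      (∑-cong β (λ d d< → cong₂ (λ s t → if s ≡ᵇ digit t y then tab (j * β + d) else 0) (at% j d<) (at/ j d<)))
      (∑-single β (digit j y) (λ d → tab (j * β + d)) (digit-< j y))))

    digits-differ : ∀ c y z → y < β ^ c → z < β ^ c → y ≢ z → ∃ λ j → j < c × digit j y ≢ digit j z
    digits-differ zero zero zero _ _ ne = contradiction refl ne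
    digits-differ zero (suc _) _ (s≤s ()) _ _
    digits-differ zero zero (suc _) _ (s≤s ()) _
    digits-differ (suc c) y z y< z< ne with y % β ≟ z % β
    ... | no d = 0 , s≤s z≤n , d
    ... | yes e with digits-differ c (y / β) (z / β) (m<n*o⇒m/o<n (subst (y <_) (*-comm β (β ^ c)) y<)) (m<n*o⇒m/o<n (subst (z <_) (*-comm β (β ^ c)) z<))
                  (λ q → ne (trans (m≡m%n+[m/n]*n y β) (trans (cong₂ (λ s t → s + t * β) e q) (sym (m≡m%n+[m/n]*n z β)))))
    ... | j , j< , d = suc j , s≤s j< , d

    separated : ∀ c y z → y < β ^ c → z < β ^ c → y ≢ z → ∃ λ t → t < c * β × uses y t ≢ uses z t
    separated c y z y< z< ne with digits-differ c y z y< z< ne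
    ... | j , j< , d = j * β + digit j y
        , <-≤-trans (+-monoʳ-< (j * β) (digit-< j y)) (≤-trans (≤-reflexive (+-comm (j * β) β)) (*-monoˡ-≤ β j<))
        , λ p → contradiction (trans (sym y-uses) (trans p z-not)) λ ()
      where
      y-uses : uses y (j * β + digit j y) ≡ true
      y-uses = trans (cong₂ (λ s t → s ≡ᵇ digit t y) (at% j (digit-< j y)) (at/ j (digit-< j y))) (≡⇒true {digit j y} refl)
      z-not : uses z (j * β + digit j y) ≡ false
      z-not = trans (cong₂ (λ s t → s ≡ᵇ digit t z) (at% j (digit-< j y)) (at/ j (digit-< j y))) (≢⇒false d)

    -- Comparing only κ low bits lets one table serve buckets with ranges of different sizes.
    collide : ℕ → (ℕ → ℕ) → ℕ → ℕ → ℕ → Bool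
    collide c tab κ y z = wrap κ (hash c tab y) ≡ᵇ wrap κ (hash c tab z)

    collect : ∀ {A : Set} → ℕ → (ℕ → List A) → List A
    collect zero f = []
    collect (suc n) f = collect n f ++ f n

    sumOver-collect : ∀ {A : Set} n (f : ℕ → List A) g → sumOver (collect n f) g ≡ ∑ n (λ i → sumOver (f i) g)
    sumOver-collect zero f g = refl
    sumOver-collect (suc n) f g = trans (sumOver-++ (collect n f) (f n) g) (cong (_+ sumOver (f n) g) (sumOver-collect n f g))

    collect-All : ∀ {A : Set} {P : A → Set} n (f : ℕ → List A) → (∀ i → i < n → All P (f i)) → All P (collect n f)
    collect-All zero f h = []
    collect-All (suc n) f h = ++⁺ (collect-All n f (λ i i< → h i (m<n⇒m<1+n i<))) (h n ≤-refl)

    module _ (c τ n : ℕ) (Y : ℕ → ℕ) (Y-inj : InjectiveOn n Y) (Y< : ∀ i → i < n → Y i < β ^ c) where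

      -- The bound met by a random table on average: a pair of family k collides with probability 2
      -- ^ -κ k, and everything is multiplied by 2 ^ τ. The top level uses a single family of pairs,
      -- the second level one family per bucket.
      FewCollisions : Set
      FewCollisions = ∀ m (p : ℕ → ℕ → ℕ → Bool) (κ : ℕ → ℕ) →
        (∀ k → k < m → κ k ≤ τ) → (∀ k i j → p k i j ≡ true → i ≢ j) →
        ∃ λ tab → (∀ t → tab t < 2 ^ τ) ×
          2 ^ τ * ∑ m (λ k → ∑ n (λ i → ∑ n (λ j → if p k i j then ind (collide c tab (κ k) (Y i) (Y j)) else 0)))
            ≤ ∑ m (λ k → ∑ n (λ i → ∑ n (λ j → if p k i j then 2 ^ (τ ∸ κ k) else 0)))

      few-collisions′ : FewCollisions
      few-collisions′ m p κ κ≤ p-irr = tab , tab< , subst₂ (λ a b → 2 ^ τ * a ≤ b) (total (bad (c * β) tab) (λ k i j → ind (collide c tab (κ k) (Y i) (Y j))) bad-is) (total W (λ k _ _ → 2 ^ (τ ∸ κ k)) (λ _ _ _ _ → refl)) bound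
        where
        test : ∀ k i j → k < m → Test (2 ^ τ)
        test k i j k< = record { u = uses (Y i) ; v = uses (Y j) ; r = 2 ^ κ k ; W = 2 ^ (τ ∸ κ k) ; r≢0 = m^n≢0 2 (κ k)
          ; size = trans (sym (2^-+ (τ ∸ κ k) (κ k))) (cong (2 ^_) (m∸n+n≡m (κ≤ k k<))) }
        entry : ∀ k i j → List (Test (2 ^ τ))
        entry k i j with k <? m | p k i j
        ... | yes k< | true = test k i j k< ∷ []
        ... | _ | _ = []
        tests : List (Test (2 ^ τ))
        tests = collect m (λ k → collect n (λ i → collect n (λ j → entry k i j)))
        sep : All (Separated (c * β)) tests
        sep = collect-All m _ (λ k k< → collect-All n _ (λ i i< → collect-All n _ (λ j j< → one k i j i< j<)))
          where
          one : ∀ k i j → i < n → j < n → All (Separated (c * β)) (entry k i j)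
          one k i j i< j< with k <? m | p k i j in e
          ... | yes k< | true = separated c (Y i) (Y j) (Y< i i<) (Y< j j<) (λ q → p-irr k i j e (Y-inj i j i< j< q)) ∷ []
          ... | yes _ | false = []
          ... | no _ | _ = []
        found = derandomize (m^n>0 2 τ) (c * β) tests sep
        tab = proj₁ found
        tab< = proj₁ (proj₂ found)
        bound = proj₂ (proj₂ found)
        total : ∀ f (g : ℕ → ℕ → ℕ → ℕ) → (∀ k i j k< → f (test k i j k<) ≡ g k i j) →
          sumOver tests f ≡ ∑ m (λ k → ∑ n (λ i → ∑ n (λ j → if p k i j then g k i j else 0)))
        total f g fg = trans (sumOver-collect m _ f) (∑-cong m (λ k k< → trans (sumOver-collect n _ f) (∑-cong n (λ i _ →
          trans (sumOver-collect n _ f) (∑-cong n (λ j _ → one k i j k<))))))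
          where
          one : ∀ k i j → k < m → sumOver (entry k i j) f ≡ (if p k i j then g k i j else 0)
          one k i j k< with k <? m | p k i j
          ... | yes k<′ | true = trans (+-identityʳ _) (fg k i j k<′)
          ... | yes _ | false = refl
          ... | no ¬k< | _ = contradiction k< ¬k<
        bad-is : ∀ k i j k< → bad (c * β) tab (test k i j k<) ≡ ind (collide c tab (κ k) (Y i) (Y j))
        bad-is k i j k< = cong₂ (λ s t → ind (wrap (κ k) s ≡ᵇ wrap (κ k) t)) (hash-linear c tab (Y i)) (hash-linear c tab (Y j))

      opaque
        few-collisions : FewCollisions
        few-collisions = few-collisions′

-- Perfect hashing with a shared sequence of second-level functions.

module TwoLevelHashing where
  open BitFields
  open CommonMultiples
  open Tabulating
  open import Defs using (wrap)
  open import Data.Nat.Logarithm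
  open import Relation.Binary.Definitions using (tri<; tri≈; tri>)

  ∧-true : ∀ {a b} → (a ∧ b) ≡ true → a ≡ true × b ≡ true
  ∧-true {true} {true} _ = refl , refl

  lastTrue : (ℕ → Bool) → ℕ → ℕ
  lastTrue b zero = 0
  lastTrue b (suc F) = if b F then F else lastTrue b F

  -- Since `b` never returns from false to true, the position of its last true value equals the
  -- number of true values after the initial one. This converts a sum of seeds into a sum over
  -- rounds.
  lastTrue-spec : ∀ b F → (∀ t → b (suc t) ≡ true → b t ≡ true) → b 0 ≡ true → b F ≡ false →
    let a = lastTrue b F in a < F × b (suc a) ≡ false × a ≤ ∑ F (ind ∘ b ∘ suc)
  lastTrue-spec b zero dec b0 bF = contradiction (trans (sym b0) bF) λ ()
  lastTrue-spec b (suc F) dec b0 bF with b F in e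
  ... | true = ≤-refl , bF , ≤-trans (≤-reflexive (sym all)) (m≤m+n _ _)
    where
    down : ∀ t d → b (d + t) ≡ true → b t ≡ true
    down t zero p = p
    down t (suc d) p = down t d (dec (d + t) p)
    all : ∑ F (ind ∘ b ∘ suc) ≡ F
    all = trans (∑-cong F (λ t t< → cong ind (down (suc t) (F ∸ suc t) (trans (cong b (m∸n+n≡m t<)) e))))
      (trans (∑-const F 1) (*-identityʳ F))
  ... | false with lastTrue-spec b F dec b0 e
  ... | a< , fl , le = m<n⇒m<1+n a< , fl , ≤-trans le (m≤m+n _ _)

  -- The second-level functions form a single short
  -- sequence shared by all buckets; each function of the sequence resolves at
  -- least half of the buckets that are still unresolved.
  module PerfectHash (β : ℕ) .{{_ : NonZero β}} (c n ρ : ℕ) (Y : ℕ → ℕ)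
    (Y-inj : InjectiveOn n Y) (Y< : ∀ i → i < n → Y i < β ^ c) (n≤ : n ≤ 2 ^ ρ) where
    open Tabulation β

    -- A bucket contributes at most 2n ≤ 2 * 2 ^ ρ pairs and its range must be at least twice that
    -- number; two bits beyond ρ suffice for every bucket.
    τ : ℕ
    τ = ρ + 2

    private
      τ-split : 2 ^ τ ≡ 4 * 2 ^ ρ
      τ-split = trans (2^-+ ρ 2) (*-comm (2 ^ ρ) 4)

      top = few-collisions c τ n Y Y-inj Y< 1 (λ _ i j → not (j ≡ᵇ i)) (λ _ → ρ) (λ _ _ → m≤m+n ρ 2)
        λ _ i j e i≡j → contradiction (trans (sym (cong not (≡⇒true {j} {i} (sym i≡j)))) e) λ ()

    topTable : ℕ → ℕ
    topTable = proj₁ top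

    topTable< : ∀ t → topTable t < 2 ^ τ
    topTable< = proj₁ (proj₂ top)

    bucket : ℕ → ℕ
    bucket i = wrap ρ (hash c topTable (Y i))

    bucket< : ∀ i → bucket i < 2 ^ ρ
    bucket< i = wrap-< ρ _

    same? : ℕ → ℕ → ℕ → Bool
    same? k i j = (bucket i ≡ᵇ k) ∧ (bucket j ≡ᵇ k)

    -- The square of the size of bucket `k`, written as a count of ordered pairs so that it can be
    -- summed and compared with collisions termwise.
    pairs : ℕ → ℕ
    pairs k = ∑ n (λ i → ∑ n (λ j → ind (same? k i j)))

    private
      collisions = ∑ n (λ i → ∑ n (λ j → if not (j ≡ᵇ i) then ind (bucket i ≡ᵇ bucket j) else 0))

      -- There are at most n² ordered pairs, each collides with probability 2 ^ -ρ, and n ≤ 2 ^ ρ.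
      collisions≤ : collisions ≤ n
      collisions≤ = *-cancelˡ-≤ (2 ^ τ) {{m^n≢0 2 τ}} (begin
        2 ^ τ * collisions ≤⟨ proj₂ (proj₂ top) ⟩
        ∑ n (λ i → ∑ n (λ j → if not (j ≡ᵇ i) then 2 ^ (τ ∸ ρ) else 0))
          ≤⟨ ∑-≤ n (λ i _ → ≤-trans (∑-≤ n (λ j _ → drop (not (j ≡ᵇ i)))) (≤-reflexive (∑-const n _))) ⟩
        ∑ n (λ _ → n * 2 ^ (τ ∸ ρ)) ≡⟨ ∑-const n _ ⟩
        n * (n * 2 ^ (τ ∸ ρ)) ≤⟨ *-monoʳ-≤ n (*-monoˡ-≤ (2 ^ (τ ∸ ρ)) n≤) ⟩
        n * (2 ^ ρ * 2 ^ (τ ∸ ρ)) ≡⟨ cong (n *_) (trans (sym (2^-+ ρ (τ ∸ ρ))) (cong (2 ^_) (m+[n∸m]≡n (m≤m+n ρ 2)))) ⟩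
        n * 2 ^ τ ≡⟨ *-comm n (2 ^ τ) ⟩
        2 ^ τ * n ∎)
        where
        open ≤-Reasoning
        drop : ∀ b → (if b then 2 ^ (τ ∸ ρ) else 0) ≤ 2 ^ (τ ∸ ρ)
        drop true = ≤-refl
        drop false = z≤n

      ∑-pairs : ∑ (2 ^ ρ) pairs ≤ 2 * n
      ∑-pairs = begin
        ∑ (2 ^ ρ) pairs ≡⟨ trans (∑-swap (2 ^ ρ) n _) (∑-cong n (λ i _ → ∑-swap (2 ^ ρ) n _)) ⟩
        ∑ n (λ i → ∑ n (λ j → ∑ (2 ^ ρ) (λ k → ind (same? k i j)))) ≤⟨ ∑-≤ n (λ i _ → ∑-≤ n (λ j _ → one i j)) ⟩
        ∑ n (λ i → ∑ n (λ j → ind (j ≡ᵇ i) + (if not (j ≡ᵇ i) then ind (bucket i ≡ᵇ bucket j) else 0)))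
          ≡⟨ trans (∑-cong n (λ i _ → ∑-+ n _ _)) (∑-+ n _ _) ⟩
        ∑ n (λ i → ∑ n (λ j → ind (j ≡ᵇ i))) + collisions
          ≤⟨ +-mono-≤ (≤-reflexive (trans (∑-cong n (λ i i< → ∑-single n i (λ _ → 1) i<)) (trans (∑-const n 1) (*-identityʳ n)))) collisions≤ ⟩
        n + n ≡⟨ cong (n +_) (sym (+-identityʳ n)) ⟩
        2 * n ∎
        where
        open ≤-Reasoning
        one : ∀ i j → ∑ (2 ^ ρ) (λ k → ind (same? k i j)) ≤ ind (j ≡ᵇ i) + (if not (j ≡ᵇ i) then ind (bucket i ≡ᵇ bucket j) else 0)
        one i j with bucket i ≡ᵇ bucket j in e
        ... | false = ≤-trans (≤-reflexive (∑-zero (2 ^ ρ) none)) z≤n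
          where
          none : ∀ k → k < 2 ^ ρ → ind (same? k i j) ≡ 0
          none k _ with same? k i j in e′
          ... | false = refl
          ... | true = contradiction (trans (sym (≡⇒true {bucket i} {bucket j} (trans (≡ᵇ-true {bucket i} {k} (proj₁ (∧-true e′))) (sym (≡ᵇ-true {bucket j} {k} (proj₂ (∧-true {bucket i ≡ᵇ k} e′))))))) e) λ ()
        ... | true = ≤-trans (∑-unique (2 ^ ρ) (λ k → same? k i j)
              (λ k l _ _ p q → trans (sym (≡ᵇ-true {bucket i} {k} (proj₁ (∧-true p)))) (≡ᵇ-true {bucket i} {l} (proj₁ (∧-true q))))) (big (j ≡ᵇ i))
          where
          big : ∀ b → 1 ≤ ind b + (if not b then 1 else 0)
          big true = ≤-refl
          big false = ≤-refl

    opaque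
      -- A range of at least twice the squared bucket size makes the expected number of clashes at
      -- most one half. As the squares add up to at most 2n, the ranges still have linear total
      -- size; an empty bucket gets range 1, the summand 1 in `range≤`.
      κ : ℕ → ℕ
      κ k = ⌈log₂ 2 * pairs k ⌉

      κ-def : ∀ k → κ k ≡ ⌈log₂ 2 * pairs k ⌉
      κ-def k = refl

    private
      pairs≤ : ∀ k → k < 2 ^ ρ → pairs k ≤ 2 * n
      pairs≤ k k< = ≤-trans (∑-term (2 ^ ρ) pairs k k<) ∑-pairs

    κ≤ : ∀ k → k < 2 ^ ρ → κ k ≤ τ
    κ≤ k k< = subst (_≤ τ) (sym (κ-def k)) (log-≤ (begin
      2 * pairs k ≤⟨ *-monoʳ-≤ 2 (≤-trans (pairs≤ k k<) (*-monoʳ-≤ 2 n≤)) ⟩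
      2 * (2 * 2 ^ ρ) ≡⟨ sym (*-assoc 2 2 (2 ^ ρ)) ⟩
      4 * 2 ^ ρ ≡⟨ sym τ-split ⟩
      2 ^ τ ∎))
      where open ≤-Reasoning

    private
      range≤ : ∀ p → 2 ^ ⌈log₂ 2 * p ⌉ ≤ 4 * p + 1
      range≤ zero = ≤-refl
      range≤ (suc p) = ≤-trans (<⇒≤ (log-< {2 * suc p} (s≤s z≤n))) (≤-trans (≤-reflexive (sym (*-assoc 2 2 (suc p)))) (m≤m+n _ 1))

    ∑-range : ∑ (2 ^ ρ) (λ k → 2 ^ κ k) ≤ 8 * n + 2 ^ ρ
    ∑-range = begin
      ∑ (2 ^ ρ) (λ k → 2 ^ κ k) ≤⟨ ∑-≤ (2 ^ ρ) (λ k _ → subst (λ z → 2 ^ z ≤ 4 * pairs k + 1) (sym (κ-def k)) (range≤ (pairs k))) ⟩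
      ∑ (2 ^ ρ) (λ k → 4 * pairs k + 1) ≡⟨ trans (∑-+ (2 ^ ρ) _ _) (cong₂ _+_ (∑-* (2 ^ ρ) 4 pairs) (∑-const (2 ^ ρ) 1)) ⟩
      4 * ∑ (2 ^ ρ) pairs + 2 ^ ρ * 1 ≤⟨ +-mono-≤ (*-monoʳ-≤ 4 ∑-pairs) (≤-reflexive (*-identityʳ (2 ^ ρ))) ⟩
      4 * (2 * n) + 2 ^ ρ ≡⟨ cong (_+ 2 ^ ρ) (sym (*-assoc 4 2 n)) ⟩
      8 * n + 2 ^ ρ ∎
      where open ≤-Reasoning

    clash : (ℕ → ℕ) → ℕ → ℕ
    clash tab k = ∑ n (λ i → ∑ n (λ j → if same? k i j ∧ not (j ≡ᵇ i) then ind (collide c tab (κ k) (Y i) (Y j)) else 0))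

    -- A still unresolved bucket expects at most 1 / 2 clashes, and a bucket that stays unresolved
    -- has at least one. The clashes summed over the remaining buckets therefore bound the number of
    -- survivors by half.
    Halving : Set
    Halving = ∀ (rem : ℕ → Bool) → ∃ λ tab → (∀ t → tab t < 2 ^ τ) ×
      2 * ∑ (2 ^ ρ) (λ k → ind (rem k ∧ (0 <ᵇ clash tab k))) ≤ ∑ (2 ^ ρ) (ind ∘ rem)

    halve′ : Halving
    halve′ rem = tab , tab< , *-cancelˡ-≤ (2 ^ τ) {{m^n≢0 2 τ}} (begin
        2 ^ τ * (2 * ∑ (2 ^ ρ) (λ k → ind (rem k ∧ (0 <ᵇ clash tab k)))) ≤⟨ *-monoʳ-≤ (2 ^ τ) (*-monoʳ-≤ 2 (∑-≤ (2 ^ ρ) (λ k _ → left k (rem k)))) ⟩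
        2 ^ τ * (2 * L) ≡⟨ ring (2 ^ τ) L ⟩
        2 * (2 ^ τ * L) ≤⟨ *-monoʳ-≤ 2 bound ⟩
        2 * ∑ (2 ^ ρ) G ≡⟨ sym (∑-* (2 ^ ρ) 2 G) ⟩
        ∑ (2 ^ ρ) (λ k → 2 * G k) ≤⟨ ∑-≤ (2 ^ ρ) (λ k k< → right k k< (rem k)) ⟩
        ∑ (2 ^ ρ) (λ k → 2 ^ τ * ind (rem k)) ≡⟨ ∑-* (2 ^ ρ) (2 ^ τ) (ind ∘ rem) ⟩
        2 ^ τ * ∑ (2 ^ ρ) (ind ∘ rem) ∎)
      where
      open ≤-Reasoning
      p : ℕ → ℕ → ℕ → Bool
      p k i j = rem k ∧ (same? k i j ∧ not (j ≡ᵇ i))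
      found = few-collisions c τ n Y Y-inj Y< (2 ^ ρ) p κ κ≤
        λ k i j e i≡j → contradiction (trans (sym (cong not (≡⇒true {j} {i} (sym i≡j)))) (proj₂ (∧-true {same? k i j} (proj₂ (∧-true {rem k} e))))) λ ()
      tab = proj₁ found
      tab< = proj₁ (proj₂ found)
      F G : ℕ → ℕ
      F k = ∑ n (λ i → ∑ n (λ j → if p k i j then ind (collide c tab (κ k) (Y i) (Y j)) else 0))
      G k = ∑ n (λ i → ∑ n (λ j → if p k i j then 2 ^ (τ ∸ κ k) else 0))
      L = ∑ (2 ^ ρ) F
      bound : 2 ^ τ * L ≤ ∑ (2 ^ ρ) G
      bound = proj₂ (proj₂ found)
      ring : ∀ a b → a * (2 * b) ≡ 2 * (a * b)
      ring = solve-∀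
      left : ∀ k b → ind (b ∧ (0 <ᵇ clash tab k)) ≤
        ∑ n (λ i → ∑ n (λ j → if b ∧ (same? k i j ∧ not (j ≡ᵇ i)) then ind (collide c tab (κ k) (Y i) (Y j)) else 0))
      left k false = z≤n
      left k true = pos (clash tab k)
        where
        pos : ∀ x → ind (0 <ᵇ x) ≤ x
        pos zero = z≤n
        pos (suc x) = s≤s z≤n
      right : ∀ k → k < 2 ^ ρ → ∀ b →
        2 * ∑ n (λ i → ∑ n (λ j → if b ∧ (same? k i j ∧ not (j ≡ᵇ i)) then 2 ^ (τ ∸ κ k) else 0)) ≤ 2 ^ τ * ind b
      right k k< false = ≤-trans (≤-reflexive (cong (2 *_) (∑-zero n (λ i _ → ∑-zero n (λ j _ → refl))))) z≤n
      right k k< true = begin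
        2 * ∑ n (λ i → ∑ n (λ j → if same? k i j ∧ not (j ≡ᵇ i) then W else 0))
          ≤⟨ *-monoʳ-≤ 2 (∑-≤ n (λ i _ → ≤-trans (∑-≤ n (λ j _ → one (same? k i j) (not (j ≡ᵇ i)))) (≤-reflexive (∑-* n W _)))) ⟩
        2 * ∑ n (λ i → W * ∑ n (λ j → ind (same? k i j))) ≡⟨ cong (2 *_) (∑-* n W _) ⟩
        2 * (W * pairs k) ≡⟨ ring₂ W (pairs k) ⟩
        W * (2 * pairs k) ≤⟨ *-monoʳ-≤ W (subst (λ z → 2 * pairs k ≤ 2 ^ z) (sym (κ-def k)) (log-≥ (2 * pairs k))) ⟩
        W * 2 ^ κ k ≡⟨ trans (sym (2^-+ (τ ∸ κ k) (κ k))) (cong (2 ^_) (m∸n+n≡m (κ≤ k k<))) ⟩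
        2 ^ τ ≡⟨ sym (*-identityʳ (2 ^ τ)) ⟩
        2 ^ τ * 1 ∎
        where
        W = 2 ^ (τ ∸ κ k)
        ring₂ : ∀ a b → 2 * (a * b) ≡ a * (2 * b)
        ring₂ = solve-∀
        one : ∀ a b → (if a ∧ b then W else 0) ≤ W * ind a
        one true true = ≤-reflexive (sym (*-identityʳ W))
        one true false = z≤n
        one false b = z≤n

    opaque
      halve : Halving
      halve = halve′

    unresolved : ℕ → ℕ → Bool
    unresolved zero k = true
    unresolved (suc t) k = unresolved t k ∧ (0 <ᵇ clash (proj₁ (halve (unresolved t))) k)

    table : ℕ → ℕ → ℕ
    table t = proj₁ (halve (unresolved t))

    table< : ∀ t e → table t e < 2 ^ τ
    table< t = proj₁ (proj₂ (halve (unresolved t)))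

    -- `unresolved` t says that each of the first t tables has a clash in the bucket, so its last
    -- true index is the first table without one.
    seed : ℕ → ℕ
    seed k = lastTrue (λ t → unresolved t k) (suc ρ)

    private
      count : ℕ → ℕ
      count t = ∑ (2 ^ ρ) (ind ∘ unresolved t)

      count-half : ∀ t → 2 * count (suc t) ≤ count t
      count-half t = proj₂ (proj₂ (halve (unresolved t)))

      count-pow : ∀ t → 2 ^ t * count t ≤ 2 ^ ρ
      count-pow zero = ≤-trans (≤-reflexive (+-identityʳ (count 0))) (≤-reflexive (trans (∑-const (2 ^ ρ) 1) (*-identityʳ (2 ^ ρ))))
      count-pow (suc t) = ≤-trans (≤-reflexive (ring (2 ^ t) (count (suc t)))) (≤-trans (*-monoʳ-≤ (2 ^ t) (count-half t)) (count-pow t))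
        where
        ring : ∀ a b → (a + (a + 0)) * b ≡ a * (2 * b)
        ring = solve-∀

      -- Halving 2 ^ ρ buckets ρ + 1 times leaves fewer than one; this fixes the number of
      -- second-level tables.
      resolved : ∀ k → k < 2 ^ ρ → unresolved (suc ρ) k ≡ false
      resolved k k< with unresolved (suc ρ) k in e
      ... | false = refl
      ... | true = contradiction (begin-strict
          2 ^ ρ <⟨ ^-monoʳ-< 2 (s≤s (s≤s z≤n)) {x = ρ} ≤-refl ⟩
          2 ^ suc ρ ≡⟨ sym (*-identityʳ (2 ^ suc ρ)) ⟩
          2 ^ suc ρ * 1 ≤⟨ *-monoʳ-≤ (2 ^ suc ρ) (subst (λ b → ind b ≤ count (suc ρ)) e (∑-term (2 ^ ρ) (ind ∘ unresolved (suc ρ)) k k<)) ⟩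
          2 ^ suc ρ * count (suc ρ) ≤⟨ count-pow (suc ρ) ⟩
          2 ^ ρ ∎) (<-irrefl refl)
        where open ≤-Reasoning

      seed-spec : ∀ k → k < 2 ^ ρ → seed k < suc ρ × unresolved (suc (seed k)) k ≡ false × seed k ≤ ∑ (suc ρ) (λ t → ind (unresolved (suc t) k))
      seed-spec k k< = lastTrue-spec (λ t → unresolved t k) (suc ρ) (λ t p → proj₁ (∧-true {unresolved t k} p)) refl (resolved k k<)

      seed-true : ∀ (b : ℕ → Bool) F → b 0 ≡ true → b (lastTrue b F) ≡ true
      seed-true b zero b0 = b0
      seed-true b (suc F) b0 with b F in e
      ... | true = e
      ... | false = seed-true b F b0

    seed≤ : ∀ k → k < 2 ^ ρ → seed k ≤ ρ
    seed≤ k k< = s≤s⁻¹ (proj₁ (seed-spec k k<))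

    -- The sum is at most the number of buckets unresolved after round 1, 2, ..., added up, a
    -- geometric series. The seeds hence cost O(1) bits each on average when their prefix sums are
    -- stored as a monotone sequence, although a single seed may be as large as ρ.
    ∑-seed : ∑ (2 ^ ρ) seed ≤ 2 ^ ρ
    ∑-seed = begin
      ∑ (2 ^ ρ) seed ≤⟨ ∑-≤ (2 ^ ρ) (λ k k< → proj₂ (proj₂ (seed-spec k k<))) ⟩
      ∑ (2 ^ ρ) (λ k → ∑ (suc ρ) (λ t → ind (unresolved (suc t) k))) ≡⟨ ∑-swap (2 ^ ρ) (suc ρ) _ ⟩
      ∑ (suc ρ) (λ t → count (suc t)) ≤⟨ m≤m+n _ (count (suc ρ)) ⟩
      ∑ (suc ρ) (λ t → count (suc t)) + count (suc ρ) ≤⟨ telescope (suc ρ) ⟩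
      count 0 ≡⟨ trans (∑-const (2 ^ ρ) 1) (*-identityʳ (2 ^ ρ)) ⟩
      2 ^ ρ ∎
      where
      open ≤-Reasoning
      telescope : ∀ F → ∑ F (λ t → count (suc t)) + count F ≤ count 0
      telescope zero = ≤-refl
      telescope (suc F) = ≤-trans (≤-reflexive (ring (∑ F (λ t → count (suc t))) (count (suc F)))) (≤-trans (+-monoʳ-≤ (∑ F _) (count-half F)) (telescope F))
        where
        ring : ∀ a b → (a + b) + b ≡ a + 2 * b
        ring = solve-∀

    private
      no-clash : ∀ k → k < 2 ^ ρ → clash (table (seed k)) k ≡ 0
      no-clash k k< with seed-spec k k< | seed-true (λ t → unresolved t k) (suc ρ) refl
      ... | _ , f , _ | tr with clash (table (seed k)) k
      ... | zero = refl
      ... | suc x = contradiction (trans (sym (cong (_∧ true) tr)) f) λ ()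

    offset : ℕ → ℕ
    offset i = wrap (κ (bucket i)) (hash c (table (seed (bucket i))) (Y i))

    start : ℕ → ℕ
    start k = ∑ k (λ k → 2 ^ κ k)

    position : ℕ → ℕ
    position i = start (bucket i) + offset i

    position< : ∀ i → position i < start (suc (bucket i))
    position< i = +-monoʳ-< (start (bucket i)) (wrap-< (κ (bucket i)) _)

    -- Buckets occupy disjoint intervals, and inside a bucket a coincidence would be a clash of the
    -- very table that the seed selects.
    position-injective : InjectiveOn n position
    position-injective i j i< j< e with <-cmp (bucket i) (bucket j)
    ... | tri< l _ _ = contradiction e (<⇒≢ (<-≤-trans (position< i) (≤-trans (∑-mono _ l) (m≤m+n _ _))))
    ... | tri> _ _ l = contradiction (sym e) (<⇒≢ (<-≤-trans (position< j) (≤-trans (∑-mono _ l) (m≤m+n _ _))))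
    ... | tri≈ _ b _ with i ≟ j
    ... | yes p = p
    ... | no i≢j = contradiction (≤-trans (≤-reflexive (sym term)) (≤-trans (∑-term n _ j j<) (≤-trans (∑-term n (λ i → ∑ n (λ j → cl i j)) i i<) (≤-reflexive (no-clash k (bucket< i)))))) λ ()
      where
      k = bucket i
      tab = table (seed k)
      cl : ℕ → ℕ → ℕ
      cl i j = if same? k i j ∧ not (j ≡ᵇ i) then ind (collide c tab (κ k) (Y i) (Y j)) else 0
      off : wrap (κ k) (hash c tab (Y i)) ≡ wrap (κ k) (hash c tab (Y j))
      off = trans (+-cancelˡ-≡ (start k) _ _ (trans e (cong (λ z → start z + offset j) (sym b))))
        (cong (λ z → wrap (κ z) (hash c (table (seed z)) (Y j))) (sym b))
      term : cl i j ≡ 1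
      term rewrite ≡⇒true {bucket i} {k} refl | ≡⇒true {bucket j} {k} (sym b) | ≢⇒false {j} {i} (i≢j ∘ sym)
        | ≡⇒true {wrap (κ k) (hash c tab (Y i))} {wrap (κ k) (hash c tab (Y j))} off = refl

-- Codes for monotone sequences.

module BlockCoding where
  open BitFields
  open Tabulating
  open import Defs using (wrap; odd)
  open import Data.Nat.Logarithm
  open import Data.List using (List; []; _∷_; _++_; length; replicate)
  open import Data.List.Properties using (length-++; length-replicate; ++-assoc)

  binary : List Bool → ℕ
  binary [] = 0
  binary (b ∷ l) = ind b + 2 * binary l

  binary-< : ∀ l → binary l < 2 ^ length l
  binary-< [] = s≤s z≤n
  binary-< (b ∷ l) = join-< {ind b} {binary l} 1 (length l) (bit b) (binary-< l)
    where
    bit : ∀ b → ind b < 2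
    bit true = s≤s (s≤s z≤n)
    bit false = s≤s z≤n

  bitsOf-binary : ∀ l → bitsOf (length l) (binary l) ≡ l
  bitsOf-binary [] = refl
  bitsOf-binary (b ∷ l) = cong₂ _∷_ (low b) (trans (cong (bitsOf (length l)) (high b)) (bitsOf-binary l))
    where
    x = binary l
    mod₂ : ∀ c → (c + 2 * x) % 2 ≡ c % 2
    mod₂ c = trans (cong (λ z → (c + z) % 2) (*-comm 2 x)) ([m+kn]%n≡m%n c x 2)
    low : ∀ b → odd (ind b + 2 * x) ≡ b
    low true = cong (_≡ᵇ 1) (mod₂ 1)
    low false = cong (_≡ᵇ 1) (mod₂ 0)
    high : ∀ b → (ind b + 2 * x) / 2 ≡ x
    high true = ÷-shift {1} 1 x (s≤s (s≤s z≤n))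
    high false = ÷-shift {0} 1 x (s≤s z≤n)

  -- The number of zeros preceding the j-th one.
  zeros : List Bool → ℕ → ℕ
  zeros [] j = 0
  zeros (true ∷ l) zero = 0
  zeros (true ∷ l) (suc j) = zeros l j
  zeros (false ∷ l) j = suc (zeros l j)

  zeros-≤ : ∀ l j → zeros l j ≤ length l
  zeros-≤ [] j = z≤n
  zeros-≤ (true ∷ l) zero = z≤n
  zeros-≤ (true ∷ l) (suc j) = m≤n⇒m≤1+n (zeros-≤ l j)
  zeros-≤ (false ∷ l) j = s≤s (zeros-≤ l j)

  zeros-replicate : ∀ d l j → zeros (replicate d false ++ l) j ≡ d + zeros l j
  zeros-replicate zero l j = refl
  zeros-replicate (suc d) l j = cong suc (zeros-replicate d l j)

  unary : (ℕ → ℕ) → ℕ → ℕ → List Bool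
  unary h zero p = []
  unary h (suc c) p = replicate (h 0 ∸ p) false ++ true ∷ unary (h ∘ suc) c (h 0)

  Increasing : (ℕ → ℕ) → Set
  Increasing h = ∀ {i j} → i ≤ j → h i ≤ h j

  zeros-unary : ∀ h c p s → Increasing h → p ≤ h 0 → ∀ j → j < c → zeros (unary h c p ++ s) j ≡ h j ∸ p
  zeros-unary h (suc c) p s mono p≤ j j< = trans (cong (λ l → zeros l j) (++-assoc (replicate (h 0 ∸ p) false) _ s))
      (trans (zeros-replicate (h 0 ∸ p) (true ∷ unary (h ∘ suc) c (h 0) ++ s) j) (tail j j<))
    where
    tail : ∀ j → j < suc c → (h 0 ∸ p) + zeros (true ∷ unary (h ∘ suc) c (h 0) ++ s) j ≡ h j ∸ p
    tail zero _ = +-identityʳ _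
    tail (suc j) (s≤s j<) = trans (cong ((h 0 ∸ p) +_) (zeros-unary (h ∘ suc) c (h 0) s (λ l → mono (s≤s l)) (mono z≤n) j j<))
      (trans (+-comm (h 0 ∸ p) _) (trans (sym (+-∸-assoc (h (suc j) ∸ h 0) p≤)) (cong (_∸ p) (m∸n+n≡m (mono z≤n)))))

  length-unary : ∀ h c p H → Increasing h → p ≤ h 0 → p ≤ H → (∀ i → i < c → h i ≤ H) → p + length (unary h c p) ≤ H + c
  length-unary h zero p H mono _ p≤ h≤ = +-monoˡ-≤ 0 p≤
  length-unary h (suc c) p H mono p≤ _ h≤ = begin
      p + length (replicate (h 0 ∸ p) false ++ true ∷ rest) ≡⟨ cong (p +_) (trans (length-++ (replicate (h 0 ∸ p) false)) (cong (_+ suc (length rest)) (length-replicate (h 0 ∸ p)))) ⟩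
      p + ((h 0 ∸ p) + suc (length rest)) ≡⟨ trans (sym (+-assoc p _ _)) (cong (_+ suc (length rest)) (m+[n∸m]≡n p≤)) ⟩
      h 0 + suc (length rest) ≡⟨ +-suc (h 0) _ ⟩
      suc (h 0 + length rest) ≤⟨ s≤s (length-unary (h ∘ suc) c (h 0) H (λ l → mono (s≤s l)) (mono z≤n) (h≤ 0 (s≤s z≤n)) (λ i i< → h≤ (suc i) (s≤s i<))) ⟩
      suc (H + c) ≡⟨ sym (+-suc H c) ⟩
      H + suc c ∎
    where
    open ≤-Reasoning
    rest = unary (h ∘ suc) c (h 0)

  decode : ℕ → ℕ → ℕ → ℕ
  decode g p j = zeros (bitsOf (2 * g) p) j

  decode-≤ : ∀ g p j → decode g p j ≤ 2 * g
  decode-≤ g p j = ≤-trans (zeros-≤ (bitsOf (2 * g) p) j) (≤-reflexive (length-bitsOf (2 * g) p))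

  -- The unary code has g ones and at most g zeros. Padding to exactly 2 * g bits makes every
  -- pattern an index into one common decoding table.
  encode : ∀ g h → Increasing h → (∀ j → j < g → h j ≤ g) → ∃ λ p → p < 2 ^ (2 * g) × ∀ j → j < g → decode g p j ≡ h j
  encode g h mono h≤ = binary l , subst (λ z → binary l < 2 ^ z) len (binary-< l)
      , λ j j< → trans (cong (λ k → zeros k j) (trans (cong (λ z → bitsOf z (binary l)) (sym len)) (bitsOf-binary l))) (zeros-unary h g 0 _ mono z≤n j j<)
    where
    u = unary h g 0
    u≤ : length u ≤ 2 * g
    u≤ = ≤-trans (length-unary h g 0 g mono z≤n z≤n h≤) (≤-reflexive (cong (g +_) (sym (+-identityʳ g))))
    l = u ++ replicate (2 * g ∸ length u) false
    len : length l ≡ 2 * g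
    len = trans (length-++ u) (trans (cong (length u +_) (length-replicate (2 * g ∸ length u))) (m+[n∸m]≡n u≤))

  -- A nondecreasing sequence is cut into blocks of g values.  Within a block
  -- whose values spread over s the differences to the first value are stored
  -- with about log (s / g) explicit low bits, and their high parts, bounded by
  -- g, in unary; the low bits of all blocks together number at most the total
  -- spread.
  module Blocks (g : ℕ) .{{_ : NonZero g}} (v : ℕ → ℕ) (mono : Increasing v) where

    base spread : ℕ → ℕ
    base k = v (k * g)
    spread k = v (suc k * g) ∸ v (k * g)
    opaque
      -- Chosen between two demands: g * 2 ^ width exceeds the spread, so the high parts are at most
      -- g, and lg (1 + x) ≤ x keeps g * width within the spread.
      width : ℕ → ℕ
      width k = ⌈log₂ suc (spread k / g) ⌉

      width-≥ : ∀ k → suc (spread k / g) ≤ 2 ^ width k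
      width-≥ k = log-≥ (suc (spread k / g))

      width-≤ : ∀ k → width k ≤ spread k / g
      width-≤ k = log-≤ {suc (spread k / g)} (n<2^n (spread k / g))

      width-log : ∀ k β → suc (spread k / g) ≤ 2 ^ β → width k ≤ β
      width-log k β l = log-≤ {suc (spread k / g)} l

    ptr : ℕ → ℕ
    ptr k = ∑ k (λ k → g * width k)

    diff hi lo : ℕ → ℕ → ℕ
    diff k j = v (k * g + j) ∸ base k
    hi k j = diff k j ÷ width k
    lo k j = wrap (width k) (diff k j)

    g*width≤ : ∀ k → g * width k ≤ spread k
    g*width≤ k = ≤-trans (*-monoʳ-≤ g (width-≤ k)) (≤-trans (≤-reflexive (*-comm g _)) (m/n*n≤m (spread k) g))

    -- A block spends at most its spread on explicit low bits, and the spreads telescope. The bound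
    -- on the values thus bounds the pointers and the length of the whole low part too.
    ptr-≤ : ∀ k → ptr k ≤ v (k * g)
    ptr-≤ zero = z≤n
    ptr-≤ (suc k) = ≤-trans (+-mono-≤ (ptr-≤ k) (g*width≤ k)) (≤-reflexive (m+[n∸m]≡n (mono (m≤n+m (k * g) g))))

    diff-≤ : ∀ k j → j ≤ g → diff k j ≤ spread k
    diff-≤ k j j≤ = ∸-monoˡ-≤ (base k) (mono (≤-trans (+-monoʳ-≤ (k * g) j≤) (≤-reflexive (+-comm (k * g) g))))

    hi-≤ : ∀ k j → j < g → hi k j ≤ g
    hi-≤ k j j< = <⇒≤ (m<n*o⇒m/o<n {{m^n≢0 2 (width k)}} (begin-strict
      diff k j ≤⟨ diff-≤ k j (<⇒≤ j<) ⟩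
      spread k ≡⟨ m≡m%n+[m/n]*n (spread k) g ⟩
      spread k % g + spread k / g * g <⟨ +-monoˡ-< _ (m%n<n (spread k) g) ⟩
      suc (spread k / g) * g ≤⟨ *-monoˡ-≤ g (width-≥ k) ⟩
      2 ^ width k * g ≡⟨ *-comm (2 ^ width k) g ⟩
      g * 2 ^ width k ∎))
      where open ≤-Reasoning

    hi-mono : ∀ k → Increasing (hi k)
    hi-mono k l = /-monoˡ-≤ (2 ^ width k) {{m^n≢0 2 (width k)}} (∸-monoˡ-≤ (base k) (mono (+-monoʳ-≤ (k * g) l)))

    opaque
      pattern-of : ∀ k → ∃ λ p → p < 2 ^ (2 * g) × ∀ j → j < g → decode g p j ≡ hi k j
      pattern-of k = encode g (hi k) (hi-mono k) (hi-≤ k)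

    pat : ℕ → ℕ
    pat k = proj₁ (pattern-of k)

    value : ∀ i → base (i / g) + (decode g (pat (i / g)) (i % g) * 2 ^ width (i / g) + lo (i / g) (i % g)) ≡ v i
    value i = begin
      base k + (decode g (pat k) j * 2 ^ width k + lo k j) ≡⟨ cong (λ z → base k + (z * 2 ^ width k + lo k j)) (proj₂ (proj₂ (pattern-of k)) j (m%n<n i g)) ⟩
      base k + (hi k j * 2 ^ width k + lo k j) ≡⟨ cong (base k +_) (trans (+-comm _ (lo k j)) (trans (cong (lo k j +_) (*-comm (hi k j) _)) (sym (÷-split (diff k j) (width k))))) ⟩
      base k + diff k j ≡⟨ m+[n∸m]≡n (mono (m≤m+n (k * g) j)) ⟩
      v (k * g + j) ≡⟨ cong v (trans (+-comm (k * g) j) (sym (m≡m%n+[m/n]*n i g))) ⟩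
      v i ∎
      where
      open ≡-Reasoning
      k = i / g
      j = i % g

    overflow : ℕ → ℕ
    overflow nb = cat nb (λ k → g * width k) (λ k → arr (width k) g (lo k))

    private
      lo-< : ∀ k j → j < g → lo k j < 2 ^ width k
      lo-< k j _ = wrap-< (width k) _
      part-< : ∀ k → arr (width k) g (lo k) < 2 ^ (g * width k)
      part-< k = arr-< (width k) g (lo k) (lo-< k)

    overflow-< : ∀ nb → overflow nb < 2 ^ ptr nb
    overflow-< nb = cat-< nb _ _ (λ k _ → part-< k)

    overflow-rd : ∀ nb k j → k < nb → j < g → rd (overflow nb) (ptr k + j * width k) (width k) ≡ lo k j
    overflow-rd nb k j k< j< = trans
      (rd-sub {overflow nb} {ptr k} (g * width k) (j * width k) (width k)
        (cat-rd nb (λ k → g * width k) (λ k → arr (width k) g (lo k)) (λ k _ → part-< k) k k<)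
        (≤-trans (≤-reflexive (+-comm _ (width k))) (*-monoˡ-≤ (width k) j<)))
      (arr-rd (width k) g (lo k) (lo-< k) j j<)

    field-end : ∀ nb k j → k < nb → j < g → ptr k + j * width k + width k ≤ ptr nb
    field-end nb k j k< j< = begin
      ptr k + j * width k + width k ≡⟨ +-assoc (ptr k) _ _ ⟩
      ptr k + (j * width k + width k) ≤⟨ +-monoʳ-≤ (ptr k) (≤-trans (≤-reflexive (+-comm _ (width k))) (*-monoˡ-≤ (width k) j<)) ⟩
      ptr (suc k) ≤⟨ ∑-mono (λ k → g * width k) k< ⟩
      ptr nb ∎
      where open ≤-Reasoning

-- Select and rank as expressions.

module Queries where
  open BitFields
  open StraightLine
  open FieldAccess
  open CommonMultiples
  open Tabulating
  open import Defs
  open import Data.Vec using (Vec; []; _∷_)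

  mono : ∀ {n} → ℕ → Ex (3 + n) → Ex (3 + n)
  mono b e = call (monoE b) (x0 ∷ x1 ∷ x2 ∷ e ∷ [])

  selE : Ex 4
  selE = (mono 5 x3 ≪ scalar 0) ⊞ get 0 x3

  -- Select applied beyond the last element may return anything; the product with the range check
  -- suppresses it.
  hitE : Ex 7
  hitE = bin lt x5 x4 ⊠ bin eq (call selE (x0 ∷ x1 ∷ x2 ∷ x5 ∷ [])) x3

  -- A conditional without a jump: x0 is the flag, x1 the candidate and x2 the value kept otherwise.
  -- The stored result is one plus the candidate, leaving 0 for "not found".
  chooseE : Ex 3
  chooseE = (x2 ⊠ (lit 1 ⊟ x0)) ⊞ ((x1 ⊞ lit 1) ⊠ x0)

  -- Environment: ..., the query x3, the size x4, the next candidate x5, and in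
  -- x6 one plus the rank found so far, or 0.
  scanE : ℕ → Ex 7
  scanE zero = x6
  scanE (suc t) = call (scanE t) (x0 ∷ x1 ∷ x2 ∷ x3 ∷ x4 ∷ x5 ⊞ lit 1 ∷ call chooseE (hitE ∷ x5 ∷ x6 ∷ []) ∷ [])

  hashE : ℕ → Ex 6
  hashE zero = x5
  hashE (suc c) = call (hashE c) (x0 ∷ x1 ∷ x2 ∷ x3 ⊘ scalar 4 ∷ x4 ⊞ scalar 4 ∷ x5 ⊞ get 4 (x4 ⊞ (x3 ⊙ scalar 4)) ∷ [])

  -- Reduced keys are below 4 ν³ ≤ 2 ^ (24 g + 2) ≤ (2 ^ (2 g)) ^ 13, as ν ≤ 2 ^ (8 g) and g ≥ 1.
  digits : ℕ
  digits = 13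

  candidateE₃ : ℕ → Ex 7
  candidateE₃ K = get 1 (mono 20 (x4 ⊞ (call (hashE digits) (x0 ∷ x1 ∷ x2 ∷ x3 ∷ (x6 ⊞ lit 1) ⊠ scalar 6 ∷ lit 0 ∷ []) ⊙ (x5 ⊟ x4)))) ≪ lit K

  candidateE₂ : ℕ → Ex 5
  candidateE₂ K = call (candidateE₃ K) (x0 ∷ x1 ∷ x2 ∷ x3 ∷ mono 10 x4 ∷ mono 10 (x4 ⊞ lit 1) ∷ mono 15 (x4 ⊞ lit 1) ⊟ mono 15 x4 ∷ [])

  candidateE₁ : ℕ → Ex 4
  candidateE₁ K = call (candidateE₂ K) (x0 ∷ x1 ∷ x2 ∷ x3 ∷ call (hashE digits) (x0 ∷ x1 ∷ x2 ∷ x3 ∷ lit 0 ∷ lit 0 ∷ []) ⊙ scalar 5 ∷ [])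

  candidateE : ℕ → Ex 4
  candidateE K = call (candidateE₁ K) (x0 ∷ x1 ∷ x2 ∷ (x3 ⊙ scalar 2) ⊙ scalar 3 ∷ [])

  -- Both methods run for every set. The candidate of a method whose tables are absent is an
  -- arbitrary number, but every hit is verified by select and X is injective, so it can neither
  -- produce a wrong rank nor erase a right one.
  rankE : ℕ → ℕ → Ex 5
  rankE G K = call (scanE (2 ^ K)) (x0 ∷ x1 ∷ x2 ∷ x3 ∷ x4 ∷ call (candidateE K) (x0 ∷ x1 ∷ x2 ∷ x3 ∷ [])
    ∷ call (scanE (2 ^ K)) (x0 ∷ x1 ∷ x2 ∷ x3 ∷ x4 ∷ get 2 (x3 ≫ lit G) ∷ lit 0 ∷ []) ∷ [])

  selectE : Ex 5
  selectE = call selE (x0 ∷ x1 ∷ x2 ∷ x3 ∷ [])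

  -- A total remainder, so that the modulus can be a difference given by an equation in
  -- `candidateE-spec`.
  residue : ℕ → ℕ → ℕ
  residue x zero = 0
  residue x (suc d) = x % suc d

  residue-% : ∀ x d .{{_ : NonZero d}} → x % d ≡ residue x d
  residue-% x (suc d) = refl

  module Query {w : ℕ} .{{_ : NonZero w}} {μ : ℕ → ℕ} (image : Image w μ) where
    open Layout image

    private
      1≤w : 1 ≤ w
      1≤w = >-nonZero⁻¹ w
      1<2^w : 1 < 2 ^ w
      1<2^w = ≤-<-trans 1≤w (n<2^n w)
      0<2^w : 0 < 2 ^ w
      0<2^w = m^n>0 2 w

    mono⇓ : ∀ {n} {ρ : Vec ℕ n} {e} b {N v i} → Mono b N v → i < N → eval e (w ∷ η ∷ H₀ ∷ ρ) ≡ i → eval (mono b e) (w ∷ η ∷ H₀ ∷ ρ) ≡ v i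
    mono⇓ b M i< p = call⇓ (var⇓ ∷⇓ var⇓ ∷⇓ var⇓ ∷⇓ p ∷⇓ []⇓) (monoE-spec M _ i<)

    scalar⇓ : ∀ {n} {ρ : Vec ℕ n} a → a < segments → eval (scalar a) (w ∷ η ∷ H₀ ∷ ρ) ≡ scal a
    scalar⇓ a a< = hdr⇓ (hdr-scalar a a<)

    bin-< : ∀ {n} {ρ : Vec ℕ n} {o a b} → eval (bin o a b) ρ < 2 ^ w
    bin-< {ρ = ρ} {o} {a} {b} = subst (_< 2 ^ w) (sym (bin⇓ {ρ = ρ} {o} {a} {b} refl refl)) (wrap-< w _)

    flag⇓ : ∀ {n} {ρ : Vec ℕ n} {a b x y} → eval a ρ ≡ x → eval b ρ ≡ y → eval (bin lt a b) ρ ≡ ind (x <ᵇ y)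
    flag⇓ p q = trans (bin⇓ p q) (flag 1≤w _)

    eqFlag⇓ : ∀ {n} {ρ : Vec ℕ n} {a b x y} → eval a ρ ≡ x → eval b ρ ≡ y → eval (bin eq a b) ρ ≡ ind (x ≡ᵇ y)
    eqFlag⇓ p q = trans (bin⇓ p q) (flag 1≤w _)

    module Select {n : ℕ} {X high low : ℕ → ℕ} (high-mono : Mono 5 n high) (low-arr : Array 0 n low)
      (X-split : ∀ i → i < n → high i * 2 ^ scal 0 + low i ≡ X i) (X< : ∀ i → i < n → X i < 2 ^ w)
      (X-inj : InjectiveOn n X) (n<2^w : n < 2 ^ w) where

      selE-spec : ∀ i → i < n → eval selE (w ∷ η ∷ H₀ ∷ i ∷ []) ≡ X i
      selE-spec i i< = trans (add⇓ (trans (shl⇓ (mono⇓ 5 high-mono i< var⇓) (scalar⇓ 0 (s≤s z≤n))) (wrap-small w (≤-<-trans (m≤m+n _ (low i)) s<)))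
          (get⇓ low-arr i< var⇓) s<) (X-split i i<)
        where
        s< : high i * 2 ^ scal 0 + low i < 2 ^ w
        s< = subst (_< 2 ^ w) (sym (X-split i i<)) (X< i i<)

      selectE-spec : ∀ i → i < n → eval selectE (w ∷ η ∷ H₀ ∷ i ∷ n ∷ []) ≡ X i
      selectE-spec i i< = call⇓ (var⇓ ∷⇓ var⇓ ∷⇓ var⇓ ∷⇓ var⇓ ∷⇓ []⇓) (selE-spec i i<)

      module _ (x : ℕ) where
        env : ℕ → ℕ → Vec ℕ 7
        env cand found = w ∷ η ∷ H₀ ∷ x ∷ n ∷ cand ∷ found ∷ []

        hit-yes : ∀ cand found → cand < n → X cand ≡ x → eval hitE (env cand found) ≡ 1
        hit-yes cand found c< e = mul⇓ (trans (flag⇓ var⇓ var⇓) (cong ind (<ᵇ-yes c<)))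
          (trans (eqFlag⇓ (call⇓ (var⇓ ∷⇓ var⇓ ∷⇓ var⇓ ∷⇓ var⇓ ∷⇓ []⇓) (selE-spec cand c<)) var⇓) (cong ind (≡ᵇ-yes e))) 1<2^w

        hit-no : ∀ cand found → (cand < n → X cand ≢ x) → eval hitE (env cand found) ≡ 0
        hit-no cand found ne with cand <? n
        ... | yes c< = mul⇓ (trans (flag⇓ var⇓ var⇓) (cong ind (<ᵇ-yes c<)))
          (trans (eqFlag⇓ (call⇓ (var⇓ ∷⇓ var⇓ ∷⇓ var⇓ ∷⇓ var⇓ ∷⇓ []⇓) (selE-spec cand c<)) var⇓) (cong ind (≡ᵇ-no (ne c<)))) 0<2^w
        ... | no c≮ = mul⇓ (trans (flag⇓ var⇓ var⇓) (cong ind (<ᵇ-no (≮⇒≥ c≮)))) refl 0<2^w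

        choose-yes : ∀ cand found → cand < n → eval chooseE (1 ∷ cand ∷ found ∷ []) ≡ suc cand
        choose-yes cand found c< = trans
          (add⇓ (trans (mul⇓ var⇓ (sub⇓ (lit⇓ 1<2^w) var⇓ ≤-refl 1<2^w) (subst (_< 2 ^ w) (sym (*-zeroʳ found)) 0<2^w)) (*-zeroʳ found))
            (mul⇓ (add⇓ var⇓ (lit⇓ 1<2^w) c+1<) var⇓ (subst (_< 2 ^ w) (sym (*-identityʳ (cand + 1))) c+1<))
            (subst (_< 2 ^ w) (sym (*-identityʳ (cand + 1))) c+1<))
          (trans (*-identityʳ (cand + 1)) (+-comm cand 1))
          where
          c+1< : cand + 1 < 2 ^ w
          c+1< = ≤-<-trans (≤-trans (≤-reflexive (+-comm cand 1)) c<) n<2^w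

        choose-no : ∀ cand found → found < 2 ^ w → eval chooseE (0 ∷ cand ∷ found ∷ []) ≡ found
        choose-no cand found f< = trans
          (add⇓ (mul⇓ var⇓ (sub⇓ (lit⇓ 1<2^w) var⇓ z≤n 1<2^w) (subst (_< 2 ^ w) (sym (*-identityʳ found)) f<))
            (trans (mul⇓ {x = z} refl var⇓ (subst (_< 2 ^ w) (sym (*-zeroʳ z)) 0<2^w)) (*-zeroʳ z))
            (subst (_< 2 ^ w) (sym (trans (+-identityʳ _) (*-identityʳ found))) f<))
          (trans (+-identityʳ _) (*-identityʳ found))
          where z = eval (x1 ⊞ lit 1) (0 ∷ cand ∷ found ∷ [])

        scan-< : ∀ t cand found → found < 2 ^ w → eval (scanE t) (env cand found) < 2 ^ w
        scan-< zero cand found f< = subst (_< 2 ^ w) (sym var⇓) f<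
        scan-< (suc t) cand found f< = subst (_< 2 ^ w) (sym (call⇓ (var⇓ ∷⇓ var⇓ ∷⇓ var⇓ ∷⇓ var⇓ ∷⇓ var⇓ ∷⇓ refl ∷⇓ call⇓ (refl ∷⇓ var⇓ ∷⇓ var⇓ ∷⇓ []⇓) refl ∷⇓ []⇓) refl))
          (scan-< t _ _ bin-<)

        scan-absent : (∀ i → i < n → X i ≢ x) → ∀ t cand found → found < 2 ^ w → eval (scanE t) (env cand found) ≡ found
        scan-absent ne zero cand found f< = var⇓
        scan-absent ne (suc t) cand found f< = call⇓ (var⇓ ∷⇓ var⇓ ∷⇓ var⇓ ∷⇓ var⇓ ∷⇓ var⇓ ∷⇓ refl
            ∷⇓ call⇓ (hit-no cand found (ne cand) ∷⇓ var⇓ ∷⇓ var⇓ ∷⇓ []⇓) (choose-no cand found f<) ∷⇓ []⇓)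
          (scan-absent ne t _ found f<)

        module _ (r : ℕ) (r< : r < n) (Xr : X r ≡ x) where

          private
            sr< : suc r < 2 ^ w
            sr< = ≤-<-trans r< n<2^w

          -- `cand` is arbitrary, even after wrapping around: a later hit can only be r itself and
          -- stores the same value again.
          scan-found : ∀ t cand → eval (scanE t) (env cand (suc r)) ≡ suc r
          scan-found zero cand = var⇓
          scan-found (suc t) cand with cand ≟ r
          ... | yes refl = call⇓ (var⇓ ∷⇓ var⇓ ∷⇓ var⇓ ∷⇓ var⇓ ∷⇓ var⇓ ∷⇓ refl
              ∷⇓ call⇓ (hit-yes cand (suc r) r< Xr ∷⇓ var⇓ ∷⇓ var⇓ ∷⇓ []⇓) (choose-yes cand (suc r) r<) ∷⇓ []⇓) (scan-found t _)
          ... | no c≢r = call⇓ (var⇓ ∷⇓ var⇓ ∷⇓ var⇓ ∷⇓ var⇓ ∷⇓ var⇓ ∷⇓ refl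
              ∷⇓ call⇓ (hit-no cand (suc r) (λ c< e → c≢r (X-inj cand r c< r< (trans e (sym Xr)))) ∷⇓ var⇓ ∷⇓ var⇓ ∷⇓ []⇓) (choose-no cand (suc r) sr<) ∷⇓ []⇓)
              (scan-found t _)

          scan-near : ∀ t cand found → found < 2 ^ w → cand ≤ r → r < cand + t → eval (scanE t) (env cand found) ≡ suc r
          scan-near zero cand found f< c≤ r<c = contradiction (subst (r <_) (+-identityʳ cand) r<c) (≤⇒≯ c≤)
          scan-near (suc t) cand found f< c≤ r<c with m≤n⇒m<n∨m≡n c≤
          ... | inj₂ refl = call⇓ (var⇓ ∷⇓ var⇓ ∷⇓ var⇓ ∷⇓ var⇓ ∷⇓ var⇓ ∷⇓ refl
              ∷⇓ call⇓ (hit-yes cand found r< Xr ∷⇓ var⇓ ∷⇓ var⇓ ∷⇓ []⇓) (choose-yes cand found r<) ∷⇓ []⇓) (scan-found t _)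
          ... | inj₁ c<r = call⇓ (var⇓ ∷⇓ var⇓ ∷⇓ var⇓ ∷⇓ var⇓ ∷⇓ var⇓ ∷⇓ add⇓ var⇓ (lit⇓ 1<2^w) (≤-<-trans (≤-trans (≤-reflexive (+-comm cand 1)) c<r) (<-trans r< n<2^w))
              ∷⇓ call⇓ (hit-no cand found (λ c< e → <⇒≢ c<r (X-inj cand r c< r< (trans e (sym Xr)))) ∷⇓ var⇓ ∷⇓ var⇓ ∷⇓ []⇓) (choose-no cand found f<) ∷⇓ []⇓)
              (scan-near t (cand + 1) found f< (subst (_≤ r) (+-comm 1 cand) c<r) (subst (r <_) (sym (+-assoc cand 1 t)) r<c))

      rankE-absent : ∀ G K x → (∀ i → i < n → X i ≢ x) → eval (rankE G K) (w ∷ η ∷ H₀ ∷ x ∷ n ∷ []) ≡ 0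
      rankE-absent G K x ne = call⇓ (var⇓ ∷⇓ var⇓ ∷⇓ var⇓ ∷⇓ var⇓ ∷⇓ var⇓ ∷⇓ refl
          ∷⇓ call⇓ (var⇓ ∷⇓ var⇓ ∷⇓ var⇓ ∷⇓ var⇓ ∷⇓ var⇓ ∷⇓ refl ∷⇓ lit⇓ 0<2^w ∷⇓ []⇓) (scan-absent x ne (2 ^ K) _ 0 0<2^w) ∷⇓ []⇓)
        (scan-absent x ne (2 ^ K) _ 0 0<2^w)

      rankE-dense : ∀ G K x r {N D} → r < n → X r ≡ x → x < 2 ^ w → G < 2 ^ w → Array 2 N D → x ÷ G < N → D (x ÷ G) ≤ r → r < D (x ÷ G) + 2 ^ K →
        eval (rankE G K) (w ∷ η ∷ H₀ ∷ x ∷ n ∷ []) ≡ suc r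
      rankE-dense G K x r r< Xr x< G< arr₂ i< lo hi = call⇓ (var⇓ ∷⇓ var⇓ ∷⇓ var⇓ ∷⇓ var⇓ ∷⇓ var⇓ ∷⇓ refl
          ∷⇓ call⇓ (var⇓ ∷⇓ var⇓ ∷⇓ var⇓ ∷⇓ var⇓ ∷⇓ var⇓ ∷⇓ get⇓ arr₂ i< (shr⇓ var⇓ (lit⇓ G<) x<) ∷⇓ lit⇓ 0<2^w ∷⇓ []⇓)
               (scan-near x r r< Xr (2 ^ K) _ 0 0<2^w lo hi) ∷⇓ []⇓)
        (scan-found x r r< Xr (2 ^ K) _)

      rankE-sparse : ∀ G K x r c → r < n → X r ≡ x → eval (candidateE K) (w ∷ η ∷ H₀ ∷ x ∷ []) ≡ c → c ≤ r → r < c + 2 ^ K →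
        eval (rankE G K) (w ∷ η ∷ H₀ ∷ x ∷ n ∷ []) ≡ suc r
      rankE-sparse G K x r c r< Xr ev lo hi = call⇓ (var⇓ ∷⇓ var⇓ ∷⇓ var⇓ ∷⇓ var⇓ ∷⇓ var⇓ ∷⇓ call⇓ (var⇓ ∷⇓ var⇓ ∷⇓ var⇓ ∷⇓ var⇓ ∷⇓ []⇓) ev
          ∷⇓ call⇓ (var⇓ ∷⇓ var⇓ ∷⇓ var⇓ ∷⇓ var⇓ ∷⇓ var⇓ ∷⇓ refl ∷⇓ lit⇓ 0<2^w ∷⇓ []⇓) refl ∷⇓ []⇓)
        (scan-near x r r< Xr (2 ^ K) c _ (scan-< x (2 ^ K) _ 0 0<2^w) lo hi)

    module Candidate {nh : ℕ} {f : ℕ → ℕ} (hash-arr : Array 4 nh f) (nh< : nh < 2 ^ w) {{β≢0 : NonZero (scal 4)}} where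
      open Tabulation (scal 4)

      hashE-spec : ∀ c y idx found → y < 2 ^ w → idx + c * scal 4 ≤ nh → found + ∑ c (λ j → f (idx + (j * scal 4 + digit j y))) < 2 ^ w →
        eval (hashE c) (w ∷ η ∷ H₀ ∷ y ∷ idx ∷ found ∷ []) ≡ found + ∑ c (λ j → f (idx + (j * scal 4 + digit j y)))
      hashE-spec zero y idx found y< i≤ s< = trans var⇓ (sym (+-identityʳ found))
      hashE-spec (suc c) y idx found y< i≤ s< = trans
        (call⇓ (var⇓ ∷⇓ var⇓ ∷⇓ var⇓ ∷⇓ div⇓ var⇓ β⇓ y< ∷⇓ add⇓ var⇓ β⇓ (≤-<-trans (≤-trans (m≤m+n (idx + β) (c * β)) (≤-trans (≤-reflexive (+-assoc idx β (c * β))) i≤)) nh<)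
            ∷⇓ add⇓ var⇓ (get⇓ hash-arr first< (add⇓ var⇓ (mod⇓ var⇓ β⇓ y<) (<-trans first< nh<))) (≤-<-trans (≤-trans (m≤m+n _ _) (≤-reflexive (sym peel))) s<) ∷⇓ []⇓)
          (hashE-spec c (y / β) (idx + β) (found + f (idx + y % β)) (≤-<-trans (m/n≤m y β) y<)
            (≤-trans (≤-reflexive (+-assoc idx β (c * β))) i≤) (subst (_< 2 ^ w) peel s<)))
        (sym peel)
        where
        β = scal 4
        β⇓ : ∀ {n} {ρ : Vec ℕ n} → eval (scalar 4) (w ∷ η ∷ H₀ ∷ ρ) ≡ β
        β⇓ = scalar⇓ 4 (m≤m+n 5 20)
        first< : idx + y % β < nh
        first< = <-≤-trans (+-monoʳ-< idx (m%n<n y β)) (≤-trans (+-monoʳ-≤ idx (m≤m+n β (c * β))) i≤)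
        peel : found + ∑ (suc c) (λ j → f (idx + (j * β + digit j y)))
          ≡ (found + f (idx + y % β)) + ∑ c (λ j → f (idx + β + (j * β + digit j (y / β))))
        peel = trans (cong (found +_) (trans (∑-first c _) (cong (f (idx + y % β) +_) (∑-cong c (λ j _ → cong f (ring idx β (j * β) (digit j (y / β))))))))
          (sym (+-assoc found _ _))
          where
          ring : ∀ a b c d → a + ((b + c) + d) ≡ a + b + (c + d)
          ring = solve-∀

      opaque
        value-at : ℕ → ℕ → ℕ
        value-at idx y = ∑ digits (λ j → f (idx + (j * scal 4 + digit j y)))

        value-at-def : ∀ idx y → value-at idx y ≡ ∑ digits (λ j → f (idx + (j * scal 4 + digit j y)))
        value-at-def idx y = refl

      hash⇓ : ∀ {n} {ρ : Vec ℕ n} {e e′ y idx} → y < 2 ^ w → idx + digits * scal 4 ≤ nh → value-at idx y < 2 ^ w →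
        eval e (w ∷ η ∷ H₀ ∷ ρ) ≡ y → eval e′ (w ∷ η ∷ H₀ ∷ ρ) ≡ idx →
        eval (call (hashE digits) (x0 ∷ x1 ∷ x2 ∷ e ∷ e′ ∷ lit 0 ∷ [])) (w ∷ η ∷ H₀ ∷ ρ) ≡ value-at idx y
      hash⇓ y< i≤ s< p q = call⇓ (var⇓ ∷⇓ var⇓ ∷⇓ var⇓ ∷⇓ p ∷⇓ q ∷⇓ lit⇓ 0<2^w ∷⇓ []⇓) (trans (hashE-spec digits _ _ 0 y< i≤ (subst (_< 2 ^ w) (value-at-def _ _) s<)) (sym (value-at-def _ _)))

      module _ {ns nr nc : ℕ} {s a R C : ℕ → ℕ} (s-mono : Mono 10 ns s) (a-mono : Mono 15 ns a) (R-mono : Mono 20 nr R) (C-arr : Array 1 nc C)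
        {{_ : NonZero (scal 2)}} {{_ : NonZero (scal 3)}} {{_ : NonZero (scal 5)}} {{_ : NonZero (scal 6)}} where

        -- Every intermediate value has a name and an equation of its own. A caller can thereby
        -- describe the computation in terms of the hashing construction, without the nested
        -- expression being formed.
        candidateE-spec : ∀ K x {y v₀ k a₀ a₁ s₀ s₁ idx v₁ pos i e} → x < 2 ^ w → K < 2 ^ w →
          x % scal 2 % scal 3 ≡ y → digits * scal 4 ≤ nh → value-at 0 y ≡ v₀ → v₀ < 2 ^ w → v₀ % scal 5 ≡ k → k + 1 < ns →
          a k ≡ a₀ → a (k + 1) ≡ a₁ → a₀ ≤ a₁ → s k ≡ s₀ → s (k + 1) ≡ s₁ → s₀ < s₁ →
          (a₁ ∸ a₀ + 1) * scal 6 ≡ idx → idx + digits * scal 4 ≤ nh → value-at idx y ≡ v₁ → v₁ < 2 ^ w →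
          s₀ + residue v₁ (s₁ ∸ s₀) ≡ pos → pos < nr → R pos ≡ i → i < nc → C i ≡ e → e * 2 ^ K < 2 ^ w →
          eval (candidateE K) (w ∷ η ∷ H₀ ∷ x ∷ []) ≡ e * 2 ^ K
        candidateE-spec K x x< K< refl top≤ refl v₀< refl k< refl refl a≤ refl refl sk< refl idx≤ refl v₁< refl pos< refl R< refl c< =
          call⇓ (var⇓ ∷⇓ var⇓ ∷⇓ var⇓ ∷⇓ mod⇓ (mod⇓ var⇓ (scalar⇓ 2 (m≤m+n 3 22)) x<) (scalar⇓ 3 (m≤m+n 4 21)) (≤-<-trans (m%n≤m x (scal 2)) x<) ∷⇓ []⇓)
          (call⇓ (var⇓ ∷⇓ var⇓ ∷⇓ var⇓ ∷⇓ var⇓ ∷⇓ mod⇓ (hash⇓ y< top≤ v₀< var⇓ (lit⇓ 0<2^w)) (scalar⇓ 5 (m≤m+n 6 19)) v₀< ∷⇓ []⇓)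
          (call⇓ (var⇓ ∷⇓ var⇓ ∷⇓ var⇓ ∷⇓ var⇓ ∷⇓ mono⇓ 10 s-mono (<-trans (subst (k <_) (+-comm 1 k) ≤-refl) k<) var⇓ ∷⇓ mono⇓ 10 s-mono k< k+1
              ∷⇓ sub⇓ (mono⇓ 15 a-mono k< k+1) (mono⇓ 15 a-mono (<-trans (subst (k <_) (+-comm 1 k) ≤-refl) k<) var⇓) a≤ (Mono.value< a-mono (k + 1) k<) ∷⇓ []⇓)
          (trans (shl⇓ (get⇓ C-arr R< (mono⇓ 20 R-mono pos< (add⇓ var⇓ inner (<-≤-trans pos< (Mono.N≤ R-mono))))) (lit⇓ K<)) (wrap-small w c<))))
          where
          y = x % scal 2 % scal 3
          y< : y < 2 ^ w
          y< = ≤-<-trans (≤-trans (m%n≤m (x % scal 2) (scal 3)) (m%n≤m x (scal 2))) x<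
          k = value-at 0 y % scal 5
          k+1< : k + 1 < 2 ^ w
          k+1< = <-≤-trans k< (Mono.N≤ s-mono)
          k+1 : eval (x4 ⊞ lit 1) (w ∷ η ∷ H₀ ∷ y ∷ k ∷ []) ≡ k + 1
          k+1 = add⇓ var⇓ (lit⇓ 1<2^w) k+1<
          seed = a (k + 1) ∸ a k
          idx = (seed + 1) * scal 6
          idx< : idx < 2 ^ w
          idx< = ≤-<-trans (≤-trans (m≤m+n idx _) idx≤) nh<
          seed+1< : seed + 1 < 2 ^ w
          seed+1< = ≤-<-trans (m≤m*n (seed + 1) (scal 6)) idx<
          inner : eval (call (hashE digits) (x0 ∷ x1 ∷ x2 ∷ x3 ∷ (x6 ⊞ lit 1) ⊠ scalar 6 ∷ lit 0 ∷ []) ⊙ (x5 ⊟ x4)) (w ∷ η ∷ H₀ ∷ y ∷ s k ∷ s (k + 1) ∷ seed ∷ [])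
            ≡ residue (value-at idx y) (s (k + 1) ∸ s k)
          inner = trans (mod⇓ {{>-nonZero (m<n⇒0<n∸m sk<)}} (hash⇓ y< idx≤ v₁< var⇓ (mul⇓ (add⇓ var⇓ (lit⇓ 1<2^w) seed+1<) (scalar⇓ 6 (m≤m+n 7 18)) idx<))
            (sub⇓ var⇓ var⇓ (<⇒≤ sk<) (Mono.value< s-mono (k + 1) k<)) v₁<) (residue-% _ _ {{>-nonZero (m<n⇒0<n∸m sk<)}})

-- Decoding the preamble, and the program parts for small universes.

module Startup where
  open BitFields
  open StraightLine
  open FieldAccess
  open Tabulating using (ind)
  open import Defs
  open import Data.Vec using (Vec; []; _∷_)

  private
    odd-double : ∀ u → odd (2 * u) ≡ false
    odd-double u = cong (_≡ᵇ 1) (trans (cong (_% 2) (*-comm 2 u)) (m*n%n≡0 u 2))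

    odd-suc-double : ∀ u → odd (1 + 2 * u) ≡ true
    odd-suc-double u = cong (_≡ᵇ 1) (trans (cong (λ z → (1 + z) % 2) (*-comm 2 u)) ([m+kn]%n≡m%n 1 u 2))

    half-double : ∀ u → (2 * u) / 2 ≡ u
    half-double u = ÷-shift {0} 1 u (s≤s z≤n)

    half-suc-double : ∀ u → (1 + 2 * u) / 2 ≡ u
    half-suc-double u = ÷-shift {1} 1 u (s≤s (s≤s z≤n))

  xor-self : ∀ w u → bitwise _xor_ w u u ≡ 0
  xor-self zero u = refl
  xor-self (suc w) u with odd u
  ... | true = cong (2 *_) (xor-self w (u / 2))
  ... | false = cong (2 *_) (xor-self w (u / 2))

  -- Clearing the lowest set bit flips exactly the bits up to it.
  xor-pred : ∀ w k u → k < w → bitwise _xor_ w (2 ^ k * (1 + 2 * u)) (2 ^ k * (1 + 2 * u) ∸ 1) + 1 ≡ 2 ^ suc k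
  xor-pred (suc w) zero u _ rewrite +-identityʳ (2 * u) | odd-suc-double u | odd-double u | half-suc-double u | half-double u | xor-self w u = refl
  xor-pred (suc w) (suc k) u (s≤s k<) = subst (λ z → bitwise _xor_ (suc w) z (z ∸ 1) + 1 ≡ 2 ^ suc (suc k)) (sym (*-assoc 2 (2 ^ k) (1 + 2 * u)))
      (double (2 ^ k * (1 + 2 * u)) (*-mono-≤ (m^n>0 2 k) (s≤s {0} {2 * u} z≤n)) (xor-pred w k u k<))
    where
    unfold : ∀ a b {a′ b′} → odd a ≡ false → odd b ≡ true → a / 2 ≡ a′ → b / 2 ≡ b′ → bitwise _xor_ (suc w) a b ≡ 1 + 2 * bitwise _xor_ w a′ b′
    unfold a b p q r s rewrite p | q | r | s = refl
    ring : ∀ x → 1 + 2 * x + 1 ≡ 2 * (x + 1)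
    ring = solve-∀
    double : ∀ v {P} → 0 < v → bitwise _xor_ w v (v ∸ 1) + 1 ≡ P → bitwise _xor_ (suc w) (2 * v) (2 * v ∸ 1) + 1 ≡ 2 * P
    double (suc v) {P} _ IH = begin
      bitwise _xor_ (suc w) (2 * suc v) (2 * suc v ∸ 1) + 1 ≡⟨ cong (λ z → bitwise _xor_ (suc w) (2 * suc v) z + 1) (+-suc v (v + 0)) ⟩
      bitwise _xor_ (suc w) (2 * suc v) (1 + 2 * v) + 1 ≡⟨ cong (_+ 1) (unfold (2 * suc v) (1 + 2 * v) (odd-double (suc v)) (odd-suc-double v) (half-double (suc v)) (half-suc-double v)) ⟩
      1 + 2 * bitwise _xor_ w (suc v) v + 1 ≡⟨ ring (bitwise _xor_ w (suc v) v) ⟩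
      2 * (bitwise _xor_ w (suc v) v + 1) ≡⟨ cong (2 *_) IH ⟩
      2 * P ∎
      where open ≡-Reasoning

  boot₃ : Ex 5 → Ex 4
  boot₃ body = call body (x2 ⊙ x3 ∷ (x2 ⊘ x3) ⊙ x3 ∷ (x2 ⊘ x3 ⊘ x3) ⊙ x3 ∷ x0 ∷ x1 ∷ [])

  -- x3 is 2 ^ (k + 1), found from the lowest set bit of word 0. Division by it removes the unary
  -- number, and half of it is the modulus that cuts off k-bit fields; k itself is never computed.
  boot₂ : Ex 5 → Ex 4
  boot₂ body = call (boot₃ body) (x0 ∷ x1 ∷ x2 ⊘ x3 ∷ x3 ≫ lit 1 ∷ [])

  -- Word 0 starts with a unary number k, followed by three k-bit numbers.
  boot : Ex 5 → Ex 3
  boot body = call (boot₂ body) (x0 ∷ x2 ∷ ld (lit 0) ∷ (ld (lit 0) ⊻ (ld (lit 0) ⊟ lit 1)) ⊞ lit 1 ∷ [])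

  module Boot (w : ℕ) .{{_ : NonZero w}} (μ : ℕ → ℕ) (V : ℕ) (μ-rd : ∀ j → μ j ≡ rd V (j * w) w) where
    open Machine w μ
    open Rules w μ

    private
      v = μ 0

      v-wrap : v ≡ wrap w V
      v-wrap = trans (μ-rd 0) (cong (wrap w) (n/1≡n V))

      v< : v < 2 ^ w
      v< = subst (_< 2 ^ w) (sym v-wrap) (wrap-< w V)

      rd-v : ∀ p τ → p + τ ≤ w → rd v p τ ≡ rd V p τ
      rd-v p τ l = trans (rd-wrap v p τ) (trans (cong (λ z → wrap (p + τ) z ÷ p) v-wrap) (trans (cong (_÷ p) (wrap-wrap V l)) (sym (rd-wrap V p τ))))

    boot-spec : ∀ body k η H₀ q m n → 1 ≤ k → 4 * k + 1 ≤ w → rd V 0 (k + 1) ≡ 2 ^ k → rd V (k + 1) k ≡ w → rd V (k + 1 + k) k ≡ η → rd V (k + 1 + k + k) k ≡ H₀ →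
      eval (boot body) (q ∷ m ∷ n ∷ []) ≡ eval body (w ∷ η ∷ H₀ ∷ q ∷ n ∷ [])
    boot-spec body k η H₀ q m n 1≤k 4k≤ r₀ r₁ r₂ r₃ =
      call⇓ (var⇓ ∷⇓ var⇓ ∷⇓ v⇓ ∷⇓ p⇓ ∷⇓ []⇓)
      (call⇓ (var⇓ ∷⇓ var⇓ ∷⇓ div⇓ {y = 2 ^ suc k} {{m^n≢0 2 (suc k)}} var⇓ var⇓ v< ∷⇓ trans (shr⇓ var⇓ (lit⇓ 1<) p<) half ∷⇓ []⇓)
      (call⇓ (trans (mod⇓ {{m^n≢0 2 k}} var⇓ var⇓ y<) e₁ ∷⇓ trans (mod⇓ {{m^n≢0 2 k}} (div⇓ {{m^n≢0 2 k}} var⇓ var⇓ y<) var⇓ (≤-<-trans (÷-≤ y k) y<)) e₂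
        ∷⇓ trans (mod⇓ {{m^n≢0 2 k}} (div⇓ {{m^n≢0 2 k}} (div⇓ {{m^n≢0 2 k}} var⇓ var⇓ y<) var⇓ (≤-<-trans (÷-≤ y k) y<)) var⇓ (≤-<-trans (≤-trans (÷-≤ (y ÷ k) k) (÷-≤ y k)) y<)) e₃
        ∷⇓ var⇓ ∷⇓ var⇓ ∷⇓ []⇓) refl))
      where
      1≤w : 1 ≤ w
      1≤w = >-nonZero⁻¹ w
      1< : 1 < 2 ^ w
      1< = ≤-<-trans 1≤w (n<2^n w)
      0< : 0 < 2 ^ w
      0< = m^n>0 2 w
      k+1≤4k+1 : k + 1 + k + k + k ≤ w
      k+1≤4k+1 = ≤-trans (≤-reflexive (ring k)) 4k≤
        where
        ring : ∀ k → k + 1 + k + k + k ≡ 4 * k + 1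
        ring = solve-∀
      l₂ : k + 1 + k + k ≤ w
      l₂ = ≤-trans (m≤m+n _ k) k+1≤4k+1
      l₁ : k + 1 + k ≤ w
      l₁ = ≤-trans (m≤m+n _ k) l₂
      l₀ : k + 1 ≤ w
      l₀ = ≤-trans (m≤m+n _ k) l₁
      k<w : k < w
      k<w = subst (_≤ w) (+-comm k 1) l₀
      suc-k< : suc k < w
      suc-k< = ≤-trans (≤-trans (≤-reflexive (cong suc (+-comm 1 k))) (≤-trans (≤-reflexive (+-comm 1 (k + 1))) (+-monoʳ-≤ (k + 1) 1≤k))) l₁
      y = v ÷ suc k
      y< : y < 2 ^ w
      y< = ≤-<-trans (÷-≤ v (suc k)) v<
      v-shape : v ≡ 2 ^ k * (1 + 2 * y)
      v-shape = trans (÷-split v (suc k)) (trans (cong (_+ 2 ^ suc k * y) low) (ring (2 ^ k) y))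
        where
        low : wrap (suc k) v ≡ 2 ^ k
        low = trans (cong (λ z → wrap z v) (+-comm 1 k)) (trans (sym (cong (wrap (k + 1)) (n/1≡n v))) (trans (rd-v 0 (k + 1) l₀) r₀))
        ring : ∀ a b → a + 2 * a * b ≡ a * (1 + 2 * b)
        ring = solve-∀
      1≤v : 1 ≤ v
      1≤v = subst (1 ≤_) (sym v-shape) (*-mono-≤ (m^n>0 2 k) (s≤s z≤n))
      x = bitwise _xor_ w v (v ∸ 1)
      x+1 : x + 1 ≡ 2 ^ suc k
      x+1 = trans (cong (λ z → bitwise _xor_ w z (z ∸ 1) + 1) v-shape) (xor-pred w k y k<w)
      p< : 2 ^ suc k < 2 ^ w
      p< = ^-monoʳ-< 2 (s≤s (s≤s z≤n)) suc-k<
      v⇓ : ∀ {j} {ρ : Vec ℕ j} → eval (ld (lit 0)) ρ ≡ v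
      v⇓ = ld⇓ (lit⇓ 0<)
      p⇓ : eval ((ld (lit 0) ⊻ (ld (lit 0) ⊟ lit 1)) ⊞ lit 1) (q ∷ m ∷ n ∷ []) ≡ 2 ^ suc k
      p⇓ = trans (add⇓ (trans (bin⇓ v⇓ (sub⇓ v⇓ (lit⇓ 1<) 1≤v v<)) (wrap-small w x<)) (lit⇓ 1<) (subst (_< 2 ^ w) (sym x+1) p<)) x+1
        where
        x< : x < 2 ^ w
        x< = <-trans (subst (x <_) (trans (+-comm 1 x) x+1) ≤-refl) p<
      half : (2 ^ suc k) ÷ 1 ≡ 2 ^ k
      half = half-double (2 ^ k)
      e₁ : wrap k y ≡ w
      e₁ = trans (cong (λ z → wrap k (v ÷ z)) (+-comm 1 k)) (trans (rd-v (k + 1) k l₁) r₁)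
      e₂ : wrap k (y ÷ k) ≡ η
      e₂ = trans (cong (wrap k) (trans (÷-÷ v (suc k) k) (cong (λ z → v ÷ (z + k)) (+-comm 1 k)))) (trans (rd-v (k + 1 + k) k l₂) r₂)
      e₃ : wrap k (y ÷ k ÷ k) ≡ H₀
      e₃ = trans (cong (wrap k) (trans (cong (_÷ k) (÷-÷ v (suc k) k)) (trans (÷-÷ v (suc k + k) k) (cong (λ z → v ÷ (z + k + k)) (+-comm 1 k)))))
        (trans (rd-v (k + 1 + k + k) k k+1≤4k+1) r₃)

  -- Shifts by one bit at a time: in a small universe a word may be too short for the literal E,
  -- which would be reduced modulo 2 ^ w, whereas 1 always fits.
  largeE : ℕ → Ex 3
  largeE zero = x1
  largeE (suc E) = largeE E ≫ lit 1

  lookupE : Ex 3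
  lookupE = ld x0

  pickE : Ex 3
  pickE = (x2 ⊠ (lit 1 ⊟ x0)) ⊞ (x1 ⊠ x0)

  previous : Ex 3
  previous = x1 ⊟ bin lt (lit 0) x1

  -- Environment: the word searched for, an upper bound for the addresses not
  -- yet visited, the address found so far.
  searchE : ℕ → Ex 3
  searchE zero = x2
  searchE (suc t) = call (searchE t) (x0 ∷ previous ∷ call pickE (bin eq (ld previous) x0 ∷ previous ∷ x2 ∷ []) ∷ [])

  -- The table of a small universe stores rank plus one, so select searches for the address holding
  -- i + 1. The search runs downwards from m, which is in a register, and stays at address 0 once
  -- there; a constant number of unrolled steps thus covers every small m.
  findE : ℕ → Ex 3
  findE t = call (searchE t) (x0 ⊞ lit 1 ∷ x1 ∷ lit 0 ∷ [])

  module Small (w : ℕ) .{{_ : NonZero w}} (μ : ℕ → ℕ) where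
    open Machine w μ
    open Rules w μ

    private
      1≤w : 1 ≤ w
      1≤w = >-nonZero⁻¹ w
      1< : 1 < 2 ^ w
      1< = ≤-<-trans 1≤w (n<2^n w)
      0< : 0 < 2 ^ w
      0< = m^n>0 2 w

    largeE-spec : ∀ E {q m n} → m < 2 ^ w → eval (largeE E) (q ∷ m ∷ n ∷ []) ≡ m ÷ E
    largeE-spec zero {m = m} m< = trans var⇓ (sym (n/1≡n m))
    largeE-spec (suc E) {m = m} m< = trans (shr⇓ (largeE-spec E m<) (lit⇓ 1<) (≤-<-trans (÷-≤ m E) m<))
      (trans (÷-÷ m E 1) (cong (m ÷_) (+-comm E 1)))

    lookupE-spec : ∀ {q m n} → eval lookupE (q ∷ m ∷ n ∷ []) ≡ μ q
    lookupE-spec = ld⇓ var⇓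

    module _ (m i z : ℕ) (1≤m : 1 ≤ m) (m< : m < 2 ^ w) (z< : z < m) (i+1< : i + 1 < 2 ^ w)
      (μz : μ z ≡ i + 1) (unique : ∀ y → y < m → μ y ≡ i + 1 → y ≡ z) where

      private
        env : ℕ → ℕ → Vec ℕ 3
        env y res = i + 1 ∷ y ∷ res ∷ []

        z<2^w : z < 2 ^ w
        z<2^w = <-trans z< m<

        prev : ∀ y res → y ≤ m → eval previous (env y res) ≡ pred y
        prev zero res _ = sub⇓ var⇓ (trans (bin⇓ (lit⇓ 0<) var⇓) (flag 1≤w _)) z≤n 0<
        prev (suc y) res y≤ = sub⇓ var⇓ (trans (bin⇓ (lit⇓ 0<) var⇓) (flag 1≤w _)) (s≤s z≤n) (≤-<-trans y≤ m<)

        pred< : ∀ y → y ≤ m → pred y < m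
        pred< zero _ = 1≤m
        pred< (suc y) l = l

        pick-hit : ∀ y res → y < 2 ^ w → eval pickE (1 ∷ y ∷ res ∷ []) ≡ y
        pick-hit y res y< = trans (add⇓ (trans (mul⇓ var⇓ (sub⇓ (lit⇓ 1<) var⇓ ≤-refl 1<) (subst (_< 2 ^ w) (sym (*-zeroʳ res)) 0<)) (*-zeroʳ res))
          (mul⇓ var⇓ var⇓ (subst (_< 2 ^ w) (sym (*-identityʳ y)) y<)) (subst (_< 2 ^ w) (sym (*-identityʳ y)) y<)) (*-identityʳ y)

        pick-miss : ∀ y res → res < 2 ^ w → eval pickE (0 ∷ y ∷ res ∷ []) ≡ res
        pick-miss y res r< = trans (add⇓ (mul⇓ var⇓ (sub⇓ (lit⇓ 1<) var⇓ z≤n 1<) (subst (_< 2 ^ w) (sym (*-identityʳ res)) r<))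
          (trans (mul⇓ var⇓ var⇓ (subst (_< 2 ^ w) (sym (*-zeroʳ y)) 0<)) (*-zeroʳ y)) (subst (_< 2 ^ w) (sym (trans (+-identityʳ _) (*-identityʳ res))) r<))
          (trans (+-identityʳ _) (*-identityʳ res))

        step-hit : ∀ t y res {r} → y ≤ m → pred y ≡ z → eval (searchE t) (env (pred y) z) ≡ r → eval (searchE (suc t)) (env y res) ≡ r
        step-hit t y res y≤ e h = call⇓ (var⇓ ∷⇓ prev y res y≤ ∷⇓ call⇓ (trans (bin⇓ (ld⇓ (prev y res y≤)) var⇓) (trans (flag 1≤w _) (cong ind (≡ᵇ-yes (trans (cong μ e) μz))))
          ∷⇓ prev y res y≤ ∷⇓ var⇓ ∷⇓ []⇓) (trans (pick-hit (pred y) res (<-trans (pred< y y≤) m<)) e) ∷⇓ []⇓) h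

        step-miss : ∀ t y res {r} → y ≤ m → res < 2 ^ w → pred y ≢ z → eval (searchE t) (env (pred y) res) ≡ r → eval (searchE (suc t)) (env y res) ≡ r
        step-miss t y res y≤ r< ne h = call⇓ (var⇓ ∷⇓ prev y res y≤ ∷⇓ call⇓ (trans (bin⇓ (ld⇓ (prev y res y≤)) var⇓) (trans (flag 1≤w _) (cong ind (≡ᵇ-no (λ q → ne (unique (pred y) (pred< y y≤) q)))))
          ∷⇓ prev y res y≤ ∷⇓ var⇓ ∷⇓ []⇓) (pick-miss (pred y) res r<) ∷⇓ []⇓) h

        search-found : ∀ t y → y ≤ m → eval (searchE t) (env y z) ≡ z
        search-found zero y y≤ = var⇓
        search-found (suc t) y y≤ with pred y ≟ z
        ... | yes e = step-hit t y z y≤ e (search-found t (pred y) (<⇒≤ (pred< y y≤)))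
        ... | no ne = step-miss t y z y≤ z<2^w ne (search-found t (pred y) (<⇒≤ (pred< y y≤)))

        search-spec : ∀ t y res → res < 2 ^ w → y ≤ m → z < y → y ≤ z + t → eval (searchE t) (env y res) ≡ z
        search-spec zero y res _ _ z<y y≤z = contradiction (subst (y ≤_) (+-identityʳ z) y≤z) (<⇒≱ z<y)
        search-spec (suc t) (suc y) res r< y≤ z<y y≤z with y ≟ z
        ... | yes e = step-hit t (suc y) res y≤ e (search-found t y (<⇒≤ y≤))
        ... | no ne = step-miss t (suc y) res y≤ r< ne (search-spec t y res r< (<⇒≤ y≤) (≤∧≢⇒< (s≤s⁻¹ z<y) (≢-sym ne)) (s≤s⁻¹ (subst (suc y ≤_) (+-suc z t) y≤z)))

      findE-spec : ∀ t {n} → i < 2 ^ w → m ≤ t → eval (findE t) (i ∷ m ∷ n ∷ []) ≡ z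
      findE-spec t i< m≤t = call⇓ (add⇓ var⇓ (lit⇓ 1<) i+1< ∷⇓ var⇓ ∷⇓ lit⇓ 0< ∷⇓ []⇓)
        (search-spec t m 0 0< ≤-refl z< (≤-trans m≤t (m≤n+m t z)))

-- The sorted enumeration of a set; sampled ranks; compression of slots.

module SortedElements where
  open BitFields
  open CommonMultiples
  open Tabulating
  open import Defs
  open import Data.Maybe using (Maybe; just; nothing)
  open import Data.Fin as Fin using (Fin; zero; suc; toℕ)
  open import Data.Fin.Properties using (toℕ<n; toℕ-injective)
  open import Data.Fin.Subset using (Subset; ∣_∣) renaming (_∈_ to _∈ₛ_)
  open import Data.Fin.Subset.Properties using (_∈?_)
  open import Data.Vec as Vec using (Vec; []; _∷_; here; there)
  open import Data.Vec.Membership.Propositional.Properties using (∈-toList⁺; ∈-allFin⁺)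
  open import Data.List using (List; []; _∷_; length; filter; map; tabulate)
  open import Data.List.Properties using (filter-none; filter-accept; filter-reject; length-map)
  open import Data.List.Relation.Unary.All as All using (All; []; _∷_)
  open import Data.List.Relation.Unary.AllPairs using (AllPairs; []; _∷_)
  import Data.List.Relation.Unary.AllPairs.Properties as AllPairs
  open import Data.List.Relation.Unary.Any using (here; there)
  open import Data.List.Membership.Propositional using (_∈_)
  open import Data.List.Membership.Propositional.Properties using (∈-map⁺; ∈-map⁻; ∈-filter⁺; ∈-filter⁻)
  open import Data.Empty using (⊥-elim)
  open import Relation.Binary.Definitions using (tri<; tri≈; tri>)

  nth? : List ℕ → ℕ → Maybe ℕ
  nth? [] _ = nothing
  nth? (y ∷ _) zero = just y
  nth? (_ ∷ ys) (suc k) = nth? ys k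

  mutual
    -- Again unification names a local loop, here that of `selectS`; abstracting suc k in the proof
    -- separates the outer index from the counter.
    selectS-loop : ∀ (m : ℕ) → ℕ → Subset m → ℕ → List ℕ → Maybe ℕ
    selectS-loop = _

    selectS-nth : ∀ {m} i (S : Subset m) → selectS i S ≡ nth? (elems S) i
    selectS-nth {m} i S with elems S
    selectS-nth {m} i S | [] = refl
    selectS-nth {m} zero S | y ∷ ys = refl
    selectS-nth {m} (suc k) S | y ∷ ys with suc k
    ... | u = selectS-loop-nth u S k ys

    selectS-loop-nth : ∀ {m} u (S : Subset m) k ys → selectS-loop m u S k ys ≡ nth? ys k
    selectS-loop-nth u S k [] = refl
    selectS-loop-nth u S zero (y ∷ ys) = refl
    selectS-loop-nth u S (suc k) (y ∷ ys) = selectS-loop-nth u S k ys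

  nth : List ℕ → ℕ → ℕ
  nth [] _ = 0
  nth (y ∷ _) zero = y
  nth (_ ∷ ys) (suc k) = nth ys k

  nth?-nth : ∀ l i → i < length l → nth? l i ≡ just (nth l i)
  nth?-nth (y ∷ l) zero _ = refl
  nth?-nth (y ∷ l) (suc i) (s≤s i<) = nth?-nth l i i<

  nth-∈ : ∀ l i → i < length l → nth l i ∈ l
  nth-∈ (y ∷ l) zero _ = here refl
  nth-∈ (y ∷ l) (suc i) (s≤s i<) = there (nth-∈ l i i<)

  ∈-nth : ∀ {y} l → y ∈ l → ∃ λ i → i < length l × nth l i ≡ y
  ∈-nth (_ ∷ l) (here refl) = 0 , s≤s z≤n , refl
  ∈-nth (_ ∷ l) (there p) with ∈-nth l p
  ... | i , i< , e = suc i , s≤s i< , e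

  nth-< : ∀ {l} → AllPairs _<_ l → ∀ i j → i < j → j < length l → nth l i < nth l j
  nth-< {y ∷ l} (a ∷ _) zero (suc j) _ (s≤s j<) = All.lookup a (nth-∈ l j j<)
  nth-< {y ∷ l} (_ ∷ p) (suc i) (suc j) (s≤s i<j) (s≤s j<) = nth-< p i j i<j j<

  count-below-nth : ∀ {l} → AllPairs _<_ l → ∀ i → i < length l → length (filter (_<? nth l i) l) ≡ i
  count-below-nth {y ∷ l} (a ∷ _) zero _ = cong length (filter-none (_<? y) (<-irrefl refl ∷ All.map <⇒≯ a))
  count-below-nth {y ∷ l} (a ∷ p) (suc i) (s≤s i<) = trans (cong length (filter-accept (_<? nth l i) (All.lookup a (nth-∈ l i i<))))
    (cong suc (count-below-nth p i i<))

  toList-tabulate : ∀ {A : Set} n (f : Fin n → A) → Vec.toList (Vec.tabulate f) ≡ tabulate f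
  toList-tabulate zero f = refl
  toList-tabulate (suc n) f = cong (f zero ∷_) (toList-tabulate n (f ∘ suc))

  length-filter-tabulate : ∀ {A : Set} {P : A → Set} (P? : ∀ a → Dec (P a)) {n} (f : Fin n → A) (S : Subset n) →
    (∀ i → P (f i) → i ∈ₛ S) → (∀ i → i ∈ₛ S → P (f i)) → length (filter P? (tabulate f)) ≡ ∣ S ∣
  length-filter-tabulate P? f [] _ _ = refl
  length-filter-tabulate P? f (true ∷ S) to from =
    trans (cong length (filter-accept P? (from zero here))) (cong suc (length-filter-tabulate P? (f ∘ suc) S (λ i p → drop (to (suc i) p)) (λ i p → from (suc i) (there p))))
    where
    drop : ∀ {i} → suc i ∈ₛ (true ∷ S) → i ∈ₛ S
    drop (there p) = p
  length-filter-tabulate P? f (false ∷ S) to from =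
    trans (cong length (filter-reject P? (λ p → contradiction (to zero p) λ ()))) (length-filter-tabulate P? (f ∘ suc) S (λ i p → drop (to (suc i) p)) (λ i p → from (suc i) (there p)))
    where
    drop : ∀ {i} → suc i ∈ₛ (false ∷ S) → i ∈ₛ S
    drop (there p) = p

  elems-sorted : ∀ {m} (S : Subset m) → AllPairs _<_ (elems S)
  elems-sorted {m} S = AllPairs.map⁺ (AllPairs.filter⁺ (_∈? S) (subst (AllPairs (λ i j → toℕ i < toℕ j)) (sym (toList-tabulate m id)) (AllPairs.tabulate⁺-< id)))

  length-elems : ∀ {m} (S : Subset m) → length (elems S) ≡ ∣ S ∣
  length-elems {m} S = trans (length-map toℕ (filter (_∈? S) (Vec.toList (Vec.allFin m)))) (trans (cong (λ l → length (filter (_∈? S) l)) (toList-tabulate m id))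
    (length-filter-tabulate (_∈? S) id S (λ _ p → p) (λ _ p → p)))

  ∈-elems : ∀ {m} (S : Subset m) {x} → x ∈ₛ S → toℕ x ∈ elems S
  ∈-elems S {x} p = ∈-map⁺ toℕ (∈-filter⁺ (_∈? S) (∈-toList⁺ (∈-allFin⁺ x)) p)

  elems-∈ : ∀ {m} (S : Subset m) {y} → y ∈ elems S → ∃ λ x → x ∈ₛ S × y ≡ toℕ x
  elems-∈ {m} S p with ∈-map⁻ toℕ p
  ... | x , q , e = x , proj₂ (∈-filter⁻ (_∈? S) {xs = Vec.toList (Vec.allFin m)} q) , e

  record Enumeration {m} (n : ℕ) (S : Subset m) : Set where
    field
      X : ℕ → ℕ
      X-< : ∀ i j → i < j → j < n → X i < X j
      X<m : ∀ i → i < n → X i < m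
      select-X : ∀ i → i < n → selectS i S ≡ just (X i)
      rank-X : ∀ (x : Fin m) → (∃ λ r → r < n × X r ≡ toℕ x × rankS x S ≡ val r) ⊎ ((∀ i → i < n → X i ≢ toℕ x) × rankS x S ≡ minusOne)

    X-inj : InjectiveOn n X
    X-inj i j i< j< e with <-cmp i j

    ... | tri< l _ _ = contradiction e (<⇒≢ (X-< i j l j<))
    ... | tri≈ _ p _ = p
    ... | tri> _ _ l = contradiction (sym e) (<⇒≢ (X-< j i l i<))

  enumerate : ∀ {m} n (S : Subset m) → ∣ S ∣ ≡ n → Enumeration n S
  enumerate {m} n S e = record { X = nth l ; X-< = λ i j i<j j< → nth-< sorted i j i<j (bd j<) ; X<m = below
      ; select-X = λ i i< → trans (selectS-nth i S) (nth?-nth l i (bd i<)) ; rank-X = rank }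
    where
    l = elems S
    sorted = elems-sorted S
    len : length l ≡ n
    len = trans (length-elems S) e
    bd : ∀ {i} → i < n → i < length l
    bd = subst (_ <_) (sym len)
    below : ∀ i → i < n → nth l i < m
    below i i< with elems-∈ S (nth-∈ l i (bd i<))
    ... | x , _ , q = subst (_< m) (sym q) (toℕ<n x)
    rank : ∀ (x : Fin m) → (∃ λ r → r < n × nth l r ≡ toℕ x × rankS x S ≡ val r) ⊎ ((∀ i → i < n → nth l i ≢ toℕ x) × rankS x S ≡ minusOne)
    rank x with x ∈? S
    ... | yes p with ∈-nth l (∈-elems S p)
    ... | r , r< , q = inj₁ (r , subst (r <_) len r< , q , cong val (trans (cong (λ z → length (filter (_<? z) l)) (sym q)) (count-below-nth sorted r r<)))
    rank x | no ¬p = inj₂ ((λ i i< q → ¬p (back i i< q)) , refl)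
      where
      back : ∀ i → i < n → nth l i ≡ toℕ x → x ∈ₛ S
      back i i< q with elems-∈ S (nth-∈ l i (bd i<))
      ... | y , y∈ , q′ = subst (_∈ₛ S) (toℕ-injective (trans (sym q′) q)) y∈

  -- The number of leading terms of an increasing sequence that lie below t.
  lower : (ℕ → ℕ) → ℕ → ℕ → ℕ
  lower X zero t = 0
  lower X (suc n) t = if X n <ᵇ t then suc n else lower X n t

  lower-≤ : ∀ X n t → lower X n t ≤ n
  lower-≤ X zero t = z≤n
  lower-≤ X (suc n) t with X n <ᵇ t
  ... | true = ≤-refl
  ... | false = m≤n⇒m≤1+n (lower-≤ X n t)

  lower-rank : ∀ X n t r → (∀ i j → i < j → j < n → X i < X j) → r < n → t ≤ X r → lower X n t ≤ r
  lower-rank X (suc n) t r X-< r< t≤ with X n <ᵇ t in e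
  ... | true = contradiction (<ᵇ⇒< (X n) t (subst T (sym e) tt)) (≤⇒≯ (≤-trans t≤ (top (m≤n⇒m<n∨m≡n (s≤s⁻¹ r<)))))
    where
    top : r < n ⊎ r ≡ n → X r ≤ X n
    top (inj₁ l) = <⇒≤ (X-< r n l ≤-refl)
    top (inj₂ refl) = ≤-refl
  ... | false with m≤n⇒m<n∨m≡n (s≤s⁻¹ r<)
  ... | inj₁ l = lower-rank X n t r (λ i j i<j j< → X-< i j i<j (m<n⇒m<1+n j<)) l t≤
  ... | inj₂ refl = lower-≤ X n t

  lower-at : ∀ X n t i → lower X n t ≤ i → i < n → t ≤ X i
  lower-at X (suc n) t i l i< with X n <ᵇ t in e
  ... | true = contradiction i< (≤⇒≯ l)
  ... | false with m≤n⇒m<n∨m≡n (s≤s⁻¹ i<)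
  ... | inj₁ i<n = lower-at X n t i l i<n
  ... | inj₂ refl = ≮⇒≥ (λ q → subst T e (<⇒<ᵇ q))

  rank-gap : ∀ (X : ℕ → ℕ) n → (∀ i j → i < j → j < n → X i < X j) → ∀ d i → d + i < n → X i + d ≤ X (d + i)
  rank-gap X n X-< zero i _ = ≤-reflexive (+-identityʳ (X i))
  rank-gap X n X-< (suc d) i l = ≤-trans (≤-reflexive (+-suc (X i) d)) (≤-trans (s≤s (rank-gap X n X-< d i (<⇒≤ l))) (X-< (d + i) (suc d + i) ≤-refl l))

  -- The integers X increase strictly, so an interval of length g contains at most g of them.
  -- Scanning g candidates from the sampled rank therefore reaches r.
  lower-near : ∀ X n t g r → (∀ i j → i < j → j < n → X i < X j) → r < n → t ≤ X r → X r < t + g → r < lower X n t + g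
  lower-near X n t g r X-< r< t≤ X<  = +-cancelˡ-< t _ _ (begin-strict
      t + r ≡⟨ cong (t +_) (sym back) ⟩
      t + ((r ∸ lw) + lw) ≡⟨ sym (+-assoc t (r ∸ lw) lw) ⟩
      t + (r ∸ lw) + lw ≤⟨ +-monoˡ-≤ lw (≤-trans (+-monoˡ-≤ (r ∸ lw) (lower-at X n t lw ≤-refl (≤-<-trans lw≤ r<))) (rank-gap X n X-< (r ∸ lw) lw (subst (_< n) (sym back) r<))) ⟩
      X ((r ∸ lw) + lw) + lw ≡⟨ cong (λ z → X z + lw) back ⟩
      X r + lw <⟨ +-monoˡ-< lw X< ⟩
      t + g + lw ≡⟨ trans (+-assoc t g lw) (cong (t +_) (+-comm g lw)) ⟩
      t + (lw + g) ∎)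
    where
    open ≤-Reasoning
    lw = lower X n t
    lw≤ : lw ≤ r
    lw≤ = lower-rank X n t r X-< r< t≤
    back : (r ∸ lw) + lw ≡ r
    back = m∸n+n≡m lw≤

  ∑-< : ∀ n {f g : ℕ → ℕ} k → k < n → (∀ i → i < n → f i ≤ g i) → f k < g k → ∑ n f < ∑ n g
  ∑-< (suc n) k k< le l with m≤n⇒m<n∨m≡n k<
  ... | inj₁ (s≤s k<n) = +-mono-<-≤ (∑-< n k k<n (λ i i< → le i (m<n⇒m<1+n i<)) l) (le n ≤-refl)
  ... | inj₂ refl = +-mono-≤-< (∑-≤ n (λ i i< → le i (m<n⇒m<1+n i<))) l

  module Compress (n : ℕ) (pos : ℕ → ℕ) (pos-inj : InjectiveOn n pos) where

    -- Makes the perfect hash minimal. The array of coarse ranks, whose entries have about lg n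
    -- bits, then has exactly n entries; the empty slots cost only one more monotone sequence of
    -- O(n) bits.
    before : ℕ → ℕ
    before p = ∑ n (λ i → ind (pos i <ᵇ p))

    private
      <ᵇ-true : ∀ {a b} → a < b → (a <ᵇ b) ≡ true
      <ᵇ-true {a} {b} l with a <ᵇ b in e
      ... | true = refl
      ... | false = ⊥-elim (subst T e (<⇒<ᵇ l))
      irrefl : ∀ a → (a <ᵇ a) ≡ false
      irrefl zero = refl
      irrefl (suc a) = irrefl a
      ind≤1 : ∀ b → ind b ≤ 1
      ind≤1 true = ≤-refl
      ind≤1 false = z≤n
      ind-mono : ∀ x {p q} → p ≤ q → ind (x <ᵇ p) ≤ ind (x <ᵇ q)
      ind-mono x {p} {q} l with x <ᵇ p in e
      ... | false = z≤n
      ... | true = ≤-reflexive (cong ind (sym (<ᵇ-true (<-≤-trans (<ᵇ⇒< x p (subst T (sym e) tt)) l))))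

    before-mono : ∀ {p q} → p ≤ q → before p ≤ before q
    before-mono l = ∑-≤ n (λ i _ → ind-mono (pos i) l)

    before-≤ : ∀ p → before p ≤ n
    before-≤ p = ≤-trans (∑-≤ n (λ i _ → ind≤1 (pos i <ᵇ p))) (≤-reflexive (trans (∑-const n 1) (*-identityʳ n)))

    index : ℕ → ℕ
    index i = before (pos i)

    index-< : ∀ i → i < n → index i < n
    index-< i i< = <-≤-trans (∑-< n {g = λ _ → 1} i i< (λ k _ → ind≤1 _) (subst (λ b → ind b < 1) (sym (irrefl (pos i))) ≤-refl))
      (≤-reflexive (trans (∑-const n 1) (*-identityʳ n)))

    private
      strict : ∀ i j → i < n → pos i < pos j → index i < index j
      strict i j i< l = ∑-< n i i< (λ k _ → ind-mono (pos k) (<⇒≤ l)) (subst₂ (λ a b → ind a < ind b) (sym (irrefl (pos i))) (sym (<ᵇ-true l)) ≤-refl)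

    index-injective : InjectiveOn n index
    index-injective i j i< j< e with <-cmp (pos i) (pos j)

    ... | tri< l _ _ = contradiction e (<⇒≢ (strict i j i< l))
    ... | tri≈ _ p _ = pos-inj i j i< j< p
    ... | tri> _ _ l = contradiction (sym e) (<⇒≢ (strict j i j< l))

    inverse : ℕ → ℕ → ℕ
    inverse zero c = 0
    inverse (suc k) c = if index k ≡ᵇ c then k else inverse k c

    inverse-≤ : ∀ k c → inverse k c ≤ k
    inverse-≤ zero c = z≤n
    inverse-≤ (suc k) c with index k ≡ᵇ c
    ... | true = n≤1+n k
    ... | false = m≤n⇒m≤1+n (inverse-≤ k c)

    inverse-index : ∀ i → i < n → inverse n (index i) ≡ i
    inverse-index i i< = go n ≤-refl i<
      where
      go : ∀ k → k ≤ n → i < k → inverse k (index i) ≡ i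
      go (suc k) k≤ i<k with index k ≡ᵇ index i in e
      ... | true = index-injective k i k≤ i< (≡ᵇ-true e)
      ... | false with m≤n⇒m<n∨m≡n (s≤s⁻¹ i<k)
      ... | inj₁ l = go k (<⇒≤ k≤) l
      ... | inj₂ refl = contradiction (trans (sym (≡⇒true {index i} refl)) e) λ ()

-- Assembling the memory image from segments.

module MemoryImage where
  open BitFields
  open FieldAccess
  open BlockCoding

  record Segment (w : ℕ) : Set where
    field
      stride′ len num : ℕ
      stride≤w : stride′ ≤ w
      num< : num < 2 ^ len
  open Segment

  arraySegment : ∀ {w} ω N f → ω ≤ w → (∀ i → i < N → f i < 2 ^ ω) → Segment w
  arraySegment ω N f ω≤ f< = record { stride′ = ω ; len = N * ω ; num = arr ω N f ; stride≤w = ω≤ ; num< = arr-< ω N f f< }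

  emptySegment : ∀ {w} → Segment w
  emptySegment = record { stride′ = 0 ; len = 0 ; num = 0 ; stride≤w = z≤n ; num< = s≤s z≤n }

  bitSegment : ∀ {w} len num → 1 ≤ w → num < 2 ^ len → Segment w
  bitSegment l x 1≤w x< = record { stride′ = 1 ; len = l ; num = x ; stride≤w = 1≤w ; num< = x< }

  record Build (w : ℕ) .{{_ : NonZero w}} : Set where
    field
      seg : ℕ → Segment w
      scal : ℕ → ℕ
      k η : ℕ

    start : ℕ → ℕ
    start a = ∑ a (λ a → len (seg a))

    H₀ size total D₀ : ℕ
    H₀ = k + 1 + k + k + k
    size = start segments
    total = H₀ + (η * (segments * 4) + size)
    D₀ = H₀ + η * (segments * 4)

    entry : ℕ → ℕ → ℕ
    entry a 0 = start a / w
    entry a 1 = start a % w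
    entry a 2 = stride′ (seg a)
    entry a _ = scal a

    header : ℕ → ℕ
    header j = entry (j / 4) (j % 4)

    contents A₄ A₃ A₂ A₁ : ℕ
    contents = cat segments (λ a → len (seg a)) (λ a → num (seg a))
    A₄ = arr η (segments * 4) header + 2 ^ (η * (segments * 4)) * contents
    A₃ = H₀ + 2 ^ k * A₄
    A₂ = η + 2 ^ k * A₃
    A₁ = w + 2 ^ k * A₂

    -- The low k + 1 bits of 2 ^ k are k zeros and a one, which is the unary number k from which
    -- decoding starts.
    V : ℕ
    V = 2 ^ k + 2 ^ (k + 1) * A₁

  record Sound {w : ℕ} .{{_ : NonZero w}} (build : Build w) : Set where
    open Build build
    field
      w<2^k : w < 2 ^ k
      η≤w : η ≤ w
      H₀≤w : H₀ ≤ w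
      header< : ∀ a c → a < segments → c < 4 → entry a c < 2 ^ η

    2^k< : 2 ^ k < 2 ^ (k + 1)
    2^k< = ^-monoʳ-< 2 (s≤s (s≤s z≤n)) (subst (k <_) (+-comm 1 k) ≤-refl)
    η<2^k : η < 2 ^ k
    η<2^k = ≤-<-trans η≤w w<2^k
    H₀<2^k : H₀ < 2 ^ k
    H₀<2^k = ≤-<-trans H₀≤w w<2^k

    header-entry : ∀ a c → c < 4 → header (c + a * 4) ≡ entry a c
    header-entry a c c< = cong₂ entry
      (trans (+-distrib-/-∣ʳ c {a * 4} {4} (Data.Nat.Divisibility.divides a refl)) (cong₂ _+_ (m<n⇒m/n≡0 c<) (m*n/n≡m a 4)))
      (trans ([m+kn]%n≡m%n c a 4) (m<n⇒m%n≡m c<))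
      where import Data.Nat.Divisibility

    header-< : ∀ j → j < segments * 4 → header j < 2 ^ η
    header-< j j< = header< (j / 4) (j % 4) (m<n*o⇒m/o<n j<) (m%n<n j 4)

    Hd< : arr η (segments * 4) header < 2 ^ (η * (segments * 4))
    Hd< = subst (λ z → arr η (segments * 4) header < 2 ^ z) (*-comm (segments * 4) η) (arr-< η (segments * 4) header header-<)

    A₄< : A₄ < 2 ^ (η * (segments * 4) + size)
    A₄< = join-< (η * (segments * 4)) size Hd< (cat-< segments (λ a → len (seg a)) (λ a → num (seg a)) (λ a _ → num< (seg a)))

    V< : V < 2 ^ total
    V< = subst (λ z → V < 2 ^ z) (ring k (η * (segments * 4) + size))
      (join-< (k + 1) _ 2^k< (join-< k _ w<2^k (join-< k _ η<2^k (join-< k _ H₀<2^k A₄<))))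
      where
      ring : ∀ k x → k + 1 + (k + (k + (k + x))) ≡ k + 1 + k + k + k + x
      ring = solve-∀

    lo0 : ∀ {A} S B → A < 2 ^ S → rd (A + 2 ^ S * B) 0 S ≡ A
    lo0 {A} S B A< = trans (rd-lo {A} S B 0 S ≤-refl) (rd-small {A} S A<)
    rd-A₁ : ∀ p τ → rd V (k + 1 + p) τ ≡ rd A₁ p τ
    rd-A₁ p τ = rd-hi (k + 1) A₁ p τ 2^k<
    rd-A₂ : ∀ p τ → rd V (k + 1 + k + p) τ ≡ rd A₂ p τ
    rd-A₂ p τ = trans (cong (λ z → rd V z τ) (+-assoc (k + 1) k p)) (trans (rd-A₁ (k + p) τ) (rd-hi k A₂ p τ w<2^k))
    rd-A₃ : ∀ p τ → rd V (k + 1 + k + k + p) τ ≡ rd A₃ p τ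
    rd-A₃ p τ = trans (cong (λ z → rd V z τ) (+-assoc (k + 1 + k) k p)) (trans (rd-A₂ (k + p) τ) (rd-hi k A₃ p τ η<2^k))
    rd-A₄ : ∀ p τ → rd V (H₀ + p) τ ≡ rd A₄ p τ
    rd-A₄ p τ = trans (cong (λ z → rd V z τ) (+-assoc (k + 1 + k + k) k p)) (trans (rd-A₃ (k + p) τ) (rd-hi k A₄ p τ H₀<2^k))
    at0 : ∀ p τ → rd V p τ ≡ rd V (p + 0) τ
    at0 p τ = cong (λ z → rd V z τ) (sym (+-identityʳ p))

    boot₀ : rd V 0 (k + 1) ≡ 2 ^ k
    boot₀ = lo0 (k + 1) A₁ 2^k<
    boot-w : rd V (k + 1) k ≡ w
    boot-w = trans (at0 (k + 1) k) (trans (rd-A₁ 0 k) (lo0 k A₂ w<2^k))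
    boot-η : rd V (k + 1 + k) k ≡ η
    boot-η = trans (at0 (k + 1 + k) k) (trans (rd-A₂ 0 k) (lo0 k A₃ η<2^k))
    boot-H₀ : rd V (k + 1 + k + k) k ≡ H₀
    boot-H₀ = trans (at0 (k + 1 + k + k) k) (trans (rd-A₃ 0 k) (lo0 k A₄ H₀<2^k))

    entry-rd : ∀ a c → a < segments → c < 4 → rd V (H₀ + (c + a * 4) * η) η ≡ entry a c
    entry-rd a c a< c< = trans (rd-A₄ (j * η) η) (trans (rd-lo (η * (segments * 4)) contents (j * η) η end)
        (trans (arr-rd η (segments * 4) header header-< j j<) (header-entry a c c<)))
      where
      j = c + a * 4
      j< : j < segments * 4
      j< = <-≤-trans (+-monoˡ-< (a * 4) c<) (*-monoˡ-≤ 4 a<)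
      end : j * η + η ≤ η * (segments * 4)
      end = ≤-trans (≤-reflexive (+-comm (j * η) η)) (≤-trans (*-monoˡ-≤ η j<) (≤-reflexive (*-comm (segments * 4) η)))

  record Loaded {w : ℕ} .{{_ : NonZero w}} (build : Build w) (μ : ℕ → ℕ) : Set where
    open Build build
    field
      sound : Sound build
      μ-rd : ∀ j → μ j ≡ rd V (j * w) w
      word-large : w * 102 + w * w < 2 ^ w
      total-small : total / w + 1 < 2 ^ w

    image : Image w μ
    image = record
      { V = V ; η = η ; H₀ = H₀ ; total = total ; start = start ; stride = λ a → stride′ (seg a) ; scal = scal
      ; μ-rd = μ-rd ; η≤w = Sound.η≤w sound ; H₀≤w = Sound.H₀≤w sound ; word-large = word-large
      ; total-small = λ p p≤ → ≤-<-trans (+-monoˡ-≤ 1 (/-monoˡ-≤ w p≤)) total-small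
      ; data≤total = +-monoʳ-≤ H₀ (m≤m+n (η * (segments * 4)) size)
      ; hdr-rd = λ a a< → Sound.entry-rd sound a 0 a< (s≤s z≤n) , Sound.entry-rd sound a 1 a< (s≤s (s≤s z≤n)) , Sound.entry-rd sound a 2 a< (s≤s (s≤s (s≤s z≤n))) , Sound.entry-rd sound a 3 a< ≤-refl }

    seg-rd : ∀ a → a < segments → rd V (D₀ + start a) (len (seg a)) ≡ num (seg a)
    seg-rd a a< = trans (cong (λ z → rd V z (len (seg a))) (+-assoc H₀ (η * (segments * 4)) (start a)))
      (trans (Sound.rd-A₄ sound (η * (segments * 4) + start a) (len (seg a))) (trans (rd-hi (η * (segments * 4)) contents (start a) (len (seg a)) (Sound.Hd< sound)) (cat-rd segments (λ a → len (seg a)) (λ a → num (seg a)) (λ a _ → num< (seg a)) a a<)))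

    seg-end : ∀ a → a < segments → D₀ + start a + len (seg a) ≤ total
    seg-end a a< = ≤-trans (≤-reflexive (trans (+-assoc D₀ (start a) _) (+-assoc H₀ (η * (segments * 4)) _)))
      (+-monoʳ-≤ H₀ (+-monoʳ-≤ (η * (segments * 4)) (∑-mono (λ a → len (seg a)) a<)))

    array-at : ∀ a {ω N f} (ω≤ : ω ≤ w) (f< : ∀ i → i < N → f i < 2 ^ ω) → a < segments → N ≤ 2 ^ w →
      seg a ≡ arraySegment ω N f ω≤ f< → Layout.Array image a N f
    array-at a {ω} {N} {f} ω≤ f< a< N≤ e = record
      { seg< = a< ; stride≤ = stride≤w (seg a) ; N< = N≤
      ; fits = subst (λ z → D₀ + start a + z ≤ total) (trans (cong len e) (cong (N *_) (sym (cong stride′ e)))) (seg-end a a<)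
      ; holds = λ i i< → subst (λ z → rd V (D₀ + start a + i * z) z ≡ f i) (sym (cong stride′ e))
          (trans (rd-sub {V} {D₀ + start a} (N * ω) (i * ω) ω (subst₂ (λ l x → rd V (D₀ + start a) l ≡ x) (cong len e) (cong num e) (seg-rd a a<))
              (≤-trans (≤-reflexive (+-comm (i * ω) ω)) (*-monoˡ-≤ ω i<)))
            (arr-rd ω N f f< i i<)) }

  -- Continues a finite sequence by its upper bound, so that the last block is full and monotonicity
  -- holds on all of ℕ.
  clamp : ℕ → ℕ → (ℕ → ℕ) → ℕ → ℕ
  clamp N U v i = if i <ᵇ N then v i else U

  module Clamp (N U : ℕ) (v : ℕ → ℕ) (v-mono : ∀ {i j} → i ≤ j → j < N → v i ≤ v j) (v≤ : ∀ i → i < N → v i ≤ U) where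

    clamp-< : ∀ {i} → i < N → clamp N U v i ≡ v i
    clamp-< {i} l with i <ᵇ N in e
    ... | true = refl
    ... | false = contradiction (subst T e (<⇒<ᵇ l)) λ ()

    clamp-≤ : ∀ i → clamp N U v i ≤ U
    clamp-≤ i with i <ᵇ N in e
    ... | true = v≤ i (<ᵇ⇒< i N (subst T (sym e) tt))
    ... | false = ≤-refl

    clamp-mono : Increasing (clamp N U v)
    clamp-mono {i} {j} i≤j with j <ᵇ N in e
    ... | false = clamp-≤ i
    ... | true = ≤-trans (≤-reflexive (clamp-< (≤-<-trans i≤j j<))) (v-mono i≤j j<)
      where
      j< : j < N
      j< = <ᵇ⇒< j N (subst T (sym e) tt)

  record Code (w g : ℕ) .{{_ : NonZero w}} {{_ : NonZero g}} : Set where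
    field
      N U β : ℕ
      v : ℕ → ℕ
      v-mono : ∀ {i j} → i ≤ j → j < N → v i ≤ v j
      v≤ : ∀ i → i < N → v i ≤ U
      U<2^β : U < 2 ^ β
      β≤w : β ≤ w
      -- The decoding table has 2 ^ (2 * g) * g ≤ 2 ^ (3 * g) entries, whose indices must fit into a
      -- word.
      3g≤w : 3 * g ≤ w
      N<2^w : N < 2 ^ w

    open Clamp N U v v-mono v≤
    open Blocks g (clamp N U v) clamp-mono

    blocks : ℕ
    blocks = N / g + 1

    private
      spread≤ : ∀ k → spread k ≤ U
      spread≤ k = ≤-trans (m∸n≤m (clamp N U v (suc k * g)) (clamp N U v (k * g))) (clamp-≤ (suc k * g))
      width≤U : ∀ k → width k ≤ U
      width≤U k = ≤-trans (width-≤ k) (≤-trans (m/n≤m (spread k) g) (spread≤ k))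
      base< : ∀ k → k < blocks → base k < 2 ^ β
      base< k _ = ≤-<-trans (clamp-≤ (k * g)) U<2^β
      width< : ∀ k → k < blocks → width k < 2 ^ β
      width< k _ = ≤-<-trans (width≤U k) U<2^β
      ptr≤U : ∀ k → ptr k ≤ U
      ptr≤U k = ≤-trans (ptr-≤ k) (clamp-≤ (k * g))
      ptr< : ∀ k → k < blocks → ptr k < 2 ^ β
      ptr< k _ = ≤-<-trans (ptr≤U k) U<2^β
      pat< : ∀ k → k < blocks → pat k < 2 ^ (2 * g)
      pat< k _ = proj₁ (proj₂ (pattern-of k))
      1≤w : 1 ≤ w
      1≤w = >-nonZero⁻¹ w
      2g≤w : 2 * g ≤ w
      2g≤w = ≤-trans (m≤n+m (2 * g) g) 3g≤w
      width≤w : ∀ k → width k ≤ w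
      width≤w k = ≤-trans (width-log k β (≤-trans (s≤s (≤-trans (m/n≤m (spread k) g) (spread≤ k))) U<2^β)) β≤w
      blocks≤ : blocks ≤ 2 ^ w
      blocks≤ = ≤-trans (+-monoˡ-≤ 1 (m/n≤m N g)) (≤-trans (≤-reflexive (+-comm N 1)) N<2^w)
      dec≤ : 2 ^ (2 * g) * g ≤ 2 ^ w
      dec≤ = ≤-trans (*-monoʳ-≤ (2 ^ (2 * g)) (<⇒≤ (n<2^n g))) (≤-trans (≤-reflexive (trans (sym (2^-+ (2 * g) g)) (cong (2 ^_) (+-comm (2 * g) g)))) (2^-≤ 3g≤w))

    baseSegment widthSegment ptrSegment patSegment lowSegment : Segment w
    baseSegment = arraySegment β blocks base β≤w base<
    widthSegment = arraySegment β blocks width β≤w width<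
    ptrSegment = arraySegment β blocks ptr β≤w ptr<
    patSegment = arraySegment (2 * g) blocks pat 2g≤w pat<
    lowSegment = bitSegment (ptr blocks) (overflow blocks) 1≤w (overflow-< blocks)

    low-len : len lowSegment ≤ U
    low-len = ptr≤U blocks

    decF : ℕ → ℕ
    decF i = decode g (i / g) (i % g)

    decF< : ∀ i → i < 2 ^ (2 * g) * g → decF i < 2 ^ (2 * g)
    decF< i _ = ≤-<-trans (decode-≤ g (i / g) (i % g)) (n<2^n (2 * g))

    decSegment : Segment w
    decSegment = arraySegment (2 * g) (2 ^ (2 * g) * g) decF 2g≤w decF<

    mono-at : ∀ {build : Build w} {μ} (loaded : Loaded build μ) (let open Build build using (seg; scal)) → ∀ b → 4 + b < segments → scal 1 ≡ g →
      seg b ≡ baseSegment → seg (1 + b) ≡ widthSegment → seg (2 + b) ≡ ptrSegment → seg (3 + b) ≡ patSegment → seg (4 + b) ≡ lowSegment → seg 3 ≡ decSegment →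
      Layout.Mono (Loaded.image loaded) b N v
    mono-at {build} loaded b b< scal-g e₀ e₁ e₂ e₃ e₄ e₅ = record
      { g = g ; nb = blocks ; nd = 2 ^ (2 * g) * g ; base = base ; width = width ; ptr = ptr ; pat = pat ; dec = decF
      ; g-scal = scal-g
      ; base-arr = Loaded.array-at loaded b β≤w base< (below 0 z≤n refl) blocks≤ e₀
      ; width-arr = Loaded.array-at loaded (1 + b) β≤w width< (below 1 (s≤s z≤n) refl) blocks≤ e₁
      ; ptr-arr = Loaded.array-at loaded (2 + b) β≤w ptr< (below 2 (s≤s (s≤s z≤n)) refl) blocks≤ e₂
      ; pat-arr = Loaded.array-at loaded (3 + b) 2g≤w pat< (below 3 (s≤s (s≤s (s≤s z≤n))) refl) blocks≤ e₃
      ; dec-arr = Loaded.array-at loaded 3 2g≤w decF< (≤-trans (m≤m+n 4 b) (<⇒≤ b<)) dec≤ e₅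
      ; ovf< = b< ; N≤ = <⇒≤ N<2^w ; block< = block<
      ; pat< = λ i i< → <-≤-trans (+-monoʳ-< (pat (i / g) * g) (m%n<n i g)) (≤-trans (≤-reflexive (+-comm _ g)) (*-monoˡ-≤ g (pat< (i / g) (block< i i<))))
      ; width≤ = λ k _ → width≤w k
      ; low≤ = λ i i< → ≤-trans (+-monoʳ-≤ (Build.D₀ build + Build.start build (4 + b)) (≤-trans (≤-reflexive (*-identityʳ _)) (≤-trans (m≤m+n _ (width (i / g))) (≤-trans (field-end blocks (i / g) (i % g) (block< i i<) (m%n<n i g)) (≤-reflexive (sym (cong len e₄))))))) (Loaded.seg-end loaded (4 + b) b<)
      ; low< = λ i i< → ≤-<-trans (≤-trans (m≤m+n _ (width (i / g))) (≤-trans (field-end blocks (i / g) (i % g) (block< i i<) (m%n<n i g)) (ptr≤U blocks))) U<2^w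
      ; value = λ i i< → trans (cong₂ (λ x y → base (i / g) + (x * 2 ^ width (i / g) + y)) (dec-eq i (block< i i<)) (low-eq i (block< i i<))) (trans (value i) (clamp-< i<))
      ; value< = λ i i< → ≤-<-trans (v≤ i i<) U<2^w }
      where
      below : ∀ c → c ≤ 4 → ∀ {a} → a ≡ c + b → a < segments
      below c c≤ refl = ≤-<-trans (+-monoˡ-≤ b c≤) b<
      U<2^w : U < 2 ^ w
      U<2^w = <-≤-trans U<2^β (2^-≤ β≤w)
      block< : ∀ i → i < N → i / g < blocks
      block< i i< = subst (i / g <_) (+-comm 1 (N / g)) (s≤s (/-monoˡ-≤ g (<⇒≤ i<)))
      at : ∀ p j → j < g → decF (p * g + j) ≡ decode g p j
      at p j j< = cong₂ (decode g)
        (trans (+-distrib-/-∣ˡ {p * g} j (Data.Nat.Divisibility.divides p refl)) (trans (cong₂ _+_ (m*n/n≡m p g) (m<n⇒m/n≡0 j<)) (+-identityʳ p)))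
        (trans (cong (_% g) (+-comm (p * g) j)) (trans ([m+kn]%n≡m%n j p g) (m<n⇒m%n≡m j<)))
        where import Data.Nat.Divisibility
      dec-eq : ∀ i → i / g < blocks → decF (pat (i / g) * g + i % g) ≡ decode g (pat (i / g)) (i % g)
      dec-eq i _ = at (pat (i / g)) (i % g) (m%n<n i g)
      low-eq : ∀ i → i / g < blocks → rd (Build.V build) (Build.D₀ build + Build.start build (4 + b) + (ptr (i / g) + i % g * width (i / g)) * 1) (width (i / g)) ≡ lo (i / g) (i % g)
      low-eq i k< = trans (cong (λ z → rd (Build.V build) (Build.D₀ build + Build.start build (4 + b) + z) (width (i / g))) (*-identityʳ _))
        (trans (rd-sub {Build.V build} {Build.D₀ build + Build.start build (4 + b)} (ptr blocks) (ptr (i / g) + i % g * width (i / g)) (width (i / g))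
            (subst₂ (λ l x → rd (Build.V build) (Build.D₀ build + Build.start build (4 + b)) l ≡ x) (cong len e₄) (cong num e₄) (Loaded.seg-rd loaded (4 + b) b<))
            (field-end blocks (i / g) (i % g) k< (m%n<n i g)))
          (overflow-rd blocks (i / g) (i % g) k< (m%n<n i g)))

-- Choice of parameters, space accounting, sparse and dense sets.

module Structure where
  open BitFields
  open StraightLine
  open FieldAccess
  open CommonMultiples
  open Tabulating
  open TwoLevelHashing
  open Queries
  open Startup
  open SortedElements
  open MemoryImage
  open import Defs
  open import Data.Nat.Logarithm
  open import Data.Maybe using (just)
  open import Data.Vec using ([]; _∷_)
  open import Data.List using (List; length)
  open import Data.Fin using (toℕ)
  open import Data.Fin.Subset using (Subset)

  2^-cancel-≤ : ∀ {a b} → 2 ^ a ≤ 2 ^ b → a ≤ b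
  2^-cancel-≤ {a} {b} l with a ≤? b
  ... | yes p = p
  ... | no ¬p = contradiction l (<⇒≱ (^-monoʳ-< 2 (s≤s (s≤s z≤n)) (≰⇒> ¬p)))

  2^-cancel-< : ∀ {a b} → 2 ^ a < 2 ^ b → a < b
  2^-cancel-< {a} {b} l with a <? b
  ... | yes p = p
  ... | no ¬p = contradiction l (≤⇒≯ (2^-≤ (≮⇒≥ ¬p)))

  ÷-∸-< : ∀ x a k → x < 2 ^ a → x ÷ k < 2 ^ (a ∸ k)
  ÷-∸-< x a k x< with k ≤? a
  ... | yes l = ÷-< k (a ∸ k) (subst (λ z → x < 2 ^ z) (sym (m+[n∸m]≡n l)) x<)
  ... | no ¬l = subst (_< 2 ^ (a ∸ k)) (sym (m<n⇒m/n≡0 {{m^n≢0 2 k}} (<-≤-trans x< (2^-≤ (<⇒≤ (≰⇒> ¬l)))))) (m^n>0 2 (a ∸ k))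

  linear-≤-2^ : ∀ k → 6 ≤ k → k * 8 + 3 ≤ 2 ^ k
  linear-≤-2^ k l = subst (λ z → z * 8 + 3 ≤ 2 ^ z) (m∸n+n≡m l) (go (k ∸ 6))
    where
    go : ∀ d → (d + 6) * 8 + 3 ≤ 2 ^ (d + 6)
    go zero = ≤ᵇ⇒≤ 51 64 tt
    go (suc d) = begin
      (suc d + 6) * 8 + 3 ≡⟨ ring (d + 6) ⟩
      ((d + 6) * 8 + 3) + 8 ≤⟨ +-mono-≤ (go d) (≤-trans (≤-trans (≤-reflexive (sym (*-identityˡ 8))) (*-monoˡ-≤ 8 (≤-trans (s≤s z≤n) (m≤n+m 6 d)))) (≤-trans (m≤m+n _ 3) (go d))) ⟩
      2 ^ (d + 6) + 2 ^ (d + 6) ≡⟨ cong (2 ^ (d + 6) +_) (sym (+-identityʳ _)) ⟩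
      2 ^ (suc d + 6) ∎
      where
      open ≤-Reasoning
      ring : ∀ x → suc x * 8 + 3 ≡ (x * 8 + 3) + 8
      ring = solve-∀

  quadratic-<-2^ : ∀ w → 16 ≤ w → w * 102 + w * w < 2 ^ w
  quadratic-<-2^ w l = subst (λ z → z * 102 + z * z < 2 ^ z) (m∸n+n≡m l) (go (w ∸ 16))
    where
    go : ∀ d → (d + 16) * 102 + (d + 16) * (d + 16) < 2 ^ (d + 16)
    go zero = <ᵇ⇒< 1888 65536 tt
    go (suc d) = begin-strict
      (suc d + 16) * 102 + (suc d + 16) * (suc d + 16) ≡⟨ ring (d + 16) ⟩
      P + (103 + 2 * x) <⟨ +-mono-<-≤ (go d) (≤-trans small (<⇒≤ (go d))) ⟩
      2 ^ x + 2 ^ x ≡⟨ cong (2 ^ x +_) (sym (+-identityʳ _)) ⟩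
      2 ^ (suc d + 16) ∎
      where
      open ≤-Reasoning
      x = d + 16
      P = x * 102 + x * x
      ring : ∀ x → suc x * 102 + suc x * suc x ≡ (x * 102 + x * x) + (103 + 2 * x)
      ring = solve-∀
      small : 103 + 2 * x ≤ P
      small = +-mono-≤ (≤-trans (≤ᵇ⇒≤ 103 1632 tt) (*-monoˡ-≤ 102 (m≤n+m 16 d))) (*-monoˡ-≤ x (≤-trans (s≤s (s≤s z≤n)) (m≤n+m 16 d)))

  2*2^ : ∀ k → 2 ^ k + 2 ^ k ≡ 2 ^ suc k
  2*2^ k = cong (2 ^ k +_) (sym (+-identityʳ _))

  opaque
    lg : ℕ → ℕ
    lg n = ⌈log₂ n ⌉

    lg-def : ∀ n → ⌈log₂ n ⌉ ≡ lg n
    lg-def n = refl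

    lg-≥ : ∀ n → n ≤ 2 ^ lg n
    lg-≥ = log-≥

    lg-≤ : ∀ {n k} → n ≤ 2 ^ k → lg n ≤ k
    lg-≤ {n} {k} = log-≤ {n} {k}

    lg-< : ∀ {n} → 1 ≤ n → 2 ^ lg n < 2 * n
    lg-< {n} = log-< {n}

    lg-mono : ∀ {m n} → m ≤ n → lg m ≤ lg n
    lg-mono = ⌈log₂⌉-mono-≤

    lg-0 : lg 1 ≡ 0
    lg-0 = refl

    lg-2 : lg 2 ≡ 1
    lg-2 = refl

  module Outcomes (w : ℕ) .{{_ : NonZero w}} (μ : ℕ → ℕ) where
    open Branch w μ

    private
      0< : 0 < 2 ^ w
      0< = m^n>0 2 w
      1< : 1 < 2 ^ w
      1< = ≤-<-trans (>-nonZero⁻¹ w) (n<2^n w)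

      copy : ∀ {v} → v < 2 ^ w → evalOp w add v (wrap w 0) ≡ v
      copy {v} v< = trans (cong (λ z → wrap w (v + z)) (wrap-small w 0<)) (trans (cong (wrap w) (+-identityʳ v)) (wrap-small w v<))

    outcome-0 : ∀ s {v} → v < 2 ^ w → Outcome s v → reg s 0 ≡ v
    outcome-0 s v< (p , _) = trans p (trans (cong (λ z → evalOp w add z (wrap w 0)) (copy v<)) (copy v<))

    outcome-rank : ∀ s r → suc r < 2 ^ w → Outcome s (suc r) → rankOut s ≡ val r
    outcome-rank s r r< o@(_ , q) = trans (cong (λ z → if z ≡ᵇ 0 then minusOne else val (reg s 1)) (outcome-0 s r< o)) (cong val reg₁)
      where
      reg₁ : reg s 1 ≡ r
      reg₁ = trans q (trans (cong₂ (evalOp w sub) (copy r<) (wrap-small w 1<))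
        (trans ([m+n]%n≡m%n r (2 ^ w) {{m^n≢0 2 w}}) (wrap-small w (<-trans ≤-refl r<))))

    outcome-absent : ∀ s → Outcome s 0 → rankOut s ≡ minusOne
    outcome-absent s o = cong (λ z → if z ≡ᵇ 0 then minusOne else val (reg s 1)) (outcome-0 s 0< o)

  opaque
    -- Scans are unrolled 2 ^ K times and the search in `selectProgram` 2 ^ E times: enormous
    -- numbers, but dependent on c alone. They are kept opaque so that nothing tries to expand them.
    rankProgram : (E G K : ℕ) → Program
    rankProgram E G K = branch (largeE E) (boot (rankE G K)) lookupE

    selectProgram : ℕ → Program
    selectProgram E = branch (largeE E) (boot selectE) (findE (2 ^ E))

  module Runs (w : ℕ) (μ R : ℕ → ℕ) (x y z : ℕ) (match : Machine.Match w μ 3 R args (x ∷ y ∷ z ∷ [])) where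
    open Machine w μ
    open Branch w μ

    Runs-to : Program → Ex 3 → Set
    Runs-to P e = Σ State λ s → runWithin w P (length P) (st 0 R μ) ≡ just s × Outcome s (eval e (x ∷ y ∷ z ∷ []))

    opaque
      unfolding rankProgram

      rank-large : ∀ E G K → eval (largeE E) (x ∷ y ∷ z ∷ []) ≢ 0 → Runs-to (rankProgram E G K) (boot (rankE G K))
      rank-large E G K = run-big (largeE E) (boot (rankE G K)) lookupE match

      rank-small : ∀ E G K → eval (largeE E) (x ∷ y ∷ z ∷ []) ≡ 0 → Runs-to (rankProgram E G K) lookupE
      rank-small E G K = run-small (largeE E) (boot (rankE G K)) lookupE match

      select-large : ∀ E → eval (largeE E) (x ∷ y ∷ z ∷ []) ≢ 0 → Runs-to (selectProgram E) (boot selectE)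
      select-large E = run-big (largeE E) (boot selectE) (findE (2 ^ E)) match

      select-small : ∀ E → eval (largeE E) (x ∷ y ∷ z ∷ []) ≡ 0 → Runs-to (selectProgram E) (findE (2 ^ E))
      select-small E = run-small (largeE E) (boot selectE) (findE (2 ^ E)) match

  opaque
    -- Bounds the size of every auxiliary segment, in units of ν bits.
    Q : ℕ
    Q = 4194304

    const≤Q : ∀ x → T (x ≤ᵇ 4194304) → x ≤ Q
    const≤Q x p = ≤ᵇ⇒≤ x 4194304 p

  opaque
    K₀ : ℕ
    K₀ = 25 * Q

    K₀-def : K₀ ≡ 25 * Q
    K₀-def = refl

  opaque
    -- The overhead per unit ν: K₀ for the auxiliary segments, 4 c + 9 for the preamble of 4 k + 1
    -- bits, and 100 header entries of at most (c + K₀ + 4) ν bits.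
    K₂ : ℕ → ℕ
    K₂ c = K₀ + (4 * c + 9) + (c + K₀ + 4) * 100

    K₂-def : ∀ c → K₂ c ≡ K₀ + (4 * c + 9) + (c + K₀ + 4) * 100
    K₂-def c = refl

  -- If the modulus found exceeds M, then M itself serves, since reduction modulo M fixes all X. A
  -- modulus thus never exceeds the universe and fits into a word.
  mod-injective-≤ : ∀ n B M X → InjectiveOn n X → 1 ≤ M → (∀ i → i < n → X i < M) → M ≤ 2 ^ B →
    ∃ λ d → suc d ≤ M × suc d ≤ n * (n * B) + 2 × InjectiveOn n (λ i → X i % suc d)
  mod-injective-≤ n B (suc M) X inj _ X< M≤ with mod-injective n B X inj (λ i i< → <-≤-trans (X< i i<) M≤)
  ... | d , d≤ , d-inj with suc d ≤? suc M
  ... | yes l = d , l , ≤-trans (s≤s d≤) (≤-reflexive (sym (+-suc _ 1))) , d-inj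
  ... | no ¬l = M , ≤-refl , ≤-trans (<⇒≤ (≰⇒> ¬l)) (≤-trans (s≤s d≤) (≤-reflexive (sym (+-suc _ 1))))
    , λ i j i< j< e → inj i j i< j< (trans (sym (m<n⇒m%n≡m (X< i i<))) (trans e (m<n⇒m%n≡m (X< j j<))))

  module Constants (c : ℕ) where
    opaque
      -- Dense sets have m < 2 ^ 14 n and hence about m / 2 ^ 17 < n / 8 samples. Even at lg (1 + m)
      -- bits each they take at most half of n lg m.
      G : ℕ
      G = 17

      G-def : G ≡ 17
      G-def = refl

    opaque
      -- Coarse ranks omit K bits, which pays for everything that costs O(n)
      -- bits; E is the logarithm of the largest universe treated as small.
      K Z₁ E Z : ℕ
      K = K₂ c + G
      Z₁ = K₂ c + K₂ c * 2 ^ K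
      E = K + (2 * Z₁ + 2 * K₂ c) + (31 + 4 * K₂ c) + 64
      Z = Z₁ + 2 ^ E * (c * E)

      G≤K : G ≤ K
      G≤K = m≤n+m G (K₂ c)
      K₂<K : K₂ c + 1 ≤ K
      K₂<K = +-monoʳ-≤ (K₂ c) (subst (1 ≤_) (sym G-def) (s≤s z≤n))
      Z₁-def : Z₁ ≡ K₂ c + K₂ c * 2 ^ K
      Z₁-def = refl
      Z₁≤Z : Z₁ ≤ Z
      Z₁≤Z = m≤m+n Z₁ (2 ^ E * (c * E))
      small≤Z : 2 ^ E * (c * E) ≤ Z
      small≤Z = m≤n+m (2 ^ E * (c * E)) Z₁
      -- The summands of `E` are the lower bounds on lg m required later: 64 for the elementary
      -- estimates, K so that the literals fit into a word, and the other two for the space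
      -- estimates in the sparse and in the dense case.
      64≤E : 64 ≤ E
      64≤E = m≤n+m 64 (K + (2 * Z₁ + 2 * K₂ c) + (31 + 4 * K₂ c))
      K≤E : K ≤ E
      K≤E = ≤-trans (m≤m+n K (2 * Z₁ + 2 * K₂ c)) (≤-trans (m≤m+n (K + (2 * Z₁ + 2 * K₂ c)) (31 + 4 * K₂ c)) (m≤m+n (K + (2 * Z₁ + 2 * K₂ c) + (31 + 4 * K₂ c)) 64))
      Z₁≤E : 2 * Z₁ + 2 * K₂ c ≤ E
      Z₁≤E = ≤-trans (m≤n+m (2 * Z₁ + 2 * K₂ c) K) (≤-trans (m≤m+n (K + (2 * Z₁ + 2 * K₂ c)) (31 + 4 * K₂ c)) (m≤m+n (K + (2 * Z₁ + 2 * K₂ c) + (31 + 4 * K₂ c)) 64))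
      K₂≤E : 31 + 4 * K₂ c ≤ E
      K₂≤E = ≤-trans (m≤n+m (31 + 4 * K₂ c) (K + (2 * Z₁ + 2 * K₂ c))) (m≤m+n (K + (2 * Z₁ + 2 * K₂ c) + (31 + 4 * K₂ c)) 64)

  module Setting (c m n w : ℕ) (1≤m : 1 ≤ m) (n≤m : n ≤ m) (w≥ : lg (1 + m) ≤ w) (w≤ : w ≤ c * lg (1 + m)) where

    opaque
      L LL : ℕ
      L = lg m
      LL = lg L

      L-def : L ≡ lg m
      L-def = refl
      LL-def : LL ≡ lg (lg m)
      LL-def = refl

      m≤2^L : m ≤ 2 ^ L
      m≤2^L = lg-≥ m

      2^L<2m : 2 ^ L < 2 * m
      2^L<2m = lg-< 1≤m

      L≤2^LL : L ≤ 2 ^ LL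
      L≤2^LL = lg-≥ L

      LL≤L : LL ≤ L
      LL≤L = lg-≤ (<⇒≤ (n<2^n L))

    log1+m : lg (1 + m) ≤ suc L
    log1+m = lg-≤ (≤-trans (+-mono-≤ (m^n>0 2 L) m≤2^L) (≤-reflexive (2*2^ L)))

    m<2^w : m < 2 ^ w
    m<2^w = ≤-trans (lg-≥ (1 + m)) (2^-≤ w≥)

    L≤w : L ≤ w
    L≤w = ≤-trans (subst (_≤ lg (1 + m)) (sym L-def) (lg-mono (n≤1+n m))) w≥

    w≤cL : w ≤ c * suc L
    w≤cL = ≤-trans w≤ (*-monoʳ-≤ c log1+m)

    1≤w : 1 ≤ w
    1≤w = ≤-trans (subst (_≤ lg (1 + m)) lg-2 (lg-mono (s≤s 1≤m))) w≥

    -- The unit of overhead: in a term K₂ ν the part K₂ n is paid for by the omitted bits, K₂ LL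
    -- goes into C lg lg m and K₂ into f.
    ν : ℕ
    ν = n + LL + 1

    1≤ν : 1 ≤ ν
    1≤ν = m≤n+m 1 (n + LL)
    n≤ν : n ≤ ν
    n≤ν = ≤-trans (m≤m+n n LL) (m≤m+n (n + LL) 1)
    LL≤ν : LL ≤ ν
    LL≤ν = ≤-trans (m≤n+m LL n) (m≤m+n (n + LL) 1)

    opaque
      -- Of order lg ν, so that O(lg ν) bits per block of g values amount to O(1) bits per value.
      -- The divisor 8 makes 2 ^ (8 g) lie between ν and 512 ν; tables of size O(2 ^ (4 g)) are then
      -- well within O(ν).
      g : ℕ
      g = lg ν / 8 + 1

      private
        e : ℕ
        e = lg ν
        e≤8g : e ≤ 8 * g
        e≤8g = begin
          e ≡⟨ m≡m%n+[m/n]*n e 8 ⟩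
          e % 8 + e / 8 * 8 ≤⟨ +-monoˡ-≤ (e / 8 * 8) (<⇒≤ (m%n<n e 8)) ⟩
          8 + e / 8 * 8 ≡⟨ ring (e / 8) ⟩
          8 * g ∎
          where
          open ≤-Reasoning
          ring : ∀ x → 8 + x * 8 ≡ 8 * (x + 1)
          ring = solve-∀
        8g≤ : 8 * g ≤ e + 8
        8g≤ = ≤-trans (≤-reflexive (ring (e / 8))) (+-monoˡ-≤ 8 (m/n*n≤m e 8))
          where
          ring : ∀ x → 8 * (x + 1) ≡ x * 8 + 8
          ring = solve-∀

      1≤g : 1 ≤ g
      1≤g = m≤n+m 1 (e / 8)

      ν≤2^8g : ν ≤ 2 ^ (8 * g)
      ν≤2^8g = ≤-trans (lg-≥ ν) (2^-≤ e≤8g)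

      2^8g≤ : 2 ^ (8 * g) ≤ ν * 512
      2^8g≤ = begin
        2 ^ (8 * g) ≤⟨ 2^-≤ 8g≤ ⟩
        2 ^ (e + 8) ≡⟨ 2^-+ e 8 ⟩
        2 ^ e * 256 ≤⟨ *-monoˡ-≤ 256 (<⇒≤ (lg-< 1≤ν)) ⟩
        2 * ν * 256 ≡⟨ trans (cong (_* 256) (*-comm 2 ν)) (*-assoc ν 2 256) ⟩
        ν * 512 ∎
        where open ≤-Reasoning

      g≤ν+1 : g ≤ ν + 1
      g≤ν+1 = +-monoˡ-≤ 1 (≤-trans (m/n≤m e 8) (lg-≤ (<⇒≤ (n<2^n ν))))

      8g≤w+9 : 8 * g ≤ w + 9
      8g≤w+9 = ≤-trans 8g≤ (≤-trans (+-monoˡ-≤ 8 e≤) (≤-reflexive (+-assoc w 1 8)))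
        where
        e≤ : e ≤ w + 1
        e≤ = lg-≤ (begin
          n + LL + 1 ≡⟨ +-assoc n LL 1 ⟩
          n + (LL + 1) ≤⟨ +-mono-≤ (≤-trans n≤m (<⇒≤ m<2^w)) (≤-trans (≤-reflexive (+-comm LL 1)) (≤-<-trans (≤-trans LL≤L L≤w) (n<2^n w))) ⟩
          2 ^ w + 2 ^ w ≡⟨ 2*2^ w ⟩
          2 ^ suc w ≡⟨ cong (2 ^_) (+-comm 1 w) ⟩
          2 ^ (w + 1) ∎)
          where open ≤-Reasoning

      -- This is ⌊lg n⌋ for n ≥ 1, and 0 for n = 0. A rank needs ℓ + 1 bits, one more than the low
      -- bits leave over, whence the demand K₂ + 1 ≤ K.
      ℓ : ℕ
      ℓ = lg (suc n) ∸ 1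

      n<2^ℓ+1 : n < 2 ^ suc ℓ
      n<2^ℓ+1 = ≤-trans (lg-≥ (suc n)) (2^-≤ (m≤n+m∸n (lg (suc n)) 1))

      private
        2^ℓ≤ : 1 ≤ n → 2 ^ ℓ ≤ n
        2^ℓ≤ 1≤n with lg (suc n) | lg-< {suc n} (s≤s z≤n)
        ... | zero | _ = 1≤n
        ... | suc x | l = ≤-pred-double (s≤s⁻¹ (≤-trans l (≤-reflexive (ring n))))
          where
          ring : ∀ n → 2 * suc n ≡ suc (suc (2 * n))
          ring = solve-∀
          ≤-pred-double : 2 ^ suc x ≤ suc (2 * n) → 2 ^ x ≤ n
          ≤-pred-double q with 2 ^ x ≤? n
          ... | yes p = p
          ... | no ¬p = contradiction (≤-trans (≤-reflexive (sym (ring n))) (≤-trans (*-monoʳ-≤ 2 (≰⇒> ¬p)) q)) (<⇒≱ ≤-refl)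

      2^ℓ≤ν : 2 ^ ℓ ≤ ν
      2^ℓ≤ν with 1 ≤? n
      ... | yes p = ≤-trans (2^ℓ≤ p) n≤ν
      ... | no ¬p = subst (λ z → 2 ^ (lg (suc z) ∸ 1) ≤ ν) (sym (n<1⇒n≡0 (≰⇒> ¬p))) (subst (λ z → 2 ^ (z ∸ 1) ≤ ν) (sym lg-0) 1≤ν)

      2^ℓ≤m : 2 ^ ℓ ≤ m
      2^ℓ≤m with 1 ≤? n
      ... | yes p = ≤-trans (2^ℓ≤ p) n≤m
      ... | no ¬p = subst (λ z → 2 ^ (lg (suc z) ∸ 1) ≤ m) (sym (n<1⇒n≡0 (≰⇒> ¬p))) (subst (λ z → 2 ^ (z ∸ 1) ≤ m) (sym lg-0) 1≤m)

    ℓ≤L : ℓ ≤ L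
    ℓ≤L = 2^-cancel-≤ (≤-trans 2^ℓ≤m m≤2^L)

    ℓ<w : ℓ < w
    ℓ<w = 2^-cancel-< (≤-<-trans 2^ℓ≤m m<2^w)

    ℓ≤8g : ℓ ≤ 8 * g
    ℓ≤8g = 2^-cancel-≤ (≤-trans 2^ℓ≤ν ν≤2^8g)

    lowBits : ℕ
    lowBits = L ∸ ℓ

    lowBits+ℓ : lowBits + ℓ ≡ L
    lowBits+ℓ = m∸n+n≡m ℓ≤L

    opaque
      k : ℕ
      k = lg (1 + w)

      w<2^k : w < 2 ^ k
      w<2^k = lg-≥ (1 + w)

      1≤k : 1 ≤ k
      1≤k = subst (_≤ lg (1 + w)) lg-2 (lg-mono (s≤s 1≤w))

      k≤ : k ≤ c + LL + 1
      k≤ = lg-≤ (begin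
        1 + w ≤⟨ s≤s w≤cL ⟩
        1 + c * suc L ≤⟨ +-monoˡ-≤ (c * suc L) (s≤s z≤n) ⟩
        suc c * suc L ≤⟨ *-mono-≤ (n<2^n c) (≤-trans (+-mono-≤ (m^n>0 2 LL) L≤2^LL) (≤-reflexive (2*2^ LL))) ⟩
        2 ^ c * 2 ^ suc LL ≡⟨ sym (2^-+ c (suc LL)) ⟩
        2 ^ (c + suc LL) ≡⟨ cong (2 ^_) (trans (+-suc c LL) (+-comm 1 (c + LL))) ⟩
        2 ^ (c + LL + 1) ∎)
        where open ≤-Reasoning

      4k+1≤w : 32 ≤ w → 4 * k + 1 ≤ w
      4k+1≤w 32≤w with 6 ≤? k
      ... | yes 6≤k = *-cancelˡ-≤ 2 (s≤s⁻¹ (begin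
          suc (2 * (4 * k + 1)) ≡⟨ ring k ⟩
          k * 8 + 3 ≤⟨ linear-≤-2^ k 6≤k ⟩
          2 ^ k ≤⟨ s≤s⁻¹ (lg-< {1 + w} (s≤s z≤n)) ⟩
          w + suc (w + 0) ≡⟨ +-suc w (w + 0) ⟩
          suc (2 * w) ∎))
        where
        open ≤-Reasoning
        ring : ∀ k → suc (2 * (4 * k + 1)) ≡ k * 8 + 3
        ring = solve-∀
      ... | no ¬6≤k = ≤-trans (+-monoˡ-≤ 1 (*-monoʳ-≤ 4 (s≤s⁻¹ (≰⇒> ¬6≤k)))) (≤-trans (≤ᵇ⇒≤ 21 32 tt) 32≤w)

    3g≤w : 32 ≤ w → 3 * g ≤ w
    3g≤w 32≤w = *-cancelˡ-≤ 8 (begin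
      8 * (3 * g) ≡⟨ ring₁ g ⟩
      3 * (8 * g) ≤⟨ *-monoʳ-≤ 3 8g≤w+9 ⟩
      3 * (w + 9) ≡⟨ ring₂ w ⟩
      3 * w + 27 ≤⟨ +-monoʳ-≤ (3 * w) (≤-trans (≤ᵇ⇒≤ 27 32 tt) (≤-trans 32≤w (m≤m+n w (4 * w)))) ⟩
      3 * w + 5 * w ≡⟨ sym (*-distribʳ-+ w 3 5) ⟩
      8 * w ∎)
      where
      open ≤-Reasoning
      ring₁ : ∀ g → 8 * (3 * g) ≡ 3 * (8 * g)
      ring₁ = solve-∀
      ring₂ : ∀ w → 3 * (w + 9) ≡ 3 * w + 27
      ring₂ = solve-∀

    w<2^ : w < 2 ^ (c + ν + 1)
    w<2^ = <-≤-trans w<2^k (2^-≤ (≤-trans k≤ (+-monoˡ-≤ 1 (+-monoʳ-≤ c LL≤ν))))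

    open Constants c public

    module Store (2^E≤m : 2 ^ E ≤ m) {S : Subset m} (en : Enumeration n S) where
      open Enumeration en public

      E≤L : E ≤ L
      E≤L = 2^-cancel-≤ (≤-trans 2^E≤m m≤2^L)
      64≤L : 64 ≤ L
      64≤L = ≤-trans 64≤E E≤L
      32≤w : 32 ≤ w
      32≤w = ≤-trans (≤-trans (≤ᵇ⇒≤ 32 64 tt) 64≤L) L≤w
      K<2^w : K < 2 ^ w
      K<2^w = ≤-<-trans (≤-trans K≤E (≤-trans E≤L L≤w)) (n<2^n w)
      1≤L : 1 ≤ L
      1≤L = ≤-trans (s≤s z≤n) 64≤L

      L*≤ : ∀ d → d ≤ 8 → (L + d) * 2 ^ 15 ≤ 2 ^ L
      L*≤ d d≤ = begin
        (L + d) * 2 ^ 15 ≡⟨ cong (λ z → (z + d) * 2 ^ 15) (sym back) ⟩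
        (t + 15 + d) * 2 ^ 15 ≤⟨ *-monoˡ-≤ (2 ^ 15) (≤-trans (≤-reflexive (+-assoc t 15 d)) (≤-trans (+-monoʳ-≤ t (≤-trans (+-monoʳ-≤ 15 d≤) (≤-trans (≤ᵇ⇒≤ 23 49 tt) 49≤t))) (≤-trans (≤-trans (≤-reflexive (ring t)) (≤-trans (*-monoʳ-≤ t (≤ᵇ⇒≤ 2 8 tt)) (m≤m+n _ 3))) (linear-≤-2^ t (≤-trans (≤ᵇ⇒≤ 6 49 tt) 49≤t))))) ⟩
        2 ^ t * 2 ^ 15 ≡⟨ sym (2^-+ t 15) ⟩
        2 ^ (t + 15) ≡⟨ cong (2 ^_) back ⟩
        2 ^ L ∎
        where
        open ≤-Reasoning
        t = L ∸ 15
        back : t + 15 ≡ L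
        back = m∸n+n≡m (≤-trans (≤ᵇ⇒≤ 15 64 tt) 64≤L)
        49≤t : 49 ≤ t
        49≤t = ∸-monoˡ-≤ 15 64≤L
        ring : ∀ t → t + t ≡ t * 2
        ring = solve-∀

      instance
        w≢0 : NonZero w
        w≢0 = >-nonZero 1≤w
        g≢0 : NonZero g
        g≢0 = >-nonZero 1≤g

      n<2^w : n < 2 ^ w
      n<2^w = ≤-<-trans n≤m m<2^w

      high low : ℕ → ℕ
      high i = X i ÷ lowBits
      low i = wrap lowBits (X i)

      private
        X-mono : ∀ {i j} → i ≤ j → j < n → X i ≤ X j
        X-mono {i} {j} i≤j j< with m≤n⇒m<n∨m≡n i≤j
        ... | inj₁ l = <⇒≤ (X-< i j l j<)
        ... | inj₂ refl = ≤-refl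

        high-mono : ∀ {i j} → i ≤ j → j < n → high i ≤ high j
        high-mono i≤j j< = /-monoˡ-≤ (2 ^ lowBits) {{m^n≢0 2 lowBits}} (X-mono i≤j j<)

        high≤ : ∀ i → i < n → high i ≤ 2 ^ ℓ
        high≤ i i< = <⇒≤ (÷-< lowBits ℓ (<-≤-trans (X<m i i<) (≤-trans m≤2^L (≤-reflexive (cong (2 ^_) (sym lowBits+ℓ))))))

        U< : 2 ^ ℓ < 2 ^ (ℓ + 1)
        U< = ^-monoʳ-< 2 (s≤s (s≤s z≤n)) (subst (ℓ <_) (+-comm 1 ℓ) ≤-refl)

        ℓ+1≤w : ℓ + 1 ≤ w
        ℓ+1≤w = subst (_≤ w) (+-comm 1 ℓ) ℓ<w

        low< : ∀ i → i < n → low i < 2 ^ lowBits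
        low< i _ = wrap-< lowBits (X i)

        lowBits≤w : lowBits ≤ w
        lowBits≤w = ≤-trans (m∸n≤m L ℓ) L≤w

      highCode : Code w g
      highCode = record { N = n ; U = 2 ^ ℓ ; β = ℓ + 1 ; v = high ; v-mono = high-mono ; v≤ = high≤ ; U<2^β = U< ; β≤w = ℓ+1≤w ; 3g≤w = 3g≤w 32≤w ; N<2^w = n<2^w }

      lowArray : Segment w
      lowArray = arraySegment lowBits n low lowBits≤w low<

      module Segments (other : ℕ → Segment w) (sc : ℕ → ℕ) (K₀ : ℕ) where

        seg : ℕ → Segment w
        seg 0 = lowArray
        seg 3 = Code.decSegment highCode
        seg 5 = Code.baseSegment highCode
        seg 6 = Code.widthSegment highCode
        seg 7 = Code.ptrSegment highCode
        seg 8 = Code.patSegment highCode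
        seg 9 = Code.lowSegment highCode
        seg a = other a

        scal : ℕ → ℕ
        scal 0 = lowBits
        scal 1 = g
        scal a = sc a

        -- A header entry must be readable as one field, so η ≤ w, but 100 entries of w bits would
        -- exceed the budget when n is small. All entries are also below 2 ^ Y with Y = O(ν); twice
        -- ν is needed for the first modulus.
        Y η : ℕ
        Y = ν + ν + (c + K₀ + 2)
        η = w ⊓ Y

        build : Build w
        build = record { seg = seg ; scal = scal ; k = k ; η = η }

        H₀ size total V : ℕ
        H₀ = Build.H₀ build
        size = Build.size build
        total = Build.total build
        V = Build.V build

        module Correct (sc<w : ∀ a → sc a < 2 ^ w) (sc<Y : ∀ a → sc a < 2 ^ Y)
          (size≤ : size ≤ n * L + ν * K₀) (total< : total < w * m) where

          private
            w<2^Y : w < 2 ^ Y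
            w<2^Y = <-≤-trans w<2^ (2^-≤ (≤-trans (≤-reflexive (ring₁ c ν)) (+-mono-≤ (m≤m+n ν ν) (≤-trans (+-monoʳ-≤ c (s≤s z≤n)) (+-monoˡ-≤ 2 (m≤m+n c K₀))))))
              where
              ring₁ : ∀ c ν → c + ν + 1 ≡ ν + (c + 1)
              ring₁ = solve-∀

            size<2^Y : size < 2 ^ Y
            size<2^Y = begin-strict
              size ≤⟨ size≤ ⟩
              n * L + ν * K₀ ≤⟨ +-mono-≤ (≤-trans (*-mono-≤ (<⇒≤ (n<2^n n)) L≤2^LL) (≤-trans (≤-reflexive (sym (2^-+ n LL))) (2^-≤ (m≤m+n (n + LL) 1))))
                                    (*-mono-≤ (<⇒≤ (n<2^n ν)) (<⇒≤ (n<2^n K₀))) ⟩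
              2 ^ ν + 2 ^ ν * 2 ^ K₀ ≤⟨ +-monoˡ-≤ _ (≤-trans (≤-reflexive (sym (*-identityʳ (2 ^ ν)))) (*-monoʳ-≤ (2 ^ ν) (m^n>0 2 K₀))) ⟩
              2 ^ ν * 2 ^ K₀ + 2 ^ ν * 2 ^ K₀ ≡⟨ cong₂ _+_ (sym (2^-+ ν K₀)) (sym (2^-+ ν K₀)) ⟩
              2 ^ (ν + K₀) + 2 ^ (ν + K₀) ≡⟨ 2*2^ (ν + K₀) ⟩
              2 ^ suc (ν + K₀) <⟨ ^-monoʳ-< 2 (s≤s (s≤s z≤n)) (≤-trans (≤-reflexive (ring ν K₀)) (+-mono-≤ (m≤m+n ν ν) (+-monoˡ-≤ 2 (m≤n+m K₀ c)))) ⟩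
              2 ^ Y ∎
              where
              open ≤-Reasoning
              ring : ∀ a b → suc (suc (a + b)) ≡ a + (b + 2)
              ring = solve-∀

            -- The number of bits may exceed 2 ^ w; only word addresses have to fit, including that
            -- of the following word which `fieldE` always reads. For this `total` < w * m is
            -- enough.
            total-small : total / w + 1 < 2 ^ w
            total-small = ≤-<-trans (≤-trans (≤-reflexive (+-comm (total / w) 1)) (m<n*o⇒m/o<n (subst (total <_) (*-comm w m) total<))) m<2^w

            2^η : ∀ {x} → x < 2 ^ w → x < 2 ^ Y → x < 2 ^ η
            2^η {x} p q with ≤-total w Y
            ... | inj₁ l = subst (λ z → x < 2 ^ z) (sym (m≤n⇒m⊓n≡m l)) p
            ... | inj₂ l = subst (λ z → x < 2 ^ z) (sym (m≥n⇒m⊓n≡n l)) q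

            start≤ : ∀ a → a < segments → Build.start build a ≤ size
            start≤ a a< = ∑-mono _ (<⇒≤ a<)

            scal<w : ∀ a → scal a < 2 ^ w
            scal<w 0 = ≤-<-trans lowBits≤w (n<2^n w)
            scal<w 1 = ≤-<-trans (≤-trans (m≤m+n g (2 * g)) (3g≤w 32≤w)) (n<2^n w)
            scal<w (suc (suc a)) = sc<w (suc (suc a))

            scal<Y : ∀ a → scal a < 2 ^ Y
            scal<Y 0 = ≤-<-trans lowBits≤w w<2^Y
            scal<Y 1 = ≤-<-trans (≤-trans (m≤m+n g (2 * g)) (3g≤w 32≤w)) w<2^Y
            scal<Y (suc (suc a)) = sc<Y (suc (suc a))

            header< : ∀ a c′ → a < segments → c′ < 4 → Build.entry build a c′ < 2 ^ η
            header< a 0 a< _ = 2^η (≤-<-trans (≤-trans (/-monoˡ-≤ w (≤-trans (start≤ a a<) size≤total)) (m≤m+n (total / w) 1)) total-small)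
                (≤-<-trans (≤-trans (m/n≤m (Build.start build a) w) (start≤ a a<)) size<2^Y)
              where
              size≤total : size ≤ total
              size≤total = ≤-trans (m≤n+m size (η * (segments * 4))) (m≤n+m (η * (segments * 4) + size) H₀)
            header< a 1 a< _ = 2^η (<-trans (m%n<n (Build.start build a) w) (n<2^n w)) (<-trans (m%n<n (Build.start build a) w) w<2^Y)
            header< a 2 a< _ = 2^η (≤-<-trans (Segment.stride≤w (seg a)) (n<2^n w)) (≤-<-trans (Segment.stride≤w (seg a)) w<2^Y)
            header< a 3 a< _ = 2^η (scal<w a) (scal<Y a)
            header< a (suc (suc (suc (suc _)))) a< (s≤s (s≤s (s≤s (s≤s ()))))

            H₀≤w : H₀ ≤ w
            H₀≤w = ≤-trans (≤-reflexive (ring k)) (4k+1≤w 32≤w)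
              where
              ring : ∀ k → k + 1 + k + k + k ≡ 4 * k + 1
              ring = solve-∀

            word-large : w * 102 + w * w < 2 ^ w
            word-large = quadratic-<-2^ w (≤-trans (≤ᵇ⇒≤ 16 32 tt) 32≤w)

          private
            sound : Sound build
            sound = record { w<2^k = w<2^k ; η≤w = m⊓n≤m w Y ; H₀≤w = H₀≤w ; header< = header< }

          bs : List Bool
          bs = bitsOf total V

          μ : ℕ → ℕ
          μ = wordOf w bs

          private
            μ-rd : ∀ j → μ j ≡ rd V (j * w) w
            μ-rd j = wordOf-rd w total V j (Sound.V< sound)

          loaded : Loaded build μ
          loaded = record { sound = sound ; μ-rd = μ-rd ; word-large = word-large ; total-small = total-small }

          image : Image w μ
          image = Loaded.image loaded

          highs : Layout.Mono image 5 n high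
          highs = Code.mono-at highCode loaded 5 (m≤m+n 10 15) refl refl refl refl refl refl refl

          lows : Layout.Array image 0 n low
          lows = Loaded.array-at loaded 0 lowBits≤w low< (s≤s z≤n) (<⇒≤ n<2^w) refl

          X-split : ∀ i → i < n → high i * 2 ^ lowBits + low i ≡ X i
          X-split i _ = trans (+-comm _ (low i)) (trans (cong (low i +_) (*-comm (high i) (2 ^ lowBits))) (sym (÷-split (X i) lowBits)))

          X<2^w : ∀ i → i < n → X i < 2 ^ w
          X<2^w i i< = <-trans (X<m i i<) m<2^w

          module Run (rank-ok : ∀ r → r < n → Machine.eval w μ (rankE G K) (w ∷ η ∷ H₀ ∷ X r ∷ n ∷ []) ≡ suc r) where
            open Branch w μ
            open Outcomes w μ

            private
              large : ∀ q → Machine.eval w μ (largeE E) (q ∷ m ∷ n ∷ []) ≢ 0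
              large q e = contradiction (trans (sym (Small.largeE-spec w μ E m<2^w)) e) (≢-nonZero⁻¹ (m ÷ E) {{>-nonZero (m≥n⇒m/n>0 {{m^n≢0 2 E}} 2^E≤m)}})

              booted : ∀ body q → Machine.eval w μ (boot body) (q ∷ m ∷ n ∷ []) ≡ Machine.eval w μ body (w ∷ η ∷ H₀ ∷ q ∷ n ∷ [])
              booted body q = Boot.boot-spec w μ V μ-rd body k η H₀ q m n 1≤k (4k+1≤w 32≤w) (Sound.boot₀ sound) (Sound.boot-w sound) (Sound.boot-η sound) (Sound.boot-H₀ sound)

              R₀ : ℕ → ℕ → ℕ
              R₀ q = reg (initState w bs q m n)

              match : ∀ q → Machine.Match w μ 3 (R₀ q) args (q ∷ m ∷ n ∷ [])
              match q = (s≤s z≤n , refl) , (s≤s (s≤s z≤n) , refl) , (s≤s (s≤s (s≤s z≤n)) , refl) , tt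

            rank-correct : RankCorrect w (rankProgram E G K) (length (rankProgram E G K)) n S bs
            rank-correct x = conclude (Runs.rank-large w μ (R₀ (toℕ x)) (toℕ x) m n (match (toℕ x)) E G K (large (toℕ x))) (rank-X x)
              where
              conclude : Runs.Runs-to w μ (R₀ (toℕ x)) (toℕ x) m n (match (toℕ x)) (rankProgram E G K) (boot (rankE G K)) →
                (∃ λ r → r < n × X r ≡ toℕ x × rankS x S ≡ val r) ⊎ ((∀ i → i < n → X i ≢ toℕ x) × rankS x S ≡ minusOne) →
                Σ State λ s → (runWithin w (rankProgram E G K) (length (rankProgram E G K)) (initState w bs (toℕ x) m n) ≡ just s) × (rankOut s ≡ rankS x S)
              conclude (s , run , out) (inj₁ (r , r< , Xr , e)) = s , run , trans (outcome-rank s r (≤-<-trans r< n<2^w)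
                  (subst (Outcome s) (trans (booted (rankE G K) (toℕ x)) (subst (λ z → Machine.eval w μ (rankE G K) (w ∷ η ∷ H₀ ∷ z ∷ n ∷ []) ≡ suc r) Xr (rank-ok r r<))) out)) (sym e)
              conclude (s , run , out) (inj₂ (ne , e)) = s , run , trans (outcome-absent s (subst (Outcome s) (trans (booted (rankE G K) (toℕ x)) (Query.Select.rankE-absent image highs lows X-split X<2^w X-inj n<2^w G K (toℕ x) ne)) out)) (sym e)

            select-correct : SelectCorrect w (selectProgram E) (length (selectProgram E)) n S bs
            select-correct i i< = conclude (Runs.select-large w μ (R₀ i) i m n (match i) E (large i))
              where
              conclude : Runs.Runs-to w μ (R₀ i) i m n (match i) (selectProgram E) (boot selectE) →
                Σ State λ s → (runWithin w (selectProgram E) (length (selectProgram E)) (initState w bs i m n) ≡ just s) × (selectS i S ≡ just (reg s 0))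
              conclude (s , run , out) = s , run , trans (select-X i i<) (cong just (sym (outcome-0 s (<-trans (X<m i i<) m<2^w)
                (subst (Outcome s) (trans (booted selectE i) (Query.Select.selectE-spec image highs lows X-split X<2^w X-inj n<2^w i i<)) out))))

      g≤2ν : g ≤ ν * 2
      g≤2ν = ≤-trans g≤ν+1 (≤-trans (+-monoʳ-≤ ν 1≤ν) (≤-reflexive (trans (cong (ν +_) (sym (+-identityʳ ν))) (*-comm 2 ν))))

      ν*≤Q : ∀ {x} a → x ≤ ν * a → T (a ≤ᵇ 4194304) → x ≤ ν * Q
      ν*≤Q a l p = ≤-trans l (*-monoʳ-≤ ν (const≤Q a p))

      -- With N / g + 1 blocks and O(g) bits per block, the cost is O(N + g), and g ≤ 2 ν.
      blocks-≤ : ∀ {N b} → N ≤ ν * 11 → b ≤ 12 * g → (N / g + 1) * b ≤ ν * Q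
      blocks-≤ {N} {b} N≤ b≤ = ν*≤Q 156 (begin
        (N / g + 1) * b ≤⟨ *-monoʳ-≤ (N / g + 1) b≤ ⟩
        (N / g + 1) * (12 * g) ≡⟨ ring₁ (N / g) g ⟩
        12 * (N / g * g + g) ≤⟨ *-monoʳ-≤ 12 (+-mono-≤ (≤-trans (m/n*n≤m N g) N≤) g≤2ν) ⟩
        12 * (ν * 11 + ν * 2) ≡⟨ ring₂ ν ⟩
        ν * 156 ∎) tt
        where
        open ≤-Reasoning
        ring₁ : ∀ x g → (x + 1) * (12 * g) ≡ 12 * (x * g + g)
        ring₁ = solve-∀
        ring₂ : ∀ ν → 12 * (ν * 11 + ν * 2) ≡ ν * 156
        ring₂ = solve-∀

      1≤g′ : ∀ a → a ≤ a * g
      1≤g′ a = m≤m*n a g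

      2g≤12g : 2 * g ≤ 12 * g
      2g≤12g = *-monoˡ-≤ g (≤ᵇ⇒≤ 2 12 tt)

      8g+4≤12g : 8 * g + 4 ≤ 12 * g
      8g+4≤12g = ≤-trans (+-monoʳ-≤ (8 * g) (1≤g′ 4)) (≤-reflexive (sym (*-distribʳ-+ g 8 4)))

      ℓ+1≤12g : ℓ + 1 ≤ 12 * g
      ℓ+1≤12g = ≤-trans (+-mono-≤ ℓ≤8g (s≤s z≤n)) 8g+4≤12g

      2^4g≤ : 2 ^ (4 * g) ≤ ν * 512
      2^4g≤ = ≤-trans (2^-≤ (*-monoˡ-≤ g (≤ᵇ⇒≤ 4 8 tt))) 2^8g≤

      dec-≤ : Segment.len (Code.decSegment highCode) ≤ ν * Q
      dec-≤ = ν*≤Q 1024 (begin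
        2 ^ (2 * g) * g * (2 * g) ≤⟨ *-mono-≤ (*-monoʳ-≤ (2 ^ (2 * g)) (<⇒≤ (n<2^n g))) (*-monoʳ-≤ 2 (<⇒≤ (n<2^n g))) ⟩
        2 ^ (2 * g) * 2 ^ g * (2 * 2 ^ g) ≡⟨ cong₂ (λ x y → x * y) (sym (2^-+ (2 * g) g)) (refl {x = 2 * 2 ^ g}) ⟩
        2 ^ (2 * g + g) * (2 * 2 ^ g) ≡⟨ ring (2 ^ (2 * g + g)) (2 ^ g) ⟩
        2 ^ (2 * g + g) * 2 ^ g * 2 ≡⟨ cong (_* 2) (trans (sym (2^-+ (2 * g + g) g)) (cong (2 ^_) (ring′ g))) ⟩
        2 ^ (4 * g) * 2 ≤⟨ *-monoˡ-≤ 2 2^4g≤ ⟩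
        ν * 512 * 2 ≡⟨ *-assoc ν 512 2 ⟩
        ν * 1024 ∎) tt
        where
        open ≤-Reasoning
        ring : ∀ a b → a * (2 * b) ≡ a * b * 2
        ring = solve-∀
        ring′ : ∀ g → 2 * g + g + g ≡ 4 * g
        ring′ = solve-∀

      n≤11ν : n ≤ ν * 11
      n≤11ν = ≤-trans n≤ν (m≤m*n ν 11)

      low-≤ : ∀ {U x} → x ≤ U → U ≤ ν * 11 → x ≤ ν * Q
      low-≤ p q = ν*≤Q 11 (≤-trans p q) tt

      module Size (other : ℕ → Segment w) (sc : ℕ → ℕ) (b₁ b₂ : ℕ)
        (other₁ : Segment.len (other 1) ≤ b₁) (other₂ : Segment.len (other 2) ≤ b₂) (other-≤ : ∀ a → 3 ≤ a → Segment.len (other a) ≤ ν * Q) where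
        open Segments other sc K₀ public

        private
          main : ℕ → ℕ
          main 0 = n * lowBits
          main 1 = b₁
          main 2 = b₂
          main _ = 0

          len-≤ : ∀ a → Segment.len (seg a) ≤ main a + ν * Q
          len-≤ 0 = m≤m+n _ _
          len-≤ 1 = ≤-trans other₁ (m≤m+n _ _)
          len-≤ 2 = ≤-trans other₂ (m≤m+n _ _)
          len-≤ 3 = dec-≤
          len-≤ 4 = other-≤ 4 (≤ᵇ⇒≤ 3 4 tt)
          len-≤ 5 = blocks-≤ {n} {ℓ + 1} n≤11ν ℓ+1≤12g
          len-≤ 6 = blocks-≤ {n} {ℓ + 1} n≤11ν ℓ+1≤12g
          len-≤ 7 = blocks-≤ {n} {ℓ + 1} n≤11ν ℓ+1≤12g
          len-≤ 8 = blocks-≤ {n} {2 * g} n≤11ν 2g≤12g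
          len-≤ 9 = low-≤ (Code.low-len highCode) (≤-trans 2^ℓ≤ν (m≤m*n ν 11))
          len-≤ (suc (suc (suc (suc (suc (suc (suc (suc (suc (suc a)))))))))) = other-≤ _ (s≤s (s≤s (s≤s z≤n)))

        size-≤ : size ≤ n * lowBits + b₁ + b₂ + ν * K₀
        size-≤ = begin
          size ≤⟨ ∑-≤ segments (λ a _ → len-≤ a) ⟩
          ∑ segments (λ a → main a + ν * Q) ≡⟨ ∑-+ segments main (λ _ → ν * Q) ⟩
          ∑ segments main + ∑ segments (λ _ → ν * Q) ≡⟨ cong₂ _+_ (trans (∑-split 3 22 main) (trans (cong (∑ 3 main +_) (∑-zero 22 (λ _ _ → refl))) (+-identityʳ _))) (∑-const segments (ν * Q)) ⟩
          n * lowBits + b₁ + b₂ + segments * (ν * Q) ≡⟨ cong (n * lowBits + b₁ + b₂ +_) (trans (ring ν Q) (cong (ν *_) (sym K₀-def))) ⟩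
          n * lowBits + b₁ + b₂ + ν * K₀ ∎
          where
          open ≤-Reasoning
          ring : ∀ ν q → 25 * (ν * q) ≡ ν * (25 * q)
          ring = solve-∀

        total-≤ : total ≤ n * lowBits + b₁ + b₂ + ν * K₂ c
        total-≤ = begin
          H₀ + (η * 100 + size) ≤⟨ +-mono-≤ H₀≤ (+-mono-≤ η≤ size-≤) ⟩
          ν * (4 * c + 9) + (ν * ((c + K₀ + 4) * 100) + (M + ν * K₀)) ≡⟨ ring₃ ν (4 * c + 9) ((c + K₀ + 4) * 100) M K₀ ⟩
          M + ν * (K₀ + (4 * c + 9) + (c + K₀ + 4) * 100) ≡⟨ cong (λ z → M + ν * z) (sym (K₂-def c)) ⟩
          M + ν * K₂ c ∎
          where
          open ≤-Reasoning
          M = n * lowBits + b₁ + b₂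
          lift : ∀ a → a ≤ ν * a
          lift a = m≤n*m a ν {{>-nonZero 1≤ν}}
          ring₃ : ∀ ν a b M k → ν * a + (ν * b + (M + ν * k)) ≡ M + ν * (k + a + b)
          ring₃ = solve-∀
          H₀≤ : H₀ ≤ ν * (4 * c + 9)
          H₀≤ = begin
            H₀ ≡⟨ ring₁ k ⟩
            4 * k + 1 ≤⟨ +-monoˡ-≤ 1 (*-monoʳ-≤ 4 k≤) ⟩
            4 * (c + LL + 1) + 1 ≡⟨ ring₂ c LL ⟩
            4 * LL + (4 * c + 5) ≤⟨ +-mono-≤ (*-monoʳ-≤ 4 LL≤ν) (lift (4 * c + 5)) ⟩
            4 * ν + ν * (4 * c + 5) ≡⟨ ring₄ ν c ⟩
            ν * (4 * c + 9) ∎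
            where
            ring₁ : ∀ k → k + 1 + k + k + k ≡ 4 * k + 1
            ring₁ = solve-∀
            ring₂ : ∀ c l → 4 * (c + l + 1) + 1 ≡ 4 * l + (4 * c + 5)
            ring₂ = solve-∀
            ring₄ : ∀ ν c → 4 * ν + ν * (4 * c + 5) ≡ ν * (4 * c + 9)
            ring₄ = solve-∀
          η≤ : η * 100 ≤ ν * ((c + K₀ + 4) * 100)
          η≤ = begin
            η * 100 ≤⟨ *-monoˡ-≤ 100 (m⊓n≤n w Y) ⟩
            (ν + ν + (c + K₀ + 2)) * 100 ≤⟨ *-monoˡ-≤ 100 (+-monoʳ-≤ (ν + ν) (lift (c + K₀ + 2))) ⟩
            (ν + ν + ν * (c + K₀ + 2)) * 100 ≡⟨ trans (cong (_* 100) (ring₅ ν (c + K₀))) (*-assoc ν (c + K₀ + 4) 100) ⟩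
            ν * ((c + K₀ + 4) * 100) ∎
            where
            ring₅ : ∀ ν x → ν + ν + ν * (x + 2) ≡ ν * (x + 4)
            ring₅ = solve-∀

      Result : Set
      Result = Σ (List Bool) λ bs → length bs ≤ n * L + Z + K₂ c * LL
        × RankCorrect w (rankProgram E G K) (length (rankProgram E G K)) n S bs
        × SelectCorrect w (selectProgram E) (length (selectProgram E)) n S bs

      -- Sparse sets: coarse ranks behind a minimal perfect hash function.

      module Sparse (n≤ : n * 16384 ≤ m) where

        private
          half : ∀ {a b} → a * 2 ≤ b * 2 → a ≤ b
          half {a} {b} = *-cancelʳ-≤ a b 2
          -- Both n * 2 ^ 14 and (LL + 1) * 2 ^ 14 are at most m, the latter because m is large;
          -- half of their sum gives the claim. It makes every index linear in ν fit into a word,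
          -- with the factor needed for 2 ^ `bits`.
          sparse : ν * 8192 ≤ m
          sparse = half (begin
            ν * 8192 * 2 ≡⟨ *-assoc ν 8192 2 ⟩
            (n + LL + 1) * 16384 ≡⟨ trans (cong (_* 16384) (+-assoc n LL 1)) (*-distribʳ-+ 16384 n (LL + 1)) ⟩
            n * 16384 + (LL + 1) * 16384 ≤⟨ +-mono-≤ n≤ (half (begin
              (LL + 1) * 16384 * 2 ≡⟨ *-assoc (LL + 1) 16384 2 ⟩
              (LL + 1) * 2 ^ 15 ≤⟨ *-monoˡ-≤ (2 ^ 15) (+-monoˡ-≤ 1 LL≤L) ⟩
              (L + 1) * 2 ^ 15 ≤⟨ L*≤ 1 (s≤s z≤n) ⟩
              2 ^ L ≤⟨ <⇒≤ 2^L<2m ⟩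
              2 * m ≡⟨ *-comm 2 m ⟩
              m * 2 ∎)) ⟩
            m + m ≡⟨ trans (cong (m +_) (sym (+-identityʳ m))) (*-comm 2 m) ⟩
            m * 2 ∎)
            where open ≤-Reasoning

        small : ∀ {x} a → x ≤ ν * a → T (a ≤ᵇ 8192) → x < 2 ^ w
        small a l p = ≤-<-trans (≤-trans l (≤-trans (*-monoʳ-≤ ν (≤ᵇ⇒≤ a 8192 p)) sparse)) m<2^w

        bits : ℕ
        bits = 8 * g + 4

        2^bits≤ : 2 ^ bits ≤ ν * 8192
        2^bits≤ = ≤-trans (≤-reflexive (2^-+ (8 * g) 4)) (≤-trans (*-monoˡ-≤ 16 2^8g≤) (≤-reflexive (*-assoc ν 512 16)))

        bits≤w : bits ≤ w
        bits≤w = <⇒≤ (2^-cancel-< (≤-<-trans (≤-trans 2^bits≤ sparse) m<2^w))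

        below-bits : ∀ {x} → x ≤ ν * 11 → x < 2 ^ bits
        below-bits {x} l = begin-strict
          x ≤⟨ l ⟩
          ν * 11 <⟨ *-monoʳ-< ν {{>-nonZero 1≤ν}} (<ᵇ⇒< 11 16 tt) ⟩
          ν * 16 ≤⟨ *-monoˡ-≤ 16 ν≤2^8g ⟩
          2 ^ (8 * g) * 16 ≡⟨ sym (2^-+ (8 * g) 4) ⟩
          2 ^ bits ∎
          where open ≤-Reasoning

        opaque
          -- One reduction is not enough: d₁ is bounded by n² L + 2, and L may be as large as 2 ^
          -- LL, exponential in ν. But d₁ ≤ 2 ^ (2 ν), so keys now have 2 ν bits and a second
          -- reduction brings them below 4 ν³.
          first : ∃ λ d → suc d ≤ m × suc d ≤ n * (n * L) + 2 × InjectiveOn n (λ i → X i % suc d)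
          first = mod-injective-≤ n L m X X-inj 1≤m X<m m≤2^L

        d₁ : ℕ
        d₁ = suc (proj₁ first)

        private
          d₁≤m : d₁ ≤ m
          d₁≤m = proj₁ (proj₂ first)

        d₁≤2^ : d₁ ≤ 2 ^ (ν + ν)
        d₁≤2^ = begin
          d₁ ≤⟨ proj₁ (proj₂ (proj₂ first)) ⟩
          n * (n * L) + 2 ≤⟨ +-mono-≤ (*-mono-≤ (<⇒≤ (n<2^n n)) (*-mono-≤ (<⇒≤ (n<2^n n)) L≤2^LL)) (m≤m+n 2 0) ⟩
          2 ^ n * (2 ^ n * 2 ^ LL) + 2 ≡⟨ cong (_+ 2) (trans (cong (2 ^ n *_) (sym (2^-+ n LL))) (sym (2^-+ n (n + LL)))) ⟩
          2 ^ x + 2 ^ 1 ≤⟨ +-mono-≤ (2^-≤ {x} {suc x} (n≤1+n x)) (2^-≤ {1} {suc x} (s≤s z≤n)) ⟩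
          2 ^ suc x + 2 ^ suc x ≡⟨ 2*2^ (suc x) ⟩
          2 ^ suc (suc x) ≤⟨ 2^-≤ (≤-trans (≤-reflexive (ring n LL)) (+-monoˡ-≤ ν (+-monoˡ-≤ 1 (m≤m+n n LL)))) ⟩
          2 ^ (ν + ν) ∎
          where
          open ≤-Reasoning
          x = n + (n + LL)
          ring : ∀ n l → suc (suc (n + (n + l))) ≡ n + 1 + (n + l + 1)
          ring = solve-∀

        opaque
          second : ∃ λ d → suc d ≤ d₁ × suc d ≤ n * (n * (ν + ν)) + 2 × InjectiveOn n (λ i → X i % d₁ % suc d)
          second = mod-injective-≤ n (ν + ν) d₁ (λ i → X i % d₁) (proj₂ (proj₂ (proj₂ first))) (s≤s z≤n) (λ i _ → m%n<n (X i) d₁) d₁≤2^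

        d₂ : ℕ
        d₂ = suc (proj₁ second)

        key : ℕ → ℕ
        key i = X i % d₁ % d₂

        β : ℕ
        β = 2 ^ (2 * g)

        instance
          β≢0 : NonZero β
          β≢0 = m^n≢0 2 (2 * g)

        private
          d₂≤ : d₂ ≤ β ^ digits
          d₂≤ = begin
            d₂ ≤⟨ proj₁ (proj₂ (proj₂ second)) ⟩
            n * (n * (ν + ν)) + 2 ≤⟨ +-mono-≤ (*-mono-≤ n≤ν (*-monoˡ-≤ (ν + ν) n≤ν)) (*-monoʳ-≤ 2 (*-mono-≤ 1≤ν (*-mono-≤ 1≤ν 1≤ν))) ⟩
            ν * (ν * (ν + ν)) + 2 * (ν * (ν * ν)) ≡⟨ ring ν ⟩
            4 * (ν * (ν * ν)) ≤⟨ *-monoʳ-≤ 4 (*-mono-≤ ν≤2^8g (*-mono-≤ ν≤2^8g ν≤2^8g)) ⟩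
            4 * (2 ^ (8 * g) * (2 ^ (8 * g) * 2 ^ (8 * g))) ≡⟨ cong (4 *_) (trans (cong (2 ^ (8 * g) *_) (sym (2^-+ (8 * g) (8 * g)))) (sym (2^-+ (8 * g) (8 * g + 8 * g)))) ⟩
            2 ^ 2 * 2 ^ (8 * g + (8 * g + 8 * g)) ≡⟨ sym (2^-+ 2 (8 * g + (8 * g + 8 * g))) ⟩
            2 ^ (2 + (8 * g + (8 * g + 8 * g))) ≤⟨ 2^-≤ (≤-trans (+-monoˡ-≤ _ (*-monoʳ-≤ 2 1≤g)) (≤-reflexive (ring′ g))) ⟩
            2 ^ (2 * g * 13) ≡⟨ sym (^-*-assoc 2 (2 * g) 13) ⟩
            β ^ digits ∎
            where
            open ≤-Reasoning
            ring : ∀ ν → ν * (ν * (ν + ν)) + 2 * (ν * (ν * ν)) ≡ 4 * (ν * (ν * ν))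
            ring = solve-∀
            ring′ : ∀ g → 2 * g + (8 * g + (8 * g + 8 * g)) ≡ 2 * g * 13
            ring′ = solve-∀

        ρ : ℕ
        ρ = lg n

        2^ρ≤ : 2 ^ ρ ≤ ν * 2
        2^ρ≤ = ≤-trans (2^-≤ (lg-mono n≤ν)) (≤-trans (<⇒≤ (lg-< 1≤ν)) (≤-reflexive (*-comm 2 ν)))

        module PH = PerfectHash β digits n ρ key (proj₂ (proj₂ (proj₂ second))) (λ i _ → <-≤-trans (m%n<n (X i % d₁) d₂) d₂≤) (lg-≥ n)
        module CP = Compress n PH.position PH.position-injective
        module Tab = Tabulation β

        row : ℕ
        row = digits * β

        instance
          row≢0 : NonZero row
          row≢0 = m*n≢0 digits β
          d₁≢0 : NonZero d₁
          d₁≢0 = _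
          d₂≢0 : NonZero d₂
          d₂≢0 = _
          2^ρ≢0 : NonZero (2 ^ ρ)
          2^ρ≢0 = m^n≢0 2 ρ

        -- The top-level table comes first, so that a single base address serves both levels and
        -- seed t refers to row t + 1.
        table : ℕ → ℕ → ℕ
        table zero = PH.topTable
        table (suc t) = PH.table t

        private
          table< : ∀ t e → table t e < 2 ^ PH.τ
          table< zero = PH.topTable<
          table< (suc t) = PH.table< t

        flat : ℕ → ℕ
        flat i = table (i / row) (i % row)

        private
          flat-at : ∀ t e → e < row → flat (t * row + e) ≡ table t e
          flat-at t e e< = cong₂ table
            (trans (+-distrib-/-∣ˡ {t * row} e (divides t refl)) (trans (cong₂ _+_ (m*n/n≡m t row) (m<n⇒m/n≡0 e<)) (+-identityʳ t)))
            (trans (cong (_% row) (+-comm (t * row) e)) (trans ([m+kn]%n≡m%n e t row) (m<n⇒m%n≡m e<)))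

        entries : ℕ
        entries = (ρ + 2) * row

        private
          ρ+2≤ : ρ + 2 ≤ 10 * g
          ρ+2≤ = ≤-trans (+-mono-≤ (lg-≤ {n} {8 * g} (≤-trans n≤ν ν≤2^8g)) (1≤g′ 2)) (≤-reflexive (sym (*-distribʳ-+ g 8 2)))

          τ≤w : PH.τ ≤ w
          τ≤w = <⇒≤ (2^-cancel-< (small 8 (≤-trans (≤-reflexive (2^-+ ρ 2)) (≤-trans (*-monoˡ-≤ 4 2^ρ≤) (≤-reflexive (*-assoc ν 2 4)))) tt))

          row≤ : row ≤ entries
          row≤ = m≤n*m row (ρ + 2) {{>-nonZero (≤-trans (s≤s z≤n) (m≤n+m 2 ρ))}}

          entries< : entries < 2 ^ w
          entries< = begin-strict
            (ρ + 2) * (13 * β) ≤⟨ *-monoˡ-≤ (13 * β) (≤-trans ρ+2≤ (*-monoʳ-≤ 10 (<⇒≤ (n<2^n g)))) ⟩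
            10 * 2 ^ g * (13 * β) ≡⟨ ring 10 13 (2 ^ g) β ⟩
            2 ^ g * β * 130 <⟨ *-monoʳ-< (2 ^ g * β) {{m*n≢0 (2 ^ g) β {{m^n≢0 2 g}}}} (<ᵇ⇒< 130 256 tt) ⟩
            2 ^ g * β * 256 ≡⟨ cong (_* 256) (sym (2^-+ g (2 * g))) ⟩
            2 ^ (g + 2 * g) * 2 ^ 8 ≡⟨ sym (2^-+ (g + 2 * g) 8) ⟩
            2 ^ (g + 2 * g + 8) ≤⟨ 2^-≤ (≤-trans (≤-trans (+-monoʳ-≤ (g + 2 * g) (≤-trans (≤-reflexive refl) (+-monoˡ-≤ 4 (1≤g′ 4)))) (≤-trans (≤-reflexive (ring′ g)) (+-monoˡ-≤ 4 (*-monoˡ-≤ g (≤ᵇ⇒≤ 7 8 tt))))) bits≤w) ⟩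
            2 ^ w ∎
            where
            open ≤-Reasoning
            ring : ∀ x y a b → x * a * (y * b) ≡ a * b * (x * y)
            ring = solve-∀
            ring′ : ∀ g → g + 2 * g + (4 * g + 4) ≡ 7 * g + 4
            ring′ = solve-∀

        private
          flat< : ∀ i → i < entries → flat i < 2 ^ PH.τ
          flat< i _ = table< (i / row) (i % row)

        hashSegment : Segment w
        hashSegment = arraySegment PH.τ entries flat τ≤w flat<

        private
          hash-≤ : Segment.len hashSegment ≤ ν * Q
          hash-≤ = ν*≤Q 665600 (begin
            (ρ + 2) * row * (ρ + 2) ≤⟨ *-mono-≤ (*-monoˡ-≤ row r≤) r≤ ⟩
            10 * 2 ^ g * (13 * β) * (10 * 2 ^ g) ≡⟨ ring 10 13 10 (2 ^ g) β ⟩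
            2 ^ g * 2 ^ g * β * 1300 ≡⟨ cong (_* 1300) (trans (cong (_* β) (sym (2^-+ g g))) (trans (sym (2^-+ (g + g) (2 * g))) (cong (2 ^_) (ring′ g)))) ⟩
            2 ^ (4 * g) * 1300 ≤⟨ *-monoˡ-≤ 1300 2^4g≤ ⟩
            ν * 512 * 1300 ≡⟨ *-assoc ν 512 1300 ⟩
            ν * 665600 ∎) tt
            where
            open ≤-Reasoning
            r≤ : ρ + 2 ≤ 10 * 2 ^ g
            r≤ = ≤-trans ρ+2≤ (*-monoʳ-≤ 10 (<⇒≤ (n<2^n g)))
            ring : ∀ x y z a b → x * a * (y * b) * (z * a) ≡ a * a * b * (x * y * z)
            ring = solve-∀
            ring′ : ∀ g → g + g + 2 * g ≡ 4 * g
            ring′ = solve-∀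

        slots : ℕ
        slots = 8 * n + 2 ^ ρ

        private
          slots≤ : slots ≤ ν * 10
          slots≤ = ≤-trans (+-mono-≤ (*-monoʳ-≤ 8 n≤ν) 2^ρ≤) (≤-reflexive (ring ν))
            where
            ring : ∀ ν → 8 * ν + ν * 2 ≡ ν * 10
            ring = solve-∀
          10≤11 : ∀ {x} → x ≤ ν * 10 → x ≤ ν * 11
          10≤11 l = ≤-trans l (*-monoʳ-≤ ν (n≤1+n 10))
          2^ρ≤11 : 2 ^ ρ ≤ ν * 11
          2^ρ≤11 = ≤-trans 2^ρ≤ (*-monoʳ-≤ ν (≤ᵇ⇒≤ 2 11 tt))

        -- One more than the number of buckets, since the sequences are also read at the successor
        -- of the last bucket.
        buckets : ℕ
        buckets = 2 ^ ρ + 1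

        private
          buckets≤ : buckets ≤ ν * 11
          buckets≤ = ≤-trans (+-mono-≤ 2^ρ≤ 1≤ν) (≤-trans (≤-reflexive (trans (+-comm (ν * 2) ν) (sym (*-suc ν 2)))) (*-monoʳ-≤ ν (≤ᵇ⇒≤ 3 11 tt)))

          at-most : ∀ {i} → i < buckets → i ≤ 2 ^ ρ
          at-most {i} l = s≤s⁻¹ (subst (i <_) (+-comm (2 ^ ρ) 1) l)

          start-mono : ∀ {i j} → i ≤ j → j < buckets → PH.start i ≤ PH.start j
          start-mono l _ = ∑-mono _ l
          start≤ : ∀ i → i < buckets → PH.start i ≤ slots
          start≤ i i< = ≤-trans (∑-mono _ (at-most i<)) PH.∑-range

        seeds : ℕ → ℕ
        seeds k = ∑ k PH.seed

        private
          seeds-mono : ∀ {i j} → i ≤ j → j < buckets → seeds i ≤ seeds j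
          seeds-mono l _ = ∑-mono _ l
          seeds≤ : ∀ i → i < buckets → seeds i ≤ 2 ^ ρ
          seeds≤ i i< = ≤-trans (∑-mono _ (at-most i<)) PH.∑-seed
          before-mono : ∀ {i j} → i ≤ j → j < slots → CP.before i ≤ CP.before j
          before-mono l _ = CP.before-mono l
          before≤ : ∀ i → i < slots → CP.before i ≤ n
          before≤ i _ = CP.before-≤ i
          start-U : slots < 2 ^ bits
          start-U = below-bits (10≤11 slots≤)
          seeds-U : 2 ^ ρ < 2 ^ bits
          seeds-U = below-bits 2^ρ≤11
          before-U : n < 2 ^ bits
          before-U = below-bits n≤11ν
          buckets< : buckets < 2 ^ w
          buckets< = small 11 buckets≤ tt
          slots< : slots < 2 ^ w
          slots< = small 10 slots≤ tt

        startCode : Code w g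
        startCode = record { N = buckets ; U = slots ; β = bits ; v = PH.start ; v-mono = start-mono ; v≤ = start≤ ; U<2^β = start-U ; β≤w = bits≤w ; 3g≤w = 3g≤w 32≤w ; N<2^w = buckets< }
        seedCode : Code w g
        seedCode = record { N = buckets ; U = 2 ^ ρ ; β = bits ; v = seeds ; v-mono = seeds-mono ; v≤ = seeds≤ ; U<2^β = seeds-U ; β≤w = bits≤w ; 3g≤w = 3g≤w 32≤w ; N<2^w = buckets< }
        rankCode : Code w g
        rankCode = record { N = slots ; U = n ; β = bits ; v = CP.before ; v-mono = before-mono ; v≤ = before≤ ; U<2^β = before-U ; β≤w = bits≤w ; 3g≤w = 3g≤w 32≤w ; N<2^w = slots< }

        -- For n below about 2 ^ K the subtraction truncates to 0: the array of coarse ranks is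
        -- empty and every candidate is 0, which the scan then covers.
        γ : ℕ
        γ = (ℓ + 1) ∸ K

        coarse : ℕ → ℕ
        coarse i = CP.inverse n i ÷ K

        private
          coarse< : ∀ i → i < n → coarse i < 2 ^ γ
          coarse< i _ = ÷-∸-< (CP.inverse n i) (ℓ + 1) K (≤-<-trans (CP.inverse-≤ n i) (subst (λ z → n < 2 ^ z) (+-comm 1 ℓ) n<2^ℓ+1))

          γ≤w : γ ≤ w
          γ≤w = ≤-trans (m∸n≤m (ℓ + 1) K) (subst (_≤ w) (+-comm 1 ℓ) ℓ<w)

        coarseSegment : Segment w
        coarseSegment = arraySegment γ n coarse γ≤w coarse<

        ranks : ℕ → Segment w
        ranks 0 = Code.baseSegment rankCode
        ranks 1 = Code.widthSegment rankCode
        ranks 2 = Code.ptrSegment rankCode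
        ranks 3 = Code.patSegment rankCode
        ranks 4 = Code.lowSegment rankCode
        ranks _ = emptySegment

        other : ℕ → Segment w
        other 1 = coarseSegment
        other 4 = hashSegment
        other 10 = Code.baseSegment startCode
        other 11 = Code.widthSegment startCode
        other 12 = Code.ptrSegment startCode
        other 13 = Code.patSegment startCode
        other 14 = Code.lowSegment startCode
        other 15 = Code.baseSegment seedCode
        other 16 = Code.widthSegment seedCode
        other 17 = Code.ptrSegment seedCode
        other 18 = Code.patSegment seedCode
        other 19 = Code.lowSegment seedCode
        other (suc (suc (suc (suc (suc (suc (suc (suc (suc (suc (suc (suc (suc (suc (suc (suc (suc (suc (suc (suc a)))))))))))))))))))) = ranks a
        other _ = emptySegment

        sc : ℕ → ℕ
        sc 2 = d₁
        sc 3 = d₂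
        sc 4 = β
        sc 5 = 2 ^ ρ
        sc 6 = row
        sc _ = 0

        private
          ranks-≤ : ∀ a → Segment.len (ranks a) ≤ ν * Q
          ranks-≤ 0 = blocks-≤ {slots} {bits} (10≤11 slots≤) 8g+4≤12g
          ranks-≤ 1 = blocks-≤ {slots} {bits} (10≤11 slots≤) 8g+4≤12g
          ranks-≤ 2 = blocks-≤ {slots} {bits} (10≤11 slots≤) 8g+4≤12g
          ranks-≤ 3 = blocks-≤ {slots} {2 * g} (10≤11 slots≤) 2g≤12g
          ranks-≤ 4 = low-≤ (Code.low-len rankCode) n≤11ν
          ranks-≤ (suc (suc (suc (suc (suc a))))) = z≤n

          other-≤ : ∀ a → 3 ≤ a → Segment.len (other a) ≤ ν * Q
          other-≤ 1 (s≤s ())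
          other-≤ 2 (s≤s (s≤s ()))
          other-≤ 3 _ = z≤n
          other-≤ 4 _ = hash-≤
          other-≤ 5 _ = z≤n
          other-≤ 6 _ = z≤n
          other-≤ 7 _ = z≤n
          other-≤ 8 _ = z≤n
          other-≤ 9 _ = z≤n
          other-≤ 10 _ = blocks-≤ {buckets} {bits} buckets≤ 8g+4≤12g
          other-≤ 11 _ = blocks-≤ {buckets} {bits} buckets≤ 8g+4≤12g
          other-≤ 12 _ = blocks-≤ {buckets} {bits} buckets≤ 8g+4≤12g
          other-≤ 13 _ = blocks-≤ {buckets} {2 * g} buckets≤ 2g≤12g
          other-≤ 14 _ = low-≤ (Code.low-len startCode) (10≤11 slots≤)
          other-≤ 15 _ = blocks-≤ {buckets} {bits} buckets≤ 8g+4≤12g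
          other-≤ 16 _ = blocks-≤ {buckets} {bits} buckets≤ 8g+4≤12g
          other-≤ 17 _ = blocks-≤ {buckets} {bits} buckets≤ 8g+4≤12g
          other-≤ 18 _ = blocks-≤ {buckets} {2 * g} buckets≤ 2g≤12g
          other-≤ 19 _ = low-≤ (Code.low-len seedCode) 2^ρ≤11
          other-≤ (suc (suc (suc (suc (suc (suc (suc (suc (suc (suc (suc (suc (suc (suc (suc (suc (suc (suc (suc (suc a)))))))))))))))))))) _ = ranks-≤ a

        open Size other sc (n * γ) 0 ≤-refl z≤n other-≤ public

        private
          2ν≤Y : ν + ν < Y
          2ν≤Y = subst (_< Y) (+-identityʳ (ν + ν)) (+-monoʳ-< (ν + ν) (≤-trans (s≤s z≤n) (m≤n+m 2 (c + K₀))))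

          sc<w : ∀ a → sc a < 2 ^ w
          sc<w 2 = ≤-<-trans d₁≤m m<2^w
          sc<w 3 = ≤-<-trans (≤-trans (proj₁ (proj₂ second)) d₁≤m) m<2^w
          sc<w 4 = ≤-<-trans (≤-trans (m≤n*m β digits) row≤) entries<
          sc<w 5 = small 11 2^ρ≤11 tt
          sc<w 6 = ≤-<-trans row≤ entries<
          sc<w 0 = m^n>0 2 w
          sc<w 1 = m^n>0 2 w
          sc<w (suc (suc (suc (suc (suc (suc (suc _))))))) = m^n>0 2 w

          13-bits : ∀ x → 13 * x ≤ 2 ^ 4 * x
          13-bits x = *-monoˡ-≤ x (≤ᵇ⇒≤ 13 16 tt)

          ν*<2^Y : ∀ {x} → x ≤ ν * 8192 → x < 2 ^ Y
          ν*<2^Y {x} l = ≤-<-trans l (begin-strict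
            ν * 8192 <⟨ *-monoˡ-< 8192 (n<2^n ν) ⟩
            2 ^ ν * 2 ^ 13 ≡⟨ sym (2^-+ ν 13) ⟩
            2 ^ (ν + 13) ≤⟨ 2^-≤ (≤-trans (+-mono-≤ (m≤m+n ν ν) (≤-trans 13≤K₀ (≤-trans (m≤n+m K₀ c) (m≤m+n (c + K₀) 2)))) ≤-refl) ⟩
            2 ^ Y ∎)
            where
            open ≤-Reasoning
            13≤K₀ : 13 ≤ K₀
            13≤K₀ = ≤-trans (const≤Q 13 tt) (≤-trans (m≤n*m Q 25) (≤-reflexive (sym K₀-def)))

          row-small : row ≤ ν * 8192
          row-small = ≤-trans (13-bits β) (≤-trans (*-monoʳ-≤ 16 (2^-≤ (*-monoˡ-≤ g (≤ᵇ⇒≤ 2 8 tt)))) (≤-trans (*-monoʳ-≤ 16 2^8g≤) (≤-reflexive (ring ν))))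
            where
            ring : ∀ ν → 16 * (ν * 512) ≡ ν * 8192
            ring ν = trans (*-comm 16 (ν * 512)) (*-assoc ν 512 16)

          sc<Y : ∀ a → sc a < 2 ^ Y
          sc<Y 2 = ≤-<-trans d₁≤2^ (^-monoʳ-< 2 (s≤s (s≤s z≤n)) 2ν≤Y)
          sc<Y 3 = ≤-<-trans (≤-trans (proj₁ (proj₂ second)) d₁≤2^) (^-monoʳ-< 2 (s≤s (s≤s z≤n)) 2ν≤Y)
          sc<Y 4 = ν*<2^Y (≤-trans (m≤n*m β digits) row-small)
          sc<Y 5 = ν*<2^Y (≤-trans 2^ρ≤11 (*-monoʳ-≤ ν (≤ᵇ⇒≤ 11 8192 tt)))
          sc<Y 6 = ν*<2^Y row-small
          sc<Y 0 = m^n>0 2 Y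
          sc<Y 1 = m^n>0 2 Y
          sc<Y (suc (suc (suc (suc (suc (suc (suc _))))))) = m^n>0 2 Y

          main≤ : n * lowBits + n * γ + 0 ≤ n * L
          main≤ = ≤-trans (≤-reflexive (trans (+-identityʳ _) (sym (*-distribˡ-+ n lowBits γ)))) (*-monoʳ-≤ n (≤-trans (+-monoʳ-≤ lowBits (≤-trans (∸-monoʳ-≤ (ℓ + 1) (≤-trans (m≤n+m 1 (K₂ c)) K₂<K)) (≤-reflexive (m+n∸n≡m ℓ 1)))) (≤-reflexive lowBits+ℓ)))

        private
          k₂ : ℕ
          k₂ = K₂ c
          -- If the coarse ranks are empty, n is bounded by a constant.
          payload : n * lowBits + n * γ + n * k₂ ≤ n * L + k₂ * 2 ^ K
          payload with K ≤? ℓ + 1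
          ... | yes l = ≤-trans (≤-trans (≤-reflexive (ring n lowBits γ k₂)) (*-monoʳ-≤ n fit)) (m≤m+n _ _)
            where
            ring : ∀ n a b c → n * a + n * b + n * c ≡ n * (a + (b + c))
            ring = solve-∀
            fit : lowBits + (γ + k₂) ≤ L
            fit = ≤-trans (+-monoʳ-≤ lowBits (s≤s⁻¹ (≤-trans (≤-reflexive (trans (sym (+-suc γ k₂)) (cong (γ +_) (+-comm 1 k₂)))) (≤-trans (+-monoʳ-≤ γ K₂<K) (≤-trans (≤-reflexive (m∸n+n≡m l)) (≤-reflexive (+-comm ℓ 1))))))) (≤-reflexive lowBits+ℓ)
          ... | no ¬l = +-mono-≤ (≤-trans (+-mono-≤ (*-monoʳ-≤ n (m∸n≤m L ℓ)) (≤-reflexive (trans (cong (n *_) (m≤n⇒m∸n≡0 (<⇒≤ (≰⇒> ¬l)))) (*-zeroʳ n)))) (≤-reflexive (+-identityʳ _)))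
              (≤-trans (≤-reflexive (*-comm n k₂)) (*-monoʳ-≤ k₂ (≤-trans (<⇒≤ n<2^ℓ+1) (2^-≤ (≤-trans (≤-reflexive (+-comm 1 ℓ)) (<⇒≤ (≰⇒> ¬l)))))))
          total≤ : total ≤ n * L + Z₁ + k₂ * LL
          total≤ = begin
            total ≤⟨ total-≤ ⟩
            n * lowBits + n * γ + 0 + (n + LL + 1) * k₂ ≡⟨ ring (n * lowBits) (n * γ) n LL k₂ ⟩
            (n * lowBits + n * γ + n * k₂) + (k₂ + k₂ * LL) ≤⟨ +-monoˡ-≤ (k₂ + k₂ * LL) payload ⟩
            (n * L + k₂ * 2 ^ K) + (k₂ + k₂ * LL) ≡⟨ ring′ (n * L) (k₂ * 2 ^ K) k₂ (k₂ * LL) ⟩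
            n * L + (k₂ + k₂ * 2 ^ K) + k₂ * LL ≡⟨ cong (λ z → n * L + z + k₂ * LL) (sym Z₁-def) ⟩
            n * L + Z₁ + k₂ * LL ∎
            where
            open ≤-Reasoning
            ring : ∀ a b n l k → a + b + 0 + (n + l + 1) * k ≡ (a + b + n * k) + (k + k * l)
            ring = solve-∀
            ring′ : ∀ a b c d → (a + b) + (c + d) ≡ a + (c + b) + d
            ring′ = solve-∀
          total< : total < w * m
          -- After doubling, n * 2 ≤ m charges the payload to one half of 2 * (w * m), and the
          -- constants, below 2 ^ E ≤ m, are charged to the other half.
          total< = *-cancelˡ-< 2 total (w * m) (begin-strict
            2 * total ≤⟨ *-monoʳ-≤ 2 total≤ ⟩
            2 * (n * L + Z₁ + k₂ * LL) ≡⟨ ring (n) L Z₁ (k₂ * LL) ⟩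
            L * (n * 2) + (2 * Z₁ + 2 * (k₂ * LL)) ≤⟨ +-mono-≤ (*-mono-≤ L≤w (≤-trans (*-monoʳ-≤ n (≤ᵇ⇒≤ 2 16384 tt)) n≤))
                (+-mono-≤ (m≤n*m (2 * Z₁) w) (≤-trans (*-monoʳ-≤ 2 (*-monoʳ-≤ k₂ (≤-trans LL≤L L≤w))) (≤-reflexive (ring″ k₂ w)))) ⟩
            w * m + (w * (2 * Z₁) + w * (2 * k₂)) ≡⟨ cong (w * m +_) (sym (*-distribˡ-+ w (2 * Z₁) (2 * k₂))) ⟩
            w * m + w * (2 * Z₁ + 2 * k₂) <⟨ +-monoʳ-< (w * m) (*-monoʳ-< w (≤-<-trans Z₁≤E (<-≤-trans (n<2^n E) 2^E≤m))) ⟩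
            w * m + w * m ≡⟨ cong (w * m +_) (sym (+-identityʳ (w * m))) ⟩
            2 * (w * m) ∎)
            where
            open ≤-Reasoning
            ring : ∀ n l z x → 2 * (n * l + z + x) ≡ l * (n * 2) + (2 * z + 2 * x)
            ring = solve-∀
            ring″ : ∀ k w → 2 * (k * w) ≡ w * (2 * k)
            ring″ = solve-∀

        module Co = Correct sc<w sc<Y (≤-trans size-≤ (+-monoˡ-≤ (ν * K₀) main≤)) total<
        open Co

        private
          hash-arr : Layout.Array image 4 entries flat
          hash-arr = Loaded.array-at loaded 4 τ≤w flat< (m≤m+n 5 20) (<⇒≤ entries<) refl

          s-mono : Layout.Mono image 10 buckets PH.start
          s-mono = Code.mono-at startCode loaded 10 (m≤m+n 15 10) refl refl refl refl refl refl refl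
          a-mono : Layout.Mono image 15 buckets seeds
          a-mono = Code.mono-at seedCode loaded 15 (m≤m+n 20 5) refl refl refl refl refl refl refl
          R-mono : Layout.Mono image 20 slots CP.before
          R-mono = Code.mono-at rankCode loaded 20 (m≤m+n 25 0) refl refl refl refl refl refl refl
          C-arr : Layout.Array image 1 n coarse
          C-arr = Loaded.array-at loaded 1 γ≤w coarse< (m≤m+n 2 23) (<⇒≤ n<2^w) refl

        private
          value-at : ℕ → ℕ → ℕ
          value-at = Query.Candidate.value-at image hash-arr entries< {{β≢0}}

          value-is : ∀ t y → value-at (t * row) y ≡ Tab.hash digits (table t) y
          value-is t y = trans (Query.Candidate.value-at-def image hash-arr entries< {{β≢0}} (t * row) y) (∑-cong digits (λ j j< → flat-at t (j * β + Tab.digit j y)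
            (<-≤-trans (+-monoʳ-< (j * β) (Tab.digit-< j y)) (≤-trans (≤-reflexive (+-comm (j * β) β)) (*-monoˡ-≤ β j<)))))

          value-< : ∀ t y → value-at (t * row) y < 2 ^ w
          value-< t y = small 104 (begin
            value-at (t * row) y ≡⟨ value-is t y ⟩
            Tab.hash digits (table t) y ≤⟨ ∑-≤ digits (λ j _ → <⇒≤ (table< t (j * β + Tab.digit j y))) ⟩
            ∑ digits (λ _ → 2 ^ PH.τ) ≡⟨ ∑-const digits (2 ^ PH.τ) ⟩
            13 * 2 ^ PH.τ ≡⟨ cong (13 *_) (2^-+ ρ 2) ⟩
            13 * (2 ^ ρ * 4) ≤⟨ *-monoʳ-≤ 13 (*-monoˡ-≤ 4 2^ρ≤) ⟩
            13 * (ν * 2 * 4) ≡⟨ ring ν ⟩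
            ν * 104 ∎) tt
            where
            open ≤-Reasoning
            ring : ∀ ν → 13 * (ν * 2 * 4) ≡ ν * 104
            ring = solve-∀

        rank-ok : ∀ G r → r < n → Machine.eval w μ (rankE G K) (w ∷ η ∷ H₀ ∷ X r ∷ n ∷ []) ≡ suc r
        rank-ok G r r< = Query.Select.rankE-sparse image highs lows X-split X<2^w X-inj n<2^w G K (X r) r (r ÷ K * 2 ^ K) r< refl
            (Query.Candidate.candidateE-spec image hash-arr entries< {{β≢0}} s-mono a-mono R-mono C-arr {{d₁≢0}} {{d₂≢0}} {{2^ρ≢0}} {{row≢0}} K (X r) {y} {v₀} {bk} {seeds bk} {seeds (suc bk)} {PH.start bk} {PH.start (suc bk)}
              {suc (PH.seed bk) * row} {v₁} {PH.position r} {CP.index r} {r ÷ K}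
              (<-trans (X<m r r<) m<2^w) K<2^w refl row≤ (value-is 0 y) (subst (_< 2 ^ w) (value-is 0 y) (value-< 0 y)) refl
              (subst (_< buckets) (sym bk+1) sk<) refl (cong seeds bk+1) (m≤m+n (seeds bk) (PH.seed bk)) refl (cong PH.start bk+1) start<
              idx-eq idx≤ (value-is (suc (PH.seed bk)) y) (subst (_< 2 ^ w) (value-is (suc (PH.seed bk)) y) (value-< (suc (PH.seed bk)) y))
              pos-eq pos< refl (CP.index-< r r<) (cong (_÷ K) (CP.inverse-index r r<)) (≤-<-trans c≤ (<-trans r< n<2^w)))
            c≤ r<c
          where
          y v₀ bk v₁ : ℕ
          y = key r
          v₀ = Tab.hash digits PH.topTable y
          bk = PH.bucket r
          v₁ = Tab.hash digits (PH.table (PH.seed bk)) y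
          bk< : bk < 2 ^ ρ
          bk< = PH.bucket< r
          bk+1 : bk + 1 ≡ suc bk
          bk+1 = +-comm bk 1
          sk< : suc bk < buckets
          sk< = subst (suc bk <_) (+-comm 1 (2 ^ ρ)) (s≤s bk<)
          start< : PH.start bk < PH.start (suc bk)
          start< = subst (_< PH.start (suc bk)) (+-identityʳ (PH.start bk)) (+-monoʳ-< (PH.start bk) (m^n>0 2 (PH.κ bk)))
          idx-eq : (seeds (suc bk) ∸ seeds bk + 1) * row ≡ suc (PH.seed bk) * row
          idx-eq = cong (_* row) (trans (+-comm (seeds (suc bk) ∸ seeds bk) 1) (cong suc (m+n∸m≡n (seeds bk) (PH.seed bk))))
          idx≤ : suc (PH.seed bk) * row + row ≤ entries
          idx≤ = ≤-trans (≤-reflexive (+-comm (suc (PH.seed bk) * row) row)) (*-monoˡ-≤ row (≤-trans (s≤s (s≤s (PH.seed≤ bk bk<))) (≤-reflexive (+-comm 2 ρ))))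
          pos-eq : PH.start bk + residue v₁ (PH.start (suc bk) ∸ PH.start bk) ≡ PH.position r
          pos-eq = cong (PH.start bk +_) (trans (cong (residue v₁) (m+n∸m≡n (PH.start bk) (2 ^ PH.κ bk))) (sym (residue-% v₁ (2 ^ PH.κ bk) {{m^n≢0 2 (PH.κ bk)}})))
          pos< : PH.position r < slots
          pos< = <-≤-trans (PH.position< r) (start≤ (suc bk) sk<)
          c≤ : r ÷ K * 2 ^ K ≤ r
          c≤ = m/n*n≤m r (2 ^ K) {{m^n≢0 2 K}}
          r<c : r < r ÷ K * 2 ^ K + 2 ^ K
          r<c = subst₂ _<_ (trans (cong (wrap K r +_) (*-comm (r ÷ K) (2 ^ K))) (sym (÷-split r K))) (+-comm (2 ^ K) _) (+-monoˡ-< (r ÷ K * 2 ^ K) (wrap-< K r))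

        module R = Run (rank-ok G)

        sparse-result : Result
        sparse-result = bs , ≤-trans (≤-reflexive (length-bitsOf total V)) (≤-trans total≤ (+-monoˡ-≤ (K₂ c * LL) (+-monoʳ-≤ (n * L) Z₁≤Z)))
          , R.rank-correct , R.select-correct

      -- Dense sets: sampled ranks.

      module Dense (m< : m < n * 16384) where

        samples : ℕ
        samples = m ÷ G + 1

        sample : ℕ → ℕ
        sample j = lower X n (j * 2 ^ G)

        private
          sample< : ∀ j → j < samples → sample j < 2 ^ lg (1 + m)
          sample< j _ = ≤-<-trans (≤-trans (lower-≤ X n (j * 2 ^ G)) n≤m) (lg-≥ (1 + m))

        sampleSegment : Segment w
        sampleSegment = arraySegment (lg (1 + m)) samples sample w≥ sample<

        other : ℕ → Segment w
        other 2 = sampleSegment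
        other _ = emptySegment

        private
          other-≤ : ∀ a → 3 ≤ a → Segment.len (other a) ≤ ν * Q
          other-≤ (suc (suc (suc a))) _ = z≤n
          other-≤ 1 (s≤s ())
          other-≤ 2 (s≤s (s≤s ()))

        open Size other (λ _ → 0) 0 (samples * lg (1 + m)) z≤n ≤-refl other-≤ public

        private
          k₂ : ℕ
          k₂ = K₂ c
          2^L< : 2 ^ L < n * 2 ^ 15
          2^L< = <-trans 2^L<2m (<-≤-trans (*-monoʳ-< 2 m<) (≤-reflexive (trans (*-comm 2 (n * 16384)) (*-assoc n 16384 2))))
          L+8<n : L + 8 < n
          L+8<n = *-cancelʳ-< (2 ^ 15) (L + 8) n (≤-<-trans (L*≤ 8 ≤-refl) 2^L<)
          8≤n : 8 ≤ n
          8≤n = ≤-trans (m≤n+m 8 L) (<⇒≤ L+8<n)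
          -- From 2 ^ L < 2 m < 2 ^ 15 n and n < 2 ^ (ℓ + 1). Select therefore costs only O(n) bits
          -- in the dense case, and nearly all of n L is available for samples.
          lowBits≤ : lowBits ≤ 15
          lowBits≤ = m≤n+o⇒m∸n≤o L ℓ (s≤s⁻¹ (≤-trans (2^-cancel-< (<-≤-trans 2^L< (≤-trans (*-monoˡ-≤ (2 ^ 15) (<⇒≤ n<2^ℓ+1)) (≤-reflexive (sym (2^-+ (suc ℓ) 15)))))) (≤-reflexive refl)))
          ν≤2n : ν ≤ n * 2
          ν≤2n = ≤-trans (≤-reflexive (+-assoc n LL 1)) (≤-trans (+-monoʳ-≤ n (≤-trans (+-mono-≤ LL≤L (≤ᵇ⇒≤ 1 8 tt)) (<⇒≤ L+8<n))) (≤-reflexive (trans (cong (n +_) (sym (+-identityʳ n))) (*-comm 2 n))))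
          8samples≤ : samples * 8 ≤ n * 2
          8samples≤ = ≤-trans (≤-reflexive (*-distribʳ-+ 8 (m ÷ G) 1)) (≤-trans (+-mono-≤ (<⇒≤ q) 8≤n) (≤-reflexive (trans (cong (n +_) (sym (+-identityʳ n))) (*-comm 2 n))))
            where
            q : m ÷ G * 8 < n
            q = *-cancelʳ-< 16384 (m ÷ G * 8) n (≤-<-trans (≤-trans (≤-reflexive (trans (*-assoc (m ÷ G) 8 16384) (cong (λ z → m ÷ G * 2 ^ z) (sym G-def)))) (m/n*n≤m m (2 ^ G) {{m^n≢0 2 G}})) m<)
          D : ℕ
          D = samples * lg (1 + m)
          8D≤ : D * 8 ≤ n * L * 4
          8D≤ = begin
            samples * lg (1 + m) * 8 ≤⟨ *-monoˡ-≤ 8 (*-monoʳ-≤ samples (≤-trans log1+m (≤-trans (+-monoˡ-≤ L 1≤L) (≤-reflexive (ring₁ L))))) ⟩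
            samples * (L * 2) * 8 ≡⟨ ring₂ samples L ⟩
            samples * 8 * (L * 2) ≤⟨ *-monoˡ-≤ (L * 2) 8samples≤ ⟩
            n * 2 * (L * 2) ≡⟨ ring₃ n L ⟩
            n * L * 4 ∎
            where
            open ≤-Reasoning
            ring₁ : ∀ l → l + l ≡ l * 2
            ring₁ = solve-∀
            ring₂ : ∀ s l → s * (l * 2) * 8 ≡ s * 8 * (l * 2)
            ring₂ = solve-∀
            ring₃ : ∀ n l → n * 2 * (l * 2) ≡ n * l * 4
            ring₃ = solve-∀
          main≤ : n * lowBits + 0 + D ≤ n * L
          main≤ = *-cancelʳ-≤ (n * lowBits + 0 + D) (n * L) 8 (begin
            (n * lowBits + 0 + D) * 8 ≡⟨ ring₁ n lowBits D ⟩
            n * (lowBits * 8) + D * 8 ≤⟨ +-mono-≤ (*-monoʳ-≤ n (≤-trans (*-monoˡ-≤ 8 lowBits≤) (≤-trans (≤ᵇ⇒≤ 120 256 tt) (*-monoˡ-≤ 4 64≤L)))) 8D≤ ⟩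
            n * (L * 4) + n * L * 4 ≡⟨ ring₂ n L ⟩
            n * L * 8 ∎)
            where
            open ≤-Reasoning
            ring₁ : ∀ n a d → (n * a + 0 + d) * 8 ≡ n * (a * 8) + d * 8
            ring₁ = solve-∀
            ring₂ : ∀ n l → n * (l * 4) + n * l * 4 ≡ n * l * 8
            ring₂ = solve-∀
          -- In eighths of n L: the samples take four, and the low bits and all overhead are O(n),
          -- which is below the remaining four since `K₂≤E` makes L large.
          total<nL : total < n * L
          total<nL = *-cancelʳ-< 8 total (n * L) (begin-strict
            total * 8 ≤⟨ *-monoˡ-≤ 8 total-≤ ⟩
            (n * lowBits + 0 + D + ν * k₂) * 8 ≡⟨ ring₁ n lowBits D ν k₂ ⟩
            n * (lowBits * 8) + D * 8 + ν * (k₂ * 8) ≤⟨ +-mono-≤ (+-mono-≤ (*-monoʳ-≤ n (*-monoˡ-≤ 8 lowBits≤)) 8D≤) (*-monoˡ-≤ (k₂ * 8) ν≤2n) ⟩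
            n * 120 + n * L * 4 + n * 2 * (k₂ * 8) ≡⟨ ring₂ n 120 (n * L * 4) k₂ ⟩
            n * (120 + 16 * k₂) + n * L * 4 <⟨ +-monoˡ-< (n * L * 4) (*-monoʳ-< n {{>-nonZero (≤-trans (s≤s z≤n) 8≤n)}} (<-≤-trans (+-monoˡ-< (16 * k₂) (<ᵇ⇒< 120 124 tt)) (≤-trans (≤-reflexive (ring₃ k₂)) (*-monoˡ-≤ 4 (≤-trans K₂≤E E≤L))))) ⟩
            n * (L * 4) + n * L * 4 ≡⟨ ring₄ n L ⟩
            n * L * 8 ∎)
            where
            open ≤-Reasoning
            ring₁ : ∀ n a d v k → (n * a + 0 + d + v * k) * 8 ≡ n * (a * 8) + d * 8 + v * (k * 8)
            ring₁ = solve-∀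
            ring₂ : ∀ n x y k → n * x + y + n * 2 * (k * 8) ≡ n * (x + 16 * k) + y
            ring₂ = solve-∀
            ring₃ : ∀ k → 124 + 16 * k ≡ (31 + 4 * k) * 4
            ring₃ = solve-∀
            ring₄ : ∀ n l → n * (l * 4) + n * l * 4 ≡ n * l * 8
            ring₄ = solve-∀
          total< : total < w * m
          total< = <-≤-trans total<nL (≤-trans (*-mono-≤ n≤m L≤w) (≤-reflexive (*-comm m w)))
          G<2^w : G < 2 ^ w
          G<2^w = ≤-<-trans G≤K K<2^w

        module Co = Correct (λ _ → m^n>0 2 w) (λ _ → m^n>0 2 Y) (≤-trans size-≤ (+-monoˡ-≤ (ν * K₀) main≤)) total<
        open Co

        private
          sample-arr : Layout.Array image 2 samples sample
          sample-arr = Loaded.array-at loaded 2 w≥ sample< (m≤m+n 3 22) (≤-trans (+-monoˡ-≤ 1 (÷-≤ m G)) (≤-trans (≤-reflexive (+-comm m 1)) m<2^w)) refl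

        rank-ok : ∀ r → r < n → Machine.eval w μ (rankE G K) (w ∷ η ∷ H₀ ∷ X r ∷ n ∷ []) ≡ suc r
        rank-ok r r< = Query.Select.rankE-dense image highs lows X-split X<2^w X-inj n<2^w G K (X r) r r< refl (<-trans (X<m r r<) m<2^w) G<2^w sample-arr
            (subst (X r ÷ G <_) (+-comm 1 (m ÷ G)) (s≤s (/-monoˡ-≤ (2 ^ G) {{m^n≢0 2 G}} (<⇒≤ (X<m r r<)))))
            (lower-rank X n t r X-< r< t≤)
            (<-≤-trans (lower-near X n t (2 ^ G) r X-< r< t≤ x<) (+-monoʳ-≤ (lower X n t) (2^-≤ G≤K)))
          where
          x = X r
          t = x ÷ G * 2 ^ G
          t≤ : t ≤ x
          t≤ = m/n*n≤m x (2 ^ G) {{m^n≢0 2 G}}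
          x< : x < t + 2 ^ G
          x< = subst₂ _<_ (trans (cong (wrap G x +_) (*-comm (x ÷ G) (2 ^ G))) (sym (÷-split x G))) (+-comm (2 ^ G) t) (+-monoˡ-< t (wrap-< G x))

        module R = Run rank-ok

        dense-result : Result
        dense-result = bs , ≤-trans (≤-reflexive (length-bitsOf total V)) (≤-trans (<⇒≤ total<nL) (≤-trans (m≤m+n (n * L) Z) (m≤m+n _ _)))
          , R.rank-correct , R.select-correct

      dictionary : Result
      dictionary with n * 16384 ≤? m
      ... | yes l = Sparse.sparse-result l
      ... | no ¬l = Dense.dense-result (≰⇒> ¬l)

-- Universes of bounded size, and the final assembly.

open BitFields
open StraightLine
open CommonMultiples
open Tabulating
open Startup
open SortedElements
open Structure
open import Defs
open import Data.Nat.Logarithm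
open import Data.Maybe using (just; nothing)
open import Data.Vec using ([]; _∷_)
open import Data.List using (List; length)
open import Data.Fin using (toℕ)
open import Data.Fin.Properties using (toℕ<n)
open import Data.Fin.Subset using (Subset; ∣_∣)

-- Shifted by one, leaving 0 for absence as in `rankOut`.
indexOf : (ℕ → ℕ) → ℕ → ℕ → ℕ
indexOf X zero x = 0
indexOf X (suc n) x = if X n ≡ᵇ x then suc n else indexOf X n x

indexOf-≤ : ∀ X n x → indexOf X n x ≤ n
indexOf-≤ X zero x = z≤n
indexOf-≤ X (suc n) x with X n ≡ᵇ x
... | true = ≤-refl
... | false = m≤n⇒m≤1+n (indexOf-≤ X n x)

indexOf-suc : ∀ X n x r → indexOf X n x ≡ suc r → X r ≡ x
indexOf-suc X (suc n) x r e with X n ≡ᵇ x in q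
... | true = subst (λ z → X z ≡ x) (suc-injective e) (≡ᵇ-true q)
... | false = indexOf-suc X n x r e

indexOf-absent : ∀ X n x → (∀ i → i < n → X i ≢ x) → indexOf X n x ≡ 0
indexOf-absent X zero x ne = refl
indexOf-absent X (suc n) x ne with X n ≡ᵇ x in q
... | true = contradiction (≡ᵇ-true q) (ne n ≤-refl)
... | false = indexOf-absent X n x (λ i i< → ne i (m<n⇒m<1+n i<))

indexOf-present : ∀ X n r → InjectiveOn n X → r < n → indexOf X n (X r) ≡ suc r
indexOf-present X (suc n) r inj r< with X n ≡ᵇ X r in q
... | true = cong suc (inj n r ≤-refl r< (≡ᵇ-true q))
... | false with m≤n⇒m<n∨m≡n (s≤s⁻¹ r<)
... | inj₁ l = indexOf-present X n r (λ i j i< j< → inj i j (m<n⇒m<1+n i<) (m<n⇒m<1+n j<)) l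
... | inj₂ refl = contradiction (trans (sym (≡⇒true {X n} refl)) q) λ ()

module SmallUniverse (m n w E G K : ℕ) (1≤m : 1 ≤ m) (n≤m : n ≤ m) (m<2^w : m < 2 ^ w) (m<2^E : m < 2 ^ E) (1≤w : 1 ≤ w)
  {S : Subset m} (en : Enumeration n S) where
  open Enumeration en

  private
    instance
      w≢0 : NonZero w
      w≢0 = >-nonZero 1≤w

    entry : ℕ → ℕ
    entry = indexOf X n

    entry< : ∀ x → x < m → entry x < 2 ^ w
    entry< x _ = ≤-<-trans (≤-trans (indexOf-≤ X n x) n≤m) m<2^w

  -- One full word per element of the universe, without header, so that the query itself is the
  -- address. With m < 2 ^ E and w ≤ c * E this is a constant number of bits, covered by f.
  bs : List Bool
  bs = bitsOf (m * w) (arr w m entry)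

  private
    μ : ℕ → ℕ
    μ = wordOf w bs

    μ-entry : ∀ x → x < m → μ x ≡ entry x
    μ-entry x x< = trans (wordOf-rd w (m * w) (arr w m entry) x (arr-< w m entry entry<)) (arr-rd w m entry entry< x x<)

    n<2^w : n < 2 ^ w
    n<2^w = ≤-<-trans n≤m m<2^w

    R₀ : ℕ → ℕ → ℕ
    R₀ q = reg (initState w bs q m n)

    match : ∀ q → Machine.Match w μ 3 (R₀ q) args (q ∷ m ∷ n ∷ [])
    match q = (s≤s z≤n , refl) , (s≤s (s≤s z≤n) , refl) , (s≤s (s≤s (s≤s z≤n)) , refl) , tt

    not-large : ∀ q → Machine.eval w μ (largeE E) (q ∷ m ∷ n ∷ []) ≡ 0
    not-large q = trans (Small.largeE-spec w μ E m<2^w) (m<n⇒m/n≡0 {{m^n≢0 2 E}} m<2^E)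

    open Branch w μ using (Outcome)
    open Outcomes w μ

  rank-correct : RankCorrect w (rankProgram E G K) (length (rankProgram E G K)) n S bs
  rank-correct x = conclude (Runs.rank-small w μ (R₀ (toℕ x)) (toℕ x) m n (match (toℕ x)) E G K (not-large (toℕ x))) (rank-X x)
    where
    looked-up : Machine.eval w μ lookupE (toℕ x ∷ m ∷ n ∷ []) ≡ entry (toℕ x)
    looked-up = trans (Small.lookupE-spec w μ) (μ-entry (toℕ x) (toℕ<n x))
    conclude : Runs.Runs-to w μ (R₀ (toℕ x)) (toℕ x) m n (match (toℕ x)) (rankProgram E G K) lookupE →
      (∃ λ r → r < n × X r ≡ toℕ x × rankS x S ≡ val r) ⊎ ((∀ i → i < n → X i ≢ toℕ x) × rankS x S ≡ minusOne) →
      Σ State λ s → (runWithin w (rankProgram E G K) (length (rankProgram E G K)) (initState w bs (toℕ x) m n) ≡ just s) × (rankOut s ≡ rankS x S)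
    conclude (s , run , out) (inj₁ (r , r< , Xr , e)) = s , run
      , trans (outcome-rank s r (≤-<-trans r< n<2^w) (subst (Outcome s) (trans looked-up (subst (λ z → entry z ≡ suc r) Xr (indexOf-present X n r X-inj r<))) out)) (sym e)
    conclude (s , run , out) (inj₂ (ne , e)) = s , run
      , trans (outcome-absent s (subst (Outcome s) (trans looked-up (indexOf-absent X n (toℕ x) ne)) out)) (sym e)

  select-correct : SelectCorrect w (selectProgram E) (length (selectProgram E)) n S bs
  select-correct i i< = conclude (Runs.select-small w μ (R₀ i) i m n (match i) E (not-large i))
    where
    i+1< : i + 1 < 2 ^ w
    i+1< = ≤-<-trans (≤-trans (≤-reflexive (+-comm i 1)) i<) n<2^w
    found : Machine.eval w μ (findE (2 ^ E)) (i ∷ m ∷ n ∷ []) ≡ X i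
    found = Small.findE-spec w μ m i (X i) 1≤m m<2^w (X<m i i<) i+1<
      (trans (μ-entry (X i) (X<m i i<)) (trans (indexOf-present X n i X-inj i<) (+-comm 1 i)))
      (λ y y< e → sym (indexOf-suc X n y i (trans (sym (μ-entry y y<)) (trans e (+-comm i 1)))))
      (2 ^ E) (<-trans i< n<2^w) (<⇒≤ m<2^E)
    conclude : Runs.Runs-to w μ (R₀ i) i m n (match i) (selectProgram E) (findE (2 ^ E)) →
      Σ State λ s → (runWithin w (selectProgram E) (length (selectProgram E)) (initState w bs i m n) ≡ just s) × (selectS i S ≡ just (reg s 0))
    conclude (s , run , out) = s , run , trans (select-X i i<) (cong just (sym (outcome-0 s (<-trans (X<m i i<) m<2^w) (subst (Outcome s) found out))))

runWithin-mono : ∀ w P {T T′ s s′} → T ≤ T′ → runWithin w P T s ≡ just s′ → runWithin w P T′ s ≡ just s′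
runWithin-mono w P {T} {T′} {s} l e with step w P s
runWithin-mono w P {T} {T′} l e | nothing = e
runWithin-mono w P {suc T} {suc T′} (s≤s l) e | just _ = runWithin-mono w P l e

theorem3p1 : ∀ (c : ℕ) → 1 ≤ c →
    Σ (ℕ → ℕ) λ f → LittleO-n f × Σ ℕ λ C →
    Σ Program λ Pr → Σ Program λ Ps → Σ ℕ λ T →
    ∀ (m : ℕ) → 1 ≤ m → ∀ (n : ℕ) → n ≤ m →
    ∀ (S : Subset m) → ∣ S ∣ ≡ n →
    ∀ (w : ℕ) → ⌈log₂ (1 + m) ⌉ ≤ w → w ≤ c * ⌈log₂ (1 + m) ⌉ →
    Σ (List Bool) λ bs →
    (length bs ≤ n * ⌈log₂ m ⌉ + f n + C * ⌈log₂ ⌈log₂ m ⌉ ⌉)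
    × IndexableDictionary w Pr Ps T n S bs
theorem3p1 c _ = (λ _ → Z) , (λ k _ → k * Z , λ _ l → l) , K₂ c , Pr , Ps , length Pr + length Ps , construct
  where
  open Constants c
  Pr Ps : Program
  Pr = rankProgram E G K
  Ps = selectProgram E
  weaken : ∀ {m n w} {S : Subset m} {bs} → RankCorrect w Pr (length Pr) n S bs → SelectCorrect w Ps (length Ps) n S bs →
    IndexableDictionary w Pr Ps (length Pr + length Ps) n S bs
  weaken {w = w} r s = (λ x → let (t , run , ok) = r x in t , runWithin-mono w Pr (m≤m+n (length Pr) (length Ps)) run , ok)
    , (λ i i< → let (t , run , ok) = s i i< in t , runWithin-mono w Ps (m≤n+m (length Ps) (length Pr)) run , ok)
  construct : ∀ (m : ℕ) → 1 ≤ m → ∀ (n : ℕ) → n ≤ m → ∀ (S : Subset m) → ∣ S ∣ ≡ n →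
    ∀ (w : ℕ) → ⌈log₂ (1 + m) ⌉ ≤ w → w ≤ c * ⌈log₂ (1 + m) ⌉ →
    Σ (List Bool) λ bs → (length bs ≤ n * ⌈log₂ m ⌉ + Z + K₂ c * ⌈log₂ ⌈log₂ m ⌉ ⌉) × IndexableDictionary w Pr Ps (length Pr + length Ps) n S bs
  construct m 1≤m n n≤m S S-size w w≥ w≤ = case (2 ^ E ≤? m)
    where
    w≥′ : lg (1 + m) ≤ w
    w≥′ = subst (_≤ w) (lg-def (1 + m)) w≥
    w≤′ : w ≤ c * lg (1 + m)
    w≤′ = subst (λ z → w ≤ c * z) (lg-def (1 + m)) w≤
    en : Enumeration n S
    en = enumerate n S S-size
    case : Dec (2 ^ E ≤ m) → Σ (List Bool) λ bs → (length bs ≤ n * ⌈log₂ m ⌉ + Z + K₂ c * ⌈log₂ ⌈log₂ m ⌉ ⌉) × IndexableDictionary w Pr Ps (length Pr + length Ps) n S bs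
    case (yes l) =
      let (bs , size , r , s) = Setting.Store.dictionary c m n w 1≤m n≤m w≥′ w≤′ l en
      in bs , ≤-trans size (≤-reflexive (cong₂ (λ x y → n * x + Z + K₂ c * y) L-eq LL-eq)) , weaken r s
      where
      L-eq : Setting.L c m n w 1≤m n≤m w≥′ w≤′ ≡ ⌈log₂ m ⌉
      L-eq = trans (Setting.L-def c m n w 1≤m n≤m w≥′ w≤′) (sym (lg-def m))
      LL-eq : Setting.LL c m n w 1≤m n≤m w≥′ w≤′ ≡ ⌈log₂ ⌈log₂ m ⌉ ⌉
      LL-eq = trans (Setting.LL-def c m n w 1≤m n≤m w≥′ w≤′) (trans (cong lg (sym (lg-def m))) (sym (lg-def ⌈log₂ m ⌉)))
    case (no ¬l) = Sm.bs , ≤-trans (≤-trans (≤-reflexive (length-bitsOf (m * w) _)) size) (≤-trans (m≤n+m Z (n * ⌈log₂ m ⌉)) (m≤m+n _ _)) , weaken Sm.rank-correct Sm.select-correct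
      where
      m<2^E : m < 2 ^ E
      m<2^E = ≰⇒> ¬l
      w≤cE : w ≤ c * E
      w≤cE = ≤-trans w≤′ (*-monoʳ-≤ c (lg-≤ m<2^E))
      m<2^w : m < 2 ^ w
      m<2^w = ≤-trans (lg-≥ (1 + m)) (2^-≤ w≥′)
      1≤w : 1 ≤ w
      1≤w = ≤-trans (subst (_≤ lg (1 + m)) lg-2 (lg-mono (s≤s 1≤m))) w≥′
      size : m * w ≤ Z
      size = ≤-trans (*-mono-≤ (<⇒≤ m<2^E) w≤cE) small≤Z
      module Sm = SmallUniverse m n w E G K 1≤m n≤m m<2^w m<2^E 1≤w en
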